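{- A signed permutation $w \in \mathfrak{S}_n^D$ has boolean principal order ideal $B(w)$ in the Bruhat order of $\mathfrak{S}_n^D$ if and only if $w$ avoids all of the signed patterns $$\underline{1}\,\underline{2}\,\underline{3},\ \underline{1}\,\underline{3}\,\underline{2},\ \underline{2}\,\underline{1}\,\underline{3},\ \underline{2}\,\underline{3}\,\underline{1},\ \underline{3}\,\underline{1}\,\underline{2},\ \underline{3}\,\underline{2}\,\underline{1},\ 321,\ 3412,\ 32\underline{1},\ 3\underline{1}\,\underline{2},\ 34\underline{1}2,\ 34\underline{2}\,\underline{1},$$ $$\underline{3}21,\ \underline{2}\,\underline{3}1,\ \underline{3}412,\ \underline{4}\,\underline{3}12,\ 1\underline{2},\ 3\underline{2}1,\ \underline{3}2\underline{1},\ \underline{3}4\underline{1}2,$$ where $\underline{i}$ denotes $-i$ (some of these patterns have an odd number of negative entries).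
   Context: $\mathfrak{S}_n^B$ is the group of signed permutations of $\{\pm1,\dots,\pm n\}$ (bijections with $w(-i)=-w(i)$), written in one-line notation $w(1)\cdots w(n)$. $\mathfrak{S}_n^D$ is the subgroup of those with an even number of negative entries in one-line notation; it is the Coxeter group of type $D$ generated by $s_{1'} = \underline{2}\,\underline{1}3\cdots n$ and $s_i = 1\cdots(i-1)(i+1)i(i+2)\cdots n$ for $i\in[n-1]$, functions composed right-to-left. Length $\ell$ is the minimal number of generators in a product expression. Bruhat order on $\mathfrak{S}_n^D$: generated by $w\lessdot w'$ whenever $\ell(w')=\ell(w)+1$ and $w'=tw$ for $t$ conjugate in $\mathfrak{S}_n^D$ to a generator; $B(w)=\{v:v\le w\}$; boolean means isomorphic to the subset lattice of some $\{1,\dots,r\}$. For a signed pattern $p\in\mathfrak{S}_k^B$, $w$ contains $p$ if there exist $0<i_1<\cdots<i_k$ such that $w(i_j)$ and $p(j)$ have the same sign for each $j$ and $|w(i_1)|\cdots|w(i_k)|$ is in the same relative order as $|p(1)|\cdots|p(k)|$; otherwise $w$ avoids $p$. -}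

module Defs where

open import Data.Nat as ℕ using (ℕ; zero; suc; _<_; _≤_; _%_; _≡ᵇ_)
open import Data.Integer as ℤ using (ℤ; +_; -[1+_]; ∣_∣; sign)
open import Data.Bool using (Bool; true; false; if_then_else_)
open import Data.Fin as Fin using (Fin; toℕ)
open import Data.Fin.Subset using (Subset; _⊆_)
open import Data.Vec using (Vec; []; _∷_; lookup; map; tabulate; toList)
open import Data.List as List using (List; foldr)
open import Data.List.Relation.Unary.All using (All)
open import Data.List.Relation.Unary.Unique.Propositional using (Unique)
open import Data.Product using (Σ; ∃; _×_; _,_)
open import Relation.Binary.PropositionalEquality using (_≡_)
open import Relation.Binary.Construct.Closure.ReflexiveTransitive using (Star)
open import Relation.Nullary using (¬_)
open import Function.Bundles using (_⇔_)

-- A signed permutation of {±1,…,±n} is represented by its one-line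
-- notation w(1)⋯w(n) as a vector of integers.

IsSignedPerm : ∀ {n} → Vec ℤ n → Set
IsSignedPerm {n} w =
  All (λ x → 1 ≤ ∣ x ∣ × ∣ x ∣ ≤ n) (toList w) × Unique (List.map ∣_∣ (toList w))

negCount : ∀ {n} → Vec ℤ n → ℕ
negCount [] = 0
negCount (+ _ ∷ w) = negCount w
negCount (-[1+ _ ] ∷ w) = suc (negCount w)

InD : ∀ {n} → Vec ℤ n → Set
InD w = IsSignedPerm w × negCount w % 2 ≡ 0

apply : ∀ {n} → Vec ℤ n → ℤ → ℤ
apply {n} w (+ zero) = + 0
apply {n} w (+ (suc j)) with j ℕ.<? n
... | Relation.Nullary.yes p = lookup w (Fin.fromℕ< p)
... | Relation.Nullary.no _ = + 0
apply {n} w -[1+ j ] = ℤ.- apply w (+ (suc j))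

_∘ₛ_ : ∀ {n} → Vec ℤ n → Vec ℤ n → Vec ℤ n
u ∘ₛ v = map (apply u) v

identity : ∀ {n} → Vec ℤ n
identity = tabulate (λ k → + suc (toℕ k))

sᵢ : ∀ {n} → ℕ → Vec ℤ n
sᵢ i = tabulate (λ k → + f (suc (toℕ k)))
  where
  f : ℕ → ℕ
  f m = if m ≡ᵇ i then suc i else (if m ≡ᵇ suc i then i else m)

s1' : ∀ {n} → Vec ℤ n
s1' = tabulate (λ k → f (suc (toℕ k)))
  where
  f : ℕ → ℤ
  f 1 = ℤ.- (+ 2)
  f 2 = ℤ.- (+ 1)
  f m = + m

data IsGen (n : ℕ) : Vec ℤ n → Set where
  gen-s  : ∀ i → 1 ≤ i → i < n → IsGen n (sᵢ i)
  gen-1' : 2 ≤ n → IsGen n s1'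

product : ∀ {n} → List (Vec ℤ n) → Vec ℤ n
product = foldr _∘ₛ_ identity

IsWord : ∀ {n} → Vec ℤ n → List (Vec ℤ n) → Set
IsWord {n} w gs = All (IsGen n) gs × product gs ≡ w

HasLength : ∀ {n} → Vec ℤ n → ℕ → Set
HasLength w k =
  (∃ λ gs → IsWord w gs × List.length gs ≡ k) ×
  (∀ gs → IsWord w gs → k ≤ List.length gs)

-- t is conjugate in 𝔖ⁿ_D to a generator: t = g s g⁻¹, i.e. t g = g s
IsReflection : ∀ {n} → Vec ℤ n → Set
IsReflection {n} t = ∃ λ g → ∃ λ s → InD g × IsGen n s × t ∘ₛ g ≡ g ∘ₛ s

_⋖_ : ∀ {n} → Vec ℤ n → Vec ℤ n → Set
w ⋖ w' = ∃ λ k → HasLength w k × HasLength w' (suc k) ×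
         ∃ λ t → IsReflection t × w' ≡ t ∘ₛ w

_≤B_ : ∀ {n} → Vec ℤ n → Vec ℤ n → Set
_≤B_ = Star _⋖_

BooleanIdeal : ∀ {n} → Vec ℤ n → Set
BooleanIdeal {n} w = ∃ λ r → ∃ λ (f : Vec ℤ n → Subset r) →
  (∀ u v → u ≤B w → v ≤B w → f u ≡ f v → u ≡ v) ×
  (∀ S → ∃ λ v → v ≤B w × f v ≡ S) ×
  (∀ u v → u ≤B w → v ≤B w → (u ≤B v ⇔ f u ⊆ f v))

Contains : ∀ {n k} → Vec ℤ n → Vec ℤ k → Set
Contains {n} {k} w p = ∃ λ (ι : Fin k → Fin n) →
  (∀ a b → a Fin.< b → ι a Fin.< ι b) ×
  (∀ a → sign (lookup w (ι a)) ≡ sign (lookup p a)) ×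
  (∀ a b → (∣ lookup w (ι a) ∣ < ∣ lookup w (ι b) ∣) ⇔ (∣ lookup p a ∣ < ∣ lookup p b ∣))

Avoids : ∀ {n k} → Vec ℤ n → Vec ℤ k → Set
Avoids w p = ¬ Contains w p

⁺ : ℕ → ℤ
⁺ i = + i

⁻ : ℕ → ℤ
⁻ i = ℤ.- (+ i)

Pattern : Set
Pattern = Σ ℕ (Vec ℤ)

patterns : List Pattern
patterns =
  (3 , ⁻ 1 ∷ ⁻ 2 ∷ ⁻ 3 ∷ []) List.∷
  (3 , ⁻ 1 ∷ ⁻ 3 ∷ ⁻ 2 ∷ []) List.∷
  (3 , ⁻ 2 ∷ ⁻ 1 ∷ ⁻ 3 ∷ []) List.∷
  (3 , ⁻ 2 ∷ ⁻ 3 ∷ ⁻ 1 ∷ []) List.∷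
  (3 , ⁻ 3 ∷ ⁻ 1 ∷ ⁻ 2 ∷ []) List.∷
  (3 , ⁻ 3 ∷ ⁻ 2 ∷ ⁻ 1 ∷ []) List.∷
  (3 , ⁺ 3 ∷ ⁺ 2 ∷ ⁺ 1 ∷ []) List.∷
  (4 , ⁺ 3 ∷ ⁺ 4 ∷ ⁺ 1 ∷ ⁺ 2 ∷ []) List.∷
  (3 , ⁺ 3 ∷ ⁺ 2 ∷ ⁻ 1 ∷ []) List.∷
  (3 , ⁺ 3 ∷ ⁻ 1 ∷ ⁻ 2 ∷ []) List.∷
  (4 , ⁺ 3 ∷ ⁺ 4 ∷ ⁻ 1 ∷ ⁺ 2 ∷ []) List.∷
  (4 , ⁺ 3 ∷ ⁺ 4 ∷ ⁻ 2 ∷ ⁻ 1 ∷ []) List.∷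
  (3 , ⁻ 3 ∷ ⁺ 2 ∷ ⁺ 1 ∷ []) List.∷
  (3 , ⁻ 2 ∷ ⁻ 3 ∷ ⁺ 1 ∷ []) List.∷
  (4 , ⁻ 3 ∷ ⁺ 4 ∷ ⁺ 1 ∷ ⁺ 2 ∷ []) List.∷
  (4 , ⁻ 4 ∷ ⁻ 3 ∷ ⁺ 1 ∷ ⁺ 2 ∷ []) List.∷
  (2 , ⁺ 1 ∷ ⁻ 2 ∷ []) List.∷
  (3 , ⁺ 3 ∷ ⁻ 2 ∷ ⁺ 1 ∷ []) List.∷
  (3 , ⁻ 3 ∷ ⁺ 2 ∷ ⁻ 1 ∷ []) List.∷
  (4 , ⁻ 3 ∷ ⁺ 4 ∷ ⁻ 1 ∷ ⁺ 2 ∷ []) List.∷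
  List.[]

AvoidsAll : ∀ {n} → Vec ℤ n → Set
AvoidsAll w = All (λ p → Avoids w (Data.Product.proj₂ p)) patterns

{-# OPTIONS --safe #-}
module Submission where

-- B(w) is boolean iff w has a word in which no generator occurs twice.  If the letters are distinct,
-- the elements below w are the products of the subwords (strong exchange), and the subword can be
-- recovered from its product: letter i occurs in it iff the product moves the i-th fundamental weight.
-- Conversely an ideal isomorphic to a subset lattice has ℓ(w) atoms, which are letters of a reduced word.
--
-- For n ≥ 4 the last generator commutes with all generators but one, so a word with distinct letters can
-- be rewritten with that generator at one end.  In one-line notation: +n is in one of the last two
-- places, or n - 1 is the last entry, and what remains is such an element of rank n - 1.  Inserting the
-- large entry cannot create a pattern, and avoidance of the patterns forces one of these three shapes.
-- The ranks n ≤ 3 are checked by computation.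

open import Data.Bool using (true; false; T; if_then_else_)
open import Data.Empty using (⊥; ⊥-elim)
open import Data.Fin as Fin using (Fin; toℕ; #_)
import Data.Fin.Properties as Fin
open import Data.Fin.Subset as Subset using (Subset)
import Data.Fin.Subset.Properties as Subset
open import Data.Integer as ℤ using (ℤ; +_; -[1+_]; ∣_∣; -_; _<_; +<+; -<+; -<-; sign)
import Data.Integer.Properties as ℤ
open import Data.List as List using (List; []; _∷_; _++_; length; reverse)
import Data.List.Properties as List
open import Data.Nat as ℕ using (ℕ; zero; suc; z≤n; s≤s; _%_)
import Data.Nat.Properties as ℕ
open import Data.List.Membership.DecPropositional ℕ._≟_ using (_∈?_)
open import Data.List.Membership.Propositional using (_∈_; _∉_; find)
open import Data.List.Membership.Propositional.Properties using (∈-∃++; ∈-++⁻; ∈-++⁺ˡ; ∈-++⁺ʳ; ∈-lookup)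
open import Data.List.Relation.Binary.Sublist.Propositional as Sublist using ([]; _∷_; _∷ʳ_; ⊆-refl; ⊆-trans) renaming (_⊆_ to _⊑_)
import Data.List.Relation.Binary.Sublist.Propositional.Properties as Sublist
open import Data.List.Relation.Unary.All as All using (All; []; _∷_)
import Data.List.Relation.Unary.All.Properties as All
open import Data.List.Relation.Unary.AllPairs using ([]; _∷_)
open import Data.List.Relation.Unary.Any as Any using (here; there; Any)
import Data.List.Relation.Unary.Any.Properties as Any
open import Data.List.Relation.Unary.Unique.DecPropositional ℕ._≟_ using (unique?)
open import Data.List.Relation.Unary.Unique.Propositional using (Unique)
import Data.List.Relation.Unary.Unique.Propositional.Properties as Unique
open import Data.Product using (∃; _×_; _,_; proj₁; proj₂)
open import Data.Sign as Sign using (Sign)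
import Data.Sign.Properties as Sign
open import Data.Sum using (_⊎_; inj₁; inj₂)
open import Data.Unit using (⊤; tt)
open import Data.Vec as Vec using (Vec; []; _∷_; lookup; tabulate; toList)
import Data.Vec.Properties as Vec
import Data.Vec.Relation.Unary.All as VecAll
import Data.Vec.Relation.Unary.All.Properties as VecAll
open import Function using (_∘_)
open import Function.Bundles using (_⇔_; mk⇔; Equivalence)
open import Function.Construct.Composition using (_⇔-∘_)
open import Function.Construct.Symmetry using (⇔-sym)
open import Relation.Binary.Construct.Closure.ReflexiveTransitive using (ε; _◅_; _◅◅_)
open import Relation.Binary.Definitions using (tri<; tri≈; tri>)
open import Relation.Binary.PropositionalEquality
open import Relation.Nullary using (¬_; Dec; yes; no)
open import Relation.Nullary.Decidable using (map′; _×-dec_; _→-dec_; ¬?; from-yes)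
open import Algebra.Properties.CommutativeSemigroup Sign.*-commutativeSemigroup using (x∙yz≈y∙xz)
open import Defs

-- Words act as functions on all integers, and the rank enters only as a bound on absolute values. A
-- root is a pair of signed values, and it is made negative when the order of the pair is reversed.
-- Strong exchange therefore needs neither inversion sets nor a length formula: one follows a pair
-- along the word to the letter that reverses it. Lengths are bounded through supports instead:
-- every word for the product of distinct letters contains all of these letters.
--
-- The induction cannot start below n = 4: in rank 3 the last generator is joined to both others,
-- and only from rank 4 on does it have a single neighbour.
--
-- The list of patterns is used asymmetrically. Above rank 3, the proof that distinct letters imply
-- avoidance needs one numerical property of the list, `Dominated`, which is checked by computation.
-- The converse follows the places of the entries of absolute value n and n - 1 in `LargeEntries`,
-- and there each of the twenty patterns excludes some configuration.

-- Roots and reflections of type D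

-- The pair stands for the vector e_b - e_a, where e_(-i) = - e_i; it is a positive root when
-- `a < b`. The condition `a≢-b` excludes the change of a single sign, which is a reflection of type
-- B but not of type D.
record Root (a b : ℤ) : Set where
  field
    a≢0  : a ≢ + 0
    b≢0  : b ≢ + 0
    a≢b  : a ≢ b
    a≢-b : a ≢ - b

open Root

x≢-x : ∀ {x} → x ≢ + 0 → x ≢ - x
x≢-x {+ zero}   x≢0 _ = x≢0 refl
x≢-x {+ suc _}  x≢0 ()
x≢-x { -[1+ _ ]} x≢0 ()

-- The graph of the reflection exchanging a with b and - a with - b.
data Refl (a b x : ℤ) : ℤ → Set where
  atA  : x ≡ a → Refl a b x b
  atB  : x ≡ b → Refl a b x a
  at-A : x ≡ - a → Refl a b x (- b)
  at-B : x ≡ - b → Refl a b x (- a)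
  off  : x ≢ a → x ≢ b → x ≢ - a → x ≢ - b → Refl a b x x

reflView : ∀ a b x → ∃ (Refl a b x)
reflView a b x with x ℤ.≟ a | x ℤ.≟ b | x ℤ.≟ - a | x ℤ.≟ - b
... | yes p | _     | _     | _     = b , atA p
... | no _  | yes p | _     | _     = a , atB p
... | no _  | no _  | yes p | _     = - b , at-A p
... | no _  | no _  | no _  | yes p = - a , at-B p
... | no p  | no q  | no r  | no s  = x , off p q r s

opaque
  -- Opaque, so that goals keep the reflection folded instead of exposing four equality tests.
  -- Reasoning goes through `refl-view` and `refl-unique`; only the finite tables unfold it.
  refl⟨_,_⟩ : ℤ → ℤ → ℤ → ℤ
  refl⟨ a , b ⟩ x = proj₁ (reflView a b x)

  refl-view : ∀ a b x → Refl a b x (refl⟨ a , b ⟩ x)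
  refl-view a b x = proj₂ (reflView a b x)

-- The root conditions make `a`, `b`, `- a`, `- b` four different values, so no two constructors
-- with different results can apply to the same `x`. Consequently a value of the reflection is
-- computed by naming a constructor.
Refl-functional : ∀ {a b x y z} → Root a b → Refl a b x y → Refl a b x z → y ≡ z
Refl-functional {a} {b} R = go
  where
  aa : a ≢ - a
  aa = x≢-x (a≢0 R)
  bb : b ≢ - b
  bb = x≢-x (b≢0 R)
  ba : b ≢ - a
  ba e = a≢-b R (trans (sym (ℤ.neg-involutive a)) (cong -_ (sym e)))
  go : ∀ {x y z} → Refl a b x y → Refl a b x z → y ≡ z
  go (atA p)  (atA q)  = refl
  go (atA p)  (atB q)  = ⊥-elim (a≢b R (trans (sym p) q))
  go (atA p)  (at-A q) = ⊥-elim (aa (trans (sym p) q))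
  go (atA p)  (at-B q) = ⊥-elim (a≢-b R (trans (sym p) q))
  go (atA p)  (off n _ _ _) = ⊥-elim (n p)
  go (atB p)  (atA q)  = ⊥-elim (a≢b R (trans (sym q) p))
  go (atB p)  (atB q)  = refl
  go (atB p)  (at-A q) = ⊥-elim (ba (trans (sym p) q))
  go (atB p)  (at-B q) = ⊥-elim (bb (trans (sym p) q))
  go (atB p)  (off _ n _ _) = ⊥-elim (n p)
  go (at-A p) (atA q)  = ⊥-elim (aa (trans (sym q) p))
  go (at-A p) (atB q)  = ⊥-elim (ba (trans (sym q) p))
  go (at-A p) (at-A q) = refl
  go (at-A p) (at-B q) = ⊥-elim (a≢b R (ℤ.neg-injective (trans (sym p) q)))
  go (at-A p) (off _ _ n _) = ⊥-elim (n p)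
  go (at-B p) (atA q)  = ⊥-elim (a≢-b R (trans (sym q) p))
  go (at-B p) (atB q)  = ⊥-elim (bb (trans (sym q) p))
  go (at-B p) (at-A q) = ⊥-elim (a≢b R (ℤ.neg-injective (trans (sym q) p)))
  go (at-B p) (at-B q) = refl
  go (at-B p) (off _ _ _ n) = ⊥-elim (n p)
  go (off n _ _ _) (atA p)  = ⊥-elim (n p)
  go (off _ n _ _) (atB p)  = ⊥-elim (n p)
  go (off _ _ n _) (at-A p) = ⊥-elim (n p)
  go (off _ _ _ n) (at-B p) = ⊥-elim (n p)
  go (off _ _ _ _) (off _ _ _ _) = refl

refl-unique : ∀ {a b x y} → Root a b → Refl a b x y → refl⟨ a , b ⟩ x ≡ y
refl-unique R v = Refl-functional R (refl-view _ _ _) v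

Refl-sym : ∀ {a b x y} → Refl a b x y → Refl a b y x
Refl-sym (atA refl)  = atB refl
Refl-sym (atB refl)  = atA refl
Refl-sym (at-A refl) = at-B refl
Refl-sym (at-B refl) = at-A refl
Refl-sym (off p q r s) = off p q r s

Refl-swap : ∀ {a b x y} → Refl a b x y → Refl b a x y
Refl-swap (atA p)  = atB p
Refl-swap (atB p)  = atA p
Refl-swap (at-A p) = at-B p
Refl-swap (at-B p) = at-A p
Refl-swap (off p q r s) = off q p s r

Refl-map : ∀ {a b x y} (g : ℤ → ℤ) → (∀ {u v} → g u ≡ g v → u ≡ v) →
           (∀ u → g (- u) ≡ - g u) → Refl a b x y → Refl (g a) (g b) (g x) (g y)
Refl-map g inj odd (atA refl) = atA refl
Refl-map g inj odd (atB refl) = atB refl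
Refl-map {a} {b} g inj odd (at-A refl) = subst (Refl _ _ _) (sym (odd b)) (at-A (odd a))
Refl-map {a} {b} g inj odd (at-B refl) = subst (Refl _ _ _) (sym (odd a)) (at-B (odd b))
Refl-map {a} {b} g inj odd (off p q r s) =
  off (p ∘ inj) (q ∘ inj) (λ e → r (inj (trans e (sym (odd a))))) (λ e → s (inj (trans e (sym (odd b)))))

Refl-neg : ∀ {a b x y} → Refl a b x y → Refl a b (- x) (- y)
Refl-neg (atA refl) = at-A refl
Refl-neg (atB refl) = at-B refl
Refl-neg {a} {b} (at-A refl) = subst (Refl _ _ _) (sym (ℤ.neg-involutive b)) (atA (ℤ.neg-involutive a))
Refl-neg {a} {b} (at-B refl) = subst (Refl _ _ _) (sym (ℤ.neg-involutive a)) (atB (ℤ.neg-involutive b))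
Refl-neg (off p q r s) = off (λ e → r (trans (sym (ℤ.neg-involutive _)) (cong -_ e)))
                             (λ e → s (trans (sym (ℤ.neg-involutive _)) (cong -_ e)))
                             (p ∘ ℤ.neg-injective) (q ∘ ℤ.neg-injective)

-- The roots (a , b) and (- b , - a) define the same reflection.
Refl-dual : ∀ {a b x y} → Refl (- b) (- a) x y → Refl a b x y
Refl-dual (atA p)  = at-B p
Refl-dual (atB p)  = at-A p
Refl-dual {a} {b} (at-A p) = subst (Refl _ _ _) (sym (ℤ.neg-involutive a)) (atB (trans p (ℤ.neg-involutive b)))
Refl-dual {a} {b} (at-B p) = subst (Refl _ _ _) (sym (ℤ.neg-involutive b)) (atA (trans p (ℤ.neg-involutive a)))
Refl-dual {a} {b} (off p q r s) =
  off (λ e → s (trans e (sym (ℤ.neg-involutive a)))) (λ e → r (trans e (sym (ℤ.neg-involutive b)))) q p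

Root-swap : ∀ {a b} → Root a b → Root b a
Root-swap {a} {b} R = record
  { a≢0 = b≢0 R ; b≢0 = a≢0 R ; a≢b = a≢b R ∘ sym
  ; a≢-b = λ e → a≢-b R (trans (sym (ℤ.neg-involutive a)) (cong -_ (sym e))) }

Root-map : ∀ {a b} (g : ℤ → ℤ) → (∀ {u v} → g u ≡ g v → u ≡ v) →
           (∀ u → g (- u) ≡ - g u) → Root a b → Root (g a) (g b)
Root-map {a} {b} g inj odd R = record
  { a≢0 = λ e → a≢0 R (zer a e) ; b≢0 = λ e → b≢0 R (zer b e)
  ; a≢b = a≢b R ∘ inj ; a≢-b = λ e → a≢-b R (inj (trans e (sym (odd b)))) }
  where
  zer : ∀ u → g u ≡ + 0 → u ≡ + 0
  zer u e with u ℤ.≟ + 0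
  ... | yes p = p
  -- If `g u` is zero, it equals `- g u`, that is `g (- u)`; injectivity then makes the nonzero `u`
  -- its own negative.
  ... | no p = ⊥-elim (x≢-x p (inj (trans e (trans (cong -_ (sym e)) (sym (odd u))))))

refl-odd : ∀ {a b} → Root a b → ∀ x → refl⟨ a , b ⟩ (- x) ≡ - refl⟨ a , b ⟩ x
refl-odd {a} {b} R x = refl-unique R (Refl-neg (refl-view a b x))

refl-involutive : ∀ {a b} → Root a b → ∀ x → refl⟨ a , b ⟩ (refl⟨ a , b ⟩ x) ≡ x
refl-involutive {a} {b} R x = refl-unique R (Refl-sym (refl-view a b x))

refl-swap : ∀ {a b} → Root a b → ∀ x → refl⟨ a , b ⟩ x ≡ refl⟨ b , a ⟩ x
refl-swap {a} {b} R x = refl-unique R (Refl-swap (refl-view b a x))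

-- For an element `g` of the group this is the conjugation rule: g t g⁻¹ is the reflection in the
-- image under `g` of the root of t.
refl-map : ∀ {a b} (g : ℤ → ℤ) → (∀ {u v} → g u ≡ g v → u ≡ v) → (∀ u → g (- u) ≡ - g u) →
           Root a b → ∀ x → g (refl⟨ a , b ⟩ x) ≡ refl⟨ g a , g b ⟩ (g x)
refl-map {a} {b} g inj odd R x =
  sym (refl-unique (Root-map g inj odd R) (Refl-map g inj odd (refl-view a b x)))

-- Simple reflections

-- Letter 0 is the generator s₁', letter i ≥ 1 is sᵢ; (α i , β i) is its simple root.
α : ℕ → ℤ
α zero    = - (+ 2)
α (suc i) = + suc i

β : ℕ → ℤ
β zero    = + 1
β (suc i) = + suc (suc i)

simple-root : ∀ i → Root (α i) (β i)
simple-root zero    = record { a≢0 = λ () ; b≢0 = λ () ; a≢b = λ () ; a≢-b = λ () }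
simple-root (suc i) = record { a≢0 = λ () ; b≢0 = λ () ; a≢b = λ () ; a≢-b = λ () }

σ : ℕ → ℤ → ℤ
σ i = refl⟨ α i , β i ⟩

σ-involutive : ∀ i x → σ i (σ i x) ≡ x
σ-involutive i = refl-involutive (simple-root i)

σ-odd : ∀ i x → σ i (- x) ≡ - σ i x
σ-odd i = refl-odd (simple-root i)

σ-injective : ∀ i {x y} → σ i x ≡ σ i y → x ≡ y
σ-injective i {x} {y} e = trans (sym (σ-involutive i x)) (trans (cong (σ i) e) (σ-involutive i y))

-- A simple reflection makes no positive root negative except its own, which has two names as a
-- pair. For `i ≥ 1` the exchanged values are neighbouring integers, so no third value can be
-- overtaken.
simple-flip : ∀ i {x y x′ y′} → Refl (α i) (β i) x x′ → Refl (α i) (β i) y y′ →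
              x ≢ + 0 → y ≢ + 0 → x ≢ - y → x < y → y′ < x′ →
              (x ≡ α i × y ≡ β i) ⊎ (x ≡ - β i × y ≡ - α i)
simple-flip (suc i) = go
  where
  between : ∀ {z} → z ≢ + suc i → z ≢ + suc (suc i) → + suc i < z → z < + suc (suc i) → ⊥
  between p q (+<+ u) (+<+ v) = ℕ.<-irrefl refl (ℕ.≤-trans u (ℕ.≤-pred v))
  between⁻ : ∀ {z} → z ≢ -[1+ suc i ] → z ≢ -[1+ i ] → -[1+ suc i ] < z → z < -[1+ i ] → ⊥
  between⁻ p q (-<- u) (-<- v) = ℕ.<-irrefl refl (ℕ.≤-trans v (ℕ.≤-pred u))
  α<β : α (suc i) < β (suc i)
  α<β = +<+ (ℕ.n<1+n _)
  -β<-α : - β (suc i) < - α (suc i)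
  -β<-α = -<- (ℕ.n<1+n _)
  go : ∀ {x y x′ y′} → Refl (α (suc i)) (β (suc i)) x x′ → Refl (α (suc i)) (β (suc i)) y y′ →
       x ≢ + 0 → y ≢ + 0 → x ≢ - y → x < y → y′ < x′ →
       (x ≡ α (suc i) × y ≡ β (suc i)) ⊎ (x ≡ - β (suc i) × y ≡ - α (suc i))
  go (atA refl) (atA refl) _ _ _ u _ = ⊥-elim (ℤ.<-irrefl refl u)
  go (atA refl) (atB refl) _ _ _ u _ = inj₁ (refl , refl)
  go (atA refl) (at-A refl) _ _ _ () _
  go (atA refl) (at-B refl) _ _ _ () _
  go (atA refl) (off p q _ _) _ _ _ u v = ⊥-elim (between p q u v)
  go (atB refl) (atA refl) _ _ _ u _ = ⊥-elim (ℤ.<-asym u α<β)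
  go (atB refl) (atB refl) _ _ _ u _ = ⊥-elim (ℤ.<-irrefl refl u)
  go (atB refl) (at-A refl) _ _ _ () _
  go (atB refl) (at-B refl) _ _ _ () _
  go (atB refl) (off p q _ _) _ _ _ u v = ⊥-elim (ℤ.<-asym (ℤ.<-trans u v) α<β)
  go (at-A refl) (atA refl) _ _ e _ _ = ⊥-elim (e refl)
  go (at-A refl) (atB refl) _ _ _ _ ()
  go (at-A refl) (at-A refl) _ _ _ u _ = ⊥-elim (ℤ.<-irrefl refl u)
  go (at-A refl) (at-B refl) _ _ _ u _ = ⊥-elim (ℤ.<-asym u -β<-α)
  go (at-A refl) (off _ _ p q) _ _ _ u v = ⊥-elim (ℤ.<-asym (ℤ.<-trans u v) -β<-α)
  go (at-B refl) (atA refl) _ _ _ _ ()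
  go (at-B refl) (atB refl) _ _ e _ _ = ⊥-elim (e refl)
  go (at-B refl) (at-A refl) _ _ _ _ _ = inj₂ (refl , refl)
  go (at-B refl) (at-B refl) _ _ _ u _ = ⊥-elim (ℤ.<-irrefl refl u)
  go (at-B refl) (off _ _ p q) _ _ _ u v = ⊥-elim (between⁻ q p u v)
  go (off p q r s) (atA refl) _ _ _ u v = ⊥-elim (ℤ.<-asym (ℤ.<-trans v u) α<β)
  go (off p q r s) (atB refl) _ _ _ u v = ⊥-elim (between p q v u)
  go (off p q r s) (at-A refl) _ _ _ u v = ⊥-elim (between⁻ s r v u)
  go (off p q r s) (at-B refl) _ _ _ u v = ⊥-elim (ℤ.<-asym (ℤ.<-trans v u) -β<-α)
  go (off _ _ _ _) (off _ _ _ _) _ _ _ u v = ⊥-elim (ℤ.<-asym u v)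
-- The values -2, -1, 1, 2 become 1, 2, -2, -1, and 0 is the only other integer between -2 and 2.
-- The reversed pairs (-2, 2) and (-1, 1) are not roots; `x ≢ - y` excludes them.
simple-flip zero = go
  where
  between : ∀ {z} → z ≢ - + 2 → z ≢ + 1 → z ≢ + 2 → z ≢ - + 1 → z ≢ + 0 → -[1+ 1 ] < z → z < + 2 → ⊥
  between { + 0} p q r s t u v = t refl
  between { + 1} p q r s t u v = q refl
  between { + suc (suc _)} p q r s t u (+<+ (s≤s (s≤s ())))
  between { -[1+ 0 ]} p q r s t u v = s refl
  between { -[1+ suc _ ]} p q r s t (-<- (s≤s ())) v
  1<2 : + 1 < + 2
  1<2 = +<+ (s≤s (s≤s z≤n))
  -2<-1 : -[1+ 1 ] < -[1+ 0 ]
  -2<-1 = -<- (s≤s z≤n)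
  go : ∀ {x y x′ y′} → Refl (α 0) (β 0) x x′ → Refl (α 0) (β 0) y y′ →
       x ≢ + 0 → y ≢ + 0 → x ≢ - y → x < y → y′ < x′ →
       (x ≡ α 0 × y ≡ β 0) ⊎ (x ≡ - β 0 × y ≡ - α 0)
  go (atA refl) (atA refl) _ _ _ u _ = ⊥-elim (ℤ.<-irrefl refl u)
  go (atA refl) (atB refl) _ _ _ u _ = inj₁ (refl , refl)
  go (atA refl) (at-A refl) _ _ e _ _ = ⊥-elim (e refl)
  go (atA refl) (at-B refl) _ _ _ u v = ⊥-elim (ℤ.<-asym v 1<2)
  go (atA refl) (off p q r s) _ n _ u v = ⊥-elim (between p q r s n u (ℤ.<-trans v 1<2))
  go (atB refl) (atA refl) _ _ _ () _
  go (atB refl) (atB refl) _ _ _ u _ = ⊥-elim (ℤ.<-irrefl refl u)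
  go (atB refl) (at-A refl) _ _ _ _ v = ⊥-elim (ℤ.<-asym v -2<-1)
  go (atB refl) (at-B refl) _ _ _ () _
  go (atB refl) (off p q _ _) _ _ _ u v = ⊥-elim (ℤ.<-asym (ℤ.<-trans u v) -<+)
  go (at-A refl) (atA refl) _ _ _ () _
  go (at-A refl) (atB refl) _ _ _ u _ = ⊥-elim (ℤ.<-asym u 1<2)
  go (at-A refl) (at-A refl) _ _ _ u _ = ⊥-elim (ℤ.<-irrefl refl u)
  go (at-A refl) (at-B refl) _ _ _ () _
  go (at-A refl) (off _ _ p q) _ _ _ u v = ⊥-elim (ℤ.<-asym (ℤ.<-trans u v) -<+)
  go (at-B refl) (atA refl) _ _ _ u _ = ⊥-elim (ℤ.<-asym u -2<-1)
  go (at-B refl) (atB refl) _ _ e _ _ = ⊥-elim (e refl)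
  go (at-B refl) (at-A refl) _ _ _ _ _ = inj₂ (refl , refl)
  go (at-B refl) (at-B refl) _ _ _ u _ = ⊥-elim (ℤ.<-irrefl refl u)
  go (at-B refl) (off p q r s) _ n _ u v = ⊥-elim (between p q r s n (ℤ.<-trans -2<-1 u) v)
  go (off p q r s) (atA refl) _ _ _ u v = ⊥-elim (ℤ.<-asym (ℤ.<-trans v u) -<+)
  go (off p q r s) (atB refl) n _ _ u v = ⊥-elim (between p q r s n v (ℤ.<-trans u 1<2))
  go (off p q r s) (at-A refl) n _ _ u v = ⊥-elim (between p q r s n (ℤ.<-trans -2<-1 v) u)
  go (off p q r s) (at-B refl) _ _ _ u v = ⊥-elim (ℤ.<-asym (ℤ.<-trans v u) -<+)
  go (off _ _ _ _) (off _ _ _ _) _ _ _ u v = ⊥-elim (ℤ.<-asym u v)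

-- Words and the exchange property

ev : List ℕ → ℤ → ℤ
ev []       x = x
ev (i ∷ gs) x = σ i (ev gs x)

ev-odd : ∀ gs x → ev gs (- x) ≡ - ev gs x
ev-odd []       x = refl
ev-odd (i ∷ gs) x = trans (cong (σ i) (ev-odd gs x)) (σ-odd i _)

ev-injective : ∀ gs {x y} → ev gs x ≡ ev gs y → x ≡ y
ev-injective []       e = e
ev-injective (i ∷ gs) e = ev-injective gs (σ-injective i e)

ev-++ : ∀ gs hs x → ev (gs ++ hs) x ≡ ev gs (ev hs x)
ev-++ []       hs x = refl
ev-++ (i ∷ gs) hs x = cong (σ i) (ev-++ gs hs x)

ev-reverse : ∀ gs x → ev gs (ev (reverse gs) x) ≡ x
ev-reverse []       x = refl
ev-reverse (i ∷ gs) x = begin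
  σ i (ev gs (ev (reverse (i ∷ gs)) x))       ≡⟨ cong (λ hs → σ i (ev gs (ev hs x))) (List.unfold-reverse i gs) ⟩
  σ i (ev gs (ev (reverse gs ++ i ∷ []) x))   ≡⟨ cong (σ i ∘ ev gs) (ev-++ (reverse gs) (i ∷ []) x) ⟩
  σ i (ev gs (ev (reverse gs) (σ i x)))       ≡⟨ cong (σ i) (ev-reverse gs (σ i x)) ⟩
  σ i (σ i x)                                 ≡⟨ σ-involutive i x ⟩
  x                                           ∎
  where open ≡-Reasoning

ev-refl : ∀ gs {a b} → Root a b → ∀ x → ev gs (refl⟨ a , b ⟩ x) ≡ refl⟨ ev gs a , ev gs b ⟩ (ev gs x)
ev-refl gs = refl-map (ev gs) (ev-injective gs) (ev-odd gs)

ev-Root : ∀ gs {a b} → Root a b → Root (ev gs a) (ev gs b)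
ev-Root gs = Root-map (ev gs) (ev-injective gs) (ev-odd gs)

flipped-refl : ∀ i {x y} → Root x y → x < y → σ i y < σ i x → ∀ z → refl⟨ x , y ⟩ z ≡ σ i z
flipped-refl i {x} {y} R x<y f z
  with simple-flip i (refl-view (α i) (β i) x) (refl-view (α i) (β i) y) (a≢0 R) (b≢0 R) (a≢-b R) x<y f
... | inj₁ (refl , refl) = refl
... | inj₂ (refl , refl) = sym (refl-unique (simple-root i) (Refl-dual (refl-view x y z)))

-- Strong exchange: some letter `i` reverses the order of the images of `x` and `y`. By
-- `flipped-refl` the reflection in the pair that reaches this letter is `σ i` itself. Moved to the
-- right past the letters applied before `i`, it becomes the reflection in `(x , y)`, so multiplying
-- by it cancels `i`.
exchange : ∀ gs {x y} → Root x y → y < x → ev gs x < ev gs y →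
           ∃ λ hs → hs ⊑ gs × suc (length hs) ≡ length gs ×
                    (∀ z → ev hs z ≡ ev gs (refl⟨ x , y ⟩ z))
exchange [] R y<x x<y = ⊥-elim (ℤ.<-asym x<y y<x)
exchange (i ∷ gs) {x} {y} R y<x f with ℤ.<-cmp (ev gs x) (ev gs y)
... | tri< u _ _ with exchange gs R y<x u
...   | hs , s , l , e = i ∷ hs , refl ∷ s , cong suc l , cong (σ i) ∘ e
exchange (i ∷ gs) {x} {y} R y<x f | tri≈ _ u _ = ⊥-elim (a≢b R (ev-injective gs u))
exchange (i ∷ gs) {x} {y} R y<x f | tri> _ _ u = gs , i ∷ʳ ⊆-refl , refl , eq
  where
  open ≡-Reasoning
  R′ : Root (ev gs x) (ev gs y)
  R′ = ev-Root gs R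
  eq : ∀ z → ev gs z ≡ σ i (ev gs (refl⟨ x , y ⟩ z))
  eq z = begin
    ev gs z                                        ≡⟨ sym (σ-involutive i _) ⟩
    σ i (σ i (ev gs z))                            ≡⟨ cong (σ i) (sym (flipped-refl i (Root-swap R′) u f (ev gs z))) ⟩
    σ i (refl⟨ ev gs y , ev gs x ⟩ (ev gs z))      ≡⟨ cong (σ i) (sym (refl-swap R′ _)) ⟩
    σ i (refl⟨ ev gs x , ev gs y ⟩ (ev gs z))      ≡⟨ cong (σ i) (sym (ev-refl gs R z)) ⟩
    σ i (ev gs (refl⟨ x , y ⟩ z))                  ∎

-- Fundamental weights and the support of a word

-- The signed values on which the i-th fundamental weight is positive
-- (for i ≥ 2, where it is 1); all σ j with j ≠ i preserve this set, σ i does not.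
data Pos : ℕ → ℤ → Set where
  pos₀  : ∀ {m} → Pos 0 (+ suc m)
  pos₁  : ∀ {m} → Pos 1 (+ suc (suc m))
  pos₁⁻ : Pos 1 -[1+ 0 ]
  pos   : ∀ {i m} → suc (suc i) ℕ.< m → Pos (suc (suc i)) (+ m)

Pos-β : ∀ i → Pos i (β i)
Pos-β 0 = pos₀
Pos-β 1 = pos₁
Pos-β (suc (suc i)) = pos (ℕ.n<1+n _)

¬Pos-α : ∀ i → ¬ Pos i (α i)
¬Pos-α (suc (suc i)) (pos u) = ℕ.<-irrefl refl u

Pos-Refl : ∀ i j → i ≢ j → ∀ {x y} → Refl (α j) (β j) x y → Pos i x → Pos i y
Pos-Refl i j n (off _ _ _ _) p = p
Pos-Refl zero zero n _ p = ⊥-elim (n refl)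
Pos-Refl (suc zero) zero n (atA refl) ()
Pos-Refl (suc zero) zero n (atB refl) ()
Pos-Refl (suc zero) zero n (at-A refl) p = pos₁⁻
Pos-Refl (suc zero) zero n (at-B refl) p = pos₁
Pos-Refl (suc (suc i)) zero n (atB refl) (pos (s≤s ()))
Pos-Refl (suc (suc i)) zero n (at-A refl) (pos (s≤s (s≤s ())))
Pos-Refl zero (suc j) n (atA refl) p = pos₀
Pos-Refl zero (suc j) n (atB refl) p = pos₀
Pos-Refl zero (suc j) n (at-A refl) ()
Pos-Refl zero (suc j) n (at-B refl) ()
Pos-Refl (suc zero) (suc zero) n _ p = ⊥-elim (n refl)
Pos-Refl (suc zero) (suc (suc j)) n (atA refl) p = pos₁
Pos-Refl (suc zero) (suc (suc j)) n (atB refl) p = pos₁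
Pos-Refl (suc zero) (suc (suc j)) n (at-A refl) ()
Pos-Refl (suc zero) (suc (suc j)) n (at-B refl) ()
Pos-Refl (suc (suc i)) (suc j) n (at-A refl) ()
Pos-Refl (suc (suc i)) (suc j) n (at-B refl) ()
Pos-Refl (suc (suc i)) (suc j) n (atA refl) (pos u) = pos (ℕ.m≤n⇒m≤1+n u)
-- A value is lowered by one here. It could reach the threshold only if the letter were
-- `suc (suc i)` itself, which `n` rules out.
Pos-Refl (suc (suc i)) (suc j) n (atB refl) (pos u) = pos (ℕ.≤∧≢⇒< (ℕ.≤-pred u) n)

Pos-ev : ∀ i gs → i ∉ gs → ∀ {x} → Pos i x → Pos i (ev gs x)
Pos-ev i []       n p = p
Pos-ev i (j ∷ gs) n p = Pos-Refl i j (n ∘ here) (refl-view (α j) (β j) _) (Pos-ev i gs (n ∘ there) p)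

∉-reverse : ∀ {i : ℕ} gs → i ∉ gs → i ∉ reverse gs
∉-reverse gs n m = n (subst (_ ∈_) (List.reverse-involutive gs) (Any-reverse (reverse gs) m))
  where
  open import Data.List.Relation.Unary.Any.Properties using (reverse⁺)
  Any-reverse : ∀ {i : ℕ} hs → i ∈ hs → i ∈ reverse hs
  Any-reverse hs = reverse⁺

Unique-middle : ∀ us {i : ℕ} {vs} → Unique (us ++ i ∷ vs) → i ∉ us × i ∉ vs
Unique-middle [] (a ∷ _) = (λ ()) , (λ m → All.lookup a m refl)
Unique-middle (u ∷ us) (a ∷ U) with Unique-middle us U
... | n , n′ = (λ { (here refl) → All.lookup a (∈-++⁺ʳ us (here refl)) refl ; (there m) → n m }) , n′

-- The product of us ++ i ∷ vs takes the preimage of β i under vs, where the weight of i is positive,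
-- to a value where it is not.
support : ∀ gs hs → Unique gs → (∀ x → ev gs x ≡ ev hs x) → ∀ {i} → i ∈ gs → ¬ i ∉ hs
support gs hs U e {i} i∈ i∉ with ∈-∃++ i∈
... | us , vs , refl = ¬Pos-α i (subst (Pos i) p′ p)
  where
  open ≡-Reasoning
  u∉ : i ∉ us
  u∉ = proj₁ (Unique-middle us U)
  v∉ : i ∉ vs
  v∉ = proj₂ (Unique-middle us U)
  x = ev (reverse vs) (β i)
  p : Pos i (ev (reverse us) (ev hs x))
  p = Pos-ev i (reverse us) (∉-reverse us u∉) (Pos-ev i hs i∉ (Pos-ev i (reverse vs) (∉-reverse vs v∉) (Pos-β i)))
  p′ : ev (reverse us) (ev hs x) ≡ α i
  p′ = ev-injective us (begin
    ev us (ev (reverse us) (ev hs x))  ≡⟨ ev-reverse us _ ⟩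
    ev hs x                            ≡⟨ sym (e x) ⟩
    ev (us ++ i ∷ vs) x                ≡⟨ ev-++ us (i ∷ vs) x ⟩
    ev us (σ i (ev vs x))              ≡⟨ cong (ev us ∘ σ i) (ev-reverse vs (β i)) ⟩
    ev us (σ i (β i))                  ≡⟨ cong (ev us) (refl-unique (simple-root i) (atB refl)) ⟩
    ev us (α i)                        ∎)

-- One-line notation of words

-- Stated through the simple root, so that letter 0, which needs rank 2, and the letters `i ≥ 1`,
-- which need `i < n`, are treated alike and the bounds feed `Refl-bounded` directly.
Letter : ℕ → ℕ → Set
Letter n i = ∣ α i ∣ ℕ.≤ n × ∣ β i ∣ ℕ.≤ n

Letters : ℕ → List ℕ → Set
Letters n = All (Letter n)

Letters-reverse : ∀ {n} gs → Letters n gs → Letters n (reverse gs)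
Letters-reverse gs L = All.tabulate (All.lookup L ∘ Any.reverse⁻)

Refl-bounded : ∀ {n a b x y} → Refl a b x y → ∣ a ∣ ℕ.≤ n → ∣ b ∣ ℕ.≤ n → ∣ x ∣ ℕ.≤ n → ∣ y ∣ ℕ.≤ n
Refl-bounded (atA _) p q r = q
Refl-bounded (atB _) p q r = p
Refl-bounded {b = b} (at-A _) p q r = subst (ℕ._≤ _) (sym (ℤ.∣-i∣≡∣i∣ b)) q
Refl-bounded {a = a} (at-B _) p q r = subst (ℕ._≤ _) (sym (ℤ.∣-i∣≡∣i∣ a)) p
Refl-bounded (off _ _ _ _) p q r = r

∣∣-≢ : ∀ {n a x} → ∣ a ∣ ℕ.≤ n → n ℕ.< ∣ x ∣ → x ≢ a
∣∣-≢ p q refl = ℕ.<-irrefl refl (ℕ.≤-trans q p)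

Refl-fixes : ∀ {n a b x} → ∣ a ∣ ℕ.≤ n → ∣ b ∣ ℕ.≤ n → n ℕ.< ∣ x ∣ → Refl a b x x
Refl-fixes {n} {a} {b} p q r = off (∣∣-≢ p r) (∣∣-≢ q r)
  (∣∣-≢ (subst (ℕ._≤ n) (sym (ℤ.∣-i∣≡∣i∣ a)) p) r) (∣∣-≢ (subst (ℕ._≤ n) (sym (ℤ.∣-i∣≡∣i∣ b)) q) r)

ev-bounded : ∀ {n} gs → Letters n gs → ∀ {x} → ∣ x ∣ ℕ.≤ n → ∣ ev gs x ∣ ℕ.≤ n
ev-bounded []       []            r = r
ev-bounded (i ∷ gs) ((p , q) ∷ L) r = Refl-bounded (refl-view (α i) (β i) _) p q (ev-bounded gs L r)

ev-fixes : ∀ {n} gs → Letters n gs → ∀ {x} → n ℕ.< ∣ x ∣ → ev gs x ≡ x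
ev-fixes []       []            r = refl
ev-fixes (i ∷ gs) ((p , q) ∷ L) r =
  trans (cong (σ i) (ev-fixes gs L r)) (refl-unique (simple-root i) (Refl-fixes p q r))

ev-0 : ∀ gs → ev gs (+ 0) ≡ + 0
ev-0 gs with ev gs (+ 0) ℤ.≟ + 0
... | yes p = p
... | no p = ⊥-elim (x≢-x p (ev-odd gs (+ 0)))

vec : ∀ n → List ℕ → Vec ℤ n
vec n gs = tabulate (λ k → ev gs (+ suc (toℕ k)))

odd-ext : ∀ n (f g : ℤ → ℤ) → (∀ x → f (- x) ≡ - f x) → (∀ x → g (- x) ≡ - g x) → f (+ 0) ≡ g (+ 0) →
          (∀ (k : Fin n) → f (+ suc (toℕ k)) ≡ g (+ suc (toℕ k))) → ∀ {x} → ∣ x ∣ ℕ.≤ n → f x ≡ g x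
odd-ext n f g of og e0 e {+ zero} r = e0
odd-ext n f g of og e0 e {+ suc j} r =
  subst (λ m → f (+ suc m) ≡ g (+ suc m)) (Fin.toℕ-fromℕ< r) (e (Fin.fromℕ< r))
odd-ext n f g of og e0 e { -[1+ j ]} r =
  trans (of (+ suc j)) (trans (cong -_ (odd-ext n f g of og e0 e {+ suc j} r)) (sym (og (+ suc j))))

apply-odd : ∀ {n} (w : Vec ℤ n) x → apply w (- x) ≡ - apply w x
apply-odd w (+ zero)  = refl
apply-odd w (+ suc j) = refl
apply-odd w -[1+ j ]  = sym (ℤ.neg-involutive _)

apply-lookup : ∀ {n} (w : Vec ℤ n) k → apply w (+ suc (toℕ k)) ≡ lookup w k
apply-lookup {n} w k with toℕ k ℕ.<? n
... | yes p = cong (lookup w) (Fin.fromℕ<-toℕ k p)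
... | no p = ⊥-elim (p (Fin.toℕ<n k))

apply-vec : ∀ n gs {x} → ∣ x ∣ ℕ.≤ n → apply (vec n gs) x ≡ ev gs x
apply-vec n gs = odd-ext n (apply (vec n gs)) (ev gs) (apply-odd (vec n gs)) (ev-odd gs) (sym (ev-0 gs))
  (λ k → trans (apply-lookup (vec n gs) k) (Vec.lookup∘tabulate _ k))

vec-cong : ∀ n {gs hs} → (∀ x → ev gs x ≡ ev hs x) → vec n gs ≡ vec n hs
vec-cong n e = Vec.tabulate-cong (λ k → e _)

-- Oddness and `ev-0` determine a word on the range of its rank, and beyond that range it is the
-- identity. Words can thus be compared as functions without mention of the rank.
vec-ext : ∀ n {gs hs} → Letters n gs → Letters n hs → vec n gs ≡ vec n hs → ∀ x → ev gs x ≡ ev hs x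
vec-ext n {gs} {hs} L M e x with ∣ x ∣ ℕ.≤? n
... | yes p = trans (sym (apply-vec n gs p)) (trans (cong (λ w → apply w x) e) (apply-vec n hs p))
... | no p = trans (ev-fixes gs L (ℕ.≰⇒> p)) (sym (ev-fixes hs M (ℕ.≰⇒> p)))

vec-∘ : ∀ n gs hs → Letters n hs → vec n gs ∘ₛ vec n hs ≡ vec n (gs ++ hs)
vec-∘ n gs hs M = trans (sym (Vec.tabulate-∘ (apply (vec n gs)) _))
  (Vec.tabulate-cong (λ k → trans (apply-vec n gs (ev-bounded hs M (Fin.toℕ<n k))) (sym (ev-++ gs hs _))))

≡ᵇ-refl : ∀ m → (m ℕ.≡ᵇ m) ≡ true
≡ᵇ-refl zero = refl
≡ᵇ-refl (suc m) = ≡ᵇ-refl m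

≢⇒≡ᵇ : ∀ {m n} → m ≢ n → (m ℕ.≡ᵇ n) ≡ false
≢⇒≡ᵇ {m} {n} p with m ℕ.≡ᵇ n in e
... | false = refl
... | true = ⊥-elim (p (ℕ.≡ᵇ⇒≡ m n (subst T (sym e) _)))

sᵢ≡vec : ∀ n i → sᵢ {n} (suc i) ≡ vec n (suc i ∷ [])
sᵢ≡vec n i = Vec.tabulate-cong (λ k → sym (refl-unique (simple-root (suc i)) (lem (toℕ k))))
  where
  lem : ∀ k → Refl (α (suc i)) (β (suc i)) (+ suc k)
        (+ (if suc k ℕ.≡ᵇ suc i then suc (suc i) else (if suc k ℕ.≡ᵇ suc (suc i) then suc i else suc k)))
  lem k with suc k ℕ.≟ suc i | suc k ℕ.≟ suc (suc i)
  ... | yes refl | _ rewrite ≡ᵇ-refl k = atA refl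
  ... | no p | yes refl rewrite ≢⇒≡ᵇ p | ≡ᵇ-refl k = atB refl
  ... | no p | no q rewrite ≢⇒≡ᵇ p | ≢⇒≡ᵇ q = off (p ∘ ℤ.+-injective) (q ∘ ℤ.+-injective) (λ ()) (λ ())

s1'≡vec : ∀ n → s1' {n} ≡ vec n (0 ∷ [])
s1'≡vec n = Vec.tabulate-cong λ where
  Fin.zero                → sym (refl-unique (simple-root 0) (atB refl))
  (Fin.suc Fin.zero)      → sym (refl-unique (simple-root 0) (at-A refl))
  (Fin.suc (Fin.suc k))   → sym (refl-unique (simple-root 0) (off (λ ()) (λ ()) (λ ()) (λ ())))

gen⇒letter : ∀ {n v} → IsGen n v → ∃ λ i → Letter n i × v ≡ vec n (i ∷ [])
gen⇒letter (gen-s (suc i) (s≤s _) i<n) = suc i , (ℕ.<⇒≤ i<n , i<n) , sᵢ≡vec _ i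
gen⇒letter (gen-1' 2≤n) = 0 , (2≤n , ℕ.<⇒≤ 2≤n) , s1'≡vec _

letter⇒gen : ∀ {n} i → Letter n i → IsGen n (vec n (i ∷ []))
letter⇒gen {n} zero (p , _) = subst (IsGen n) (s1'≡vec n) (gen-1' p)
letter⇒gen {n} (suc i) (_ , q) = subst (IsGen n) (sᵢ≡vec n i) (gen-s (suc i) (s≤s z≤n) q)

word⇒letters : ∀ {n w} gvs → IsWord {n} w gvs → ∃ λ gs → Letters n gs × length gs ≡ length gvs × w ≡ vec n gs
word⇒letters [] ([] , refl) = [] , [] , refl , refl
word⇒letters {n} (g ∷ gvs) (G ∷ Gs , refl) with word⇒letters gvs (Gs , refl) | gen⇒letter G
... | gs , L , l , e | i , I , refl =
  i ∷ gs , I ∷ L , cong suc l , trans (cong (vec n (i ∷ []) ∘ₛ_) e) (vec-∘ n (i ∷ []) gs L)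

letters⇒word : ∀ {n} gs → Letters n gs → IsWord (vec n gs) (List.map (λ i → vec n (i ∷ [])) gs)
letters⇒word [] [] = [] , refl
letters⇒word {n} (i ∷ gs) (I ∷ L) with letters⇒word gs L
... | G , e = letter⇒gen i I ∷ G , trans (cong (vec n (i ∷ []) ∘ₛ_) e) (vec-∘ n (i ∷ []) gs L)

Reduced : ℕ → List ℕ → Set
Reduced n gs = Letters n gs ×
  (∀ hs → Letters n hs → (∀ x → ev gs x ≡ ev hs x) → length gs ℕ.≤ length hs)

hasLength⇒reduced : ∀ {n w k} → HasLength {n} w k → ∃ λ gs → Reduced n gs × length gs ≡ k × w ≡ vec n gs
hasLength⇒reduced {n} ((gvs , W , refl) , min) with word⇒letters gvs W
... | gs , L , l , refl = gs , (L , λ hs M e → shorter hs M e) , l , refl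
  where
  shorter : ∀ hs → Letters n hs → (∀ x → ev gs x ≡ ev hs x) → length gs ℕ.≤ length hs
  shorter hs M e with letters⇒word hs M
  ... | G , p = subst₂ ℕ._≤_ (sym l) (List.length-map _ hs) (min _ (G , trans p (sym (vec-cong n {gs} {hs} e))))

reduced⇒hasLength : ∀ {n} gs → Reduced n gs → HasLength (vec n gs) (length gs)
reduced⇒hasLength {n} gs (L , min) = (_ , letters⇒word gs L , List.length-map _ gs) , shorter
  where
  shorter : ∀ gvs → IsWord (vec n gs) gvs → length gs ℕ.≤ length gvs
  shorter gvs W with word⇒letters gvs W
  ... | hs , M , l , e = subst (length gs ℕ.≤_) l (min hs M (vec-ext n L M e))

-- Generation of the group

-- Apart from oddness, all demands are made only up to `n`: `apply w` is zero beyond the length of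
-- `w`, so a signed permutation given as a vector is not injective on all integers.
record Perm (n : ℕ) (f : ℤ → ℤ) : Set where
  field
    odd     : ∀ x → f (- x) ≡ - f x
    nonzero : ∀ {x} → x ≢ + 0 → ∣ x ∣ ℕ.≤ n → f x ≢ + 0
    bounded : ∀ {x} → ∣ x ∣ ℕ.≤ n → ∣ f x ∣ ℕ.≤ n
    inj     : ∀ {x y} → ∣ x ∣ ℕ.≤ n → ∣ y ∣ ℕ.≤ n → ∣ f x ∣ ≡ ∣ f y ∣ → ∣ x ∣ ≡ ∣ y ∣

open Perm

abs-cases : ∀ i j → ∣ i ∣ ≡ ∣ j ∣ → i ≡ j ⊎ i ≡ - j
abs-cases (+ m)    (+ .m)       refl = inj₁ refl
abs-cases (+ .(suc n)) -[1+ n ] refl = inj₂ refl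
abs-cases -[1+ m ] (+ .(suc m)) refl = inj₂ refl
abs-cases -[1+ m ] -[1+ .m ]    refl = inj₁ refl

-- The parity of the number of negative entries. The last entry is the outermost factor, so passing
-- to the next lower rank removes exactly that factor.
sgn : ℕ → (ℕ → ℤ) → Sign
sgn zero    a = Sign.+
sgn (suc n) a = sign (a n) Sign.* sgn n a

entries : (ℤ → ℤ) → ℕ → ℤ
entries f i = f (+ suc i)

sgn-cong : ∀ {a b} n → (∀ {i} → i ℕ.< n → a i ≡ b i) → sgn n a ≡ sgn n b
sgn-cong zero    e = refl
sgn-cong (suc n) e = cong₂ (λ x s → sign x Sign.* s) (e ℕ.≤-refl) (sgn-cong n (e ∘ ℕ.m≤n⇒m≤1+n))

sgn-above : ∀ {a b m n} → m ℕ.≤ n → sgn m a ≡ sgn m b → (∀ {i} → m ℕ.≤ i → a i ≡ b i) → sgn n a ≡ sgn n b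
sgn-above {a} {b} {m} m≤n s e = go (ℕ.≤⇒≤′ m≤n)
  where
  go : ∀ {n} → m ℕ.≤′ n → sgn n a ≡ sgn n b
  go ℕ.≤′-refl = s
  go (ℕ.≤′-step p) = cong₂ (λ x s → sign x Sign.* s) (e (ℕ.≤′⇒≤ p)) (go p)

sgn-head : ∀ n a → sgn (suc n) a ≡ sign (a 0) Sign.* sgn n (a ∘ suc)
sgn-head zero    a = refl
sgn-head (suc n) a = begin
  sign (a (suc n)) Sign.* sgn (suc n) a
    ≡⟨ cong (sign (a (suc n)) Sign.*_) (sgn-head n a) ⟩
  sign (a (suc n)) Sign.* (sign (a 0) Sign.* sgn n (a ∘ suc))
    ≡⟨ x∙yz≈y∙xz (sign (a (suc n))) (sign (a 0)) (sgn n (a ∘ suc)) ⟩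
  sign (a 0) Sign.* (sign (a (suc n)) Sign.* sgn n (a ∘ suc))            ∎
  where open ≡-Reasoning

σ-α : ∀ i → σ i (α i) ≡ β i
σ-α i = refl-unique (simple-root i) (atA refl)

σ-β : ∀ i → σ i (β i) ≡ α i
σ-β i = refl-unique (simple-root i) (atB refl)

σ-fixes : ∀ {n} i → Letter n i → ∀ {x} → n ℕ.< ∣ x ∣ → σ i x ≡ x
σ-fixes i I {x} = ev-fixes (i ∷ []) (I ∷ []) {x}

σ-fixes-small : ∀ i {x} → ∣ x ∣ ℕ.< suc i → σ (suc i) x ≡ x
σ-fixes-small i {x} p = refl-unique (simple-root (suc i))
  (off (λ { refl → ℕ.<-irrefl refl p }) (λ { refl → ℕ.<-asym p (ℕ.n<1+n _) })
       (λ { refl → ℕ.<-irrefl refl p }) (λ { refl → ℕ.<-asym p (ℕ.n<1+n _) }))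

sign-neg : ∀ {x} → x ≢ + 0 → sign (- x) ≡ Sign.opposite (sign x)
sign-neg {+ zero}   n = ⊥-elim (n refl)
sign-neg {+ suc _}  n = refl
sign-neg { -[1+ _ ]} n = refl

-- The generator acts on places. A letter `i ≥ 1` exchanges two neighbouring factors; letter 0
-- exchanges the first two and changes both signs, and the two changes cancel in the product.
sgn-σ : ∀ {n f} i → Letter n i → Perm n f → sgn n (entries (f ∘ σ i)) ≡ sgn n (entries f)
sgn-σ {n} {f} (suc p) (_ , q) P =
  sgn-above q base (λ {i} m≤i → cong f (σ-fixes (suc p) (ℕ.n≤1+n _ , ℕ.≤-refl) {+ suc i} (s≤s m≤i)))
  where
  base : sgn (suc (suc p)) (entries (f ∘ σ (suc p))) ≡ sgn (suc (suc p)) (entries f)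
  base = begin
    sign (f (σ (suc p) (β (suc p)))) Sign.* (sign (f (σ (suc p) (α (suc p)))) Sign.* sgn p (entries (f ∘ σ (suc p))))
      ≡⟨ cong₂ Sign._*_ (cong (sign ∘ f) (σ-β (suc p)))
           (cong₂ Sign._*_ (cong (sign ∘ f) (σ-α (suc p)))
             (sgn-cong p (λ {i} i<p → cong f (σ-fixes-small p {+ suc i} (s≤s i<p))))) ⟩
    sign (f (α (suc p))) Sign.* (sign (f (β (suc p))) Sign.* sgn p (entries f))
      ≡⟨ x∙yz≈y∙xz (sign (f (α (suc p)))) (sign (f (β (suc p)))) (sgn p (entries f)) ⟩
    sign (f (β (suc p))) Sign.* (sign (f (α (suc p))) Sign.* sgn p (entries f)) ∎
    where open ≡-Reasoning
sgn-σ {n} {f} zero (q , q′) P =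
  sgn-above q base (λ {i} m≤i → cong f (σ-fixes 0 (ℕ.≤-refl , s≤s z≤n) {+ suc i} (s≤s m≤i)))
  where
  opp : ∀ s t → Sign.opposite s Sign.* (Sign.opposite t Sign.* Sign.+) ≡ t Sign.* (s Sign.* Sign.+)
  opp Sign.+ Sign.+ = refl
  opp Sign.+ Sign.- = refl
  opp Sign.- Sign.+ = refl
  opp Sign.- Sign.- = refl
  flip : ∀ {x y} → σ 0 x ≡ - y → y ≢ + 0 → ∣ y ∣ ℕ.≤ n → sign (f (σ 0 x)) ≡ Sign.opposite (sign (f y))
  flip {y = y} e y≢0 y≤n = trans (cong sign (trans (cong f e) (odd P y))) (sign-neg (nonzero P y≢0 y≤n))
  base : sgn 2 (entries (f ∘ σ 0)) ≡ sgn 2 (entries f)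
  base = trans (cong₂ (λ s t → s Sign.* (t Sign.* Sign.+))
                  (flip {+ 2} {+ 1} (refl-unique (simple-root 0) (at-A refl)) (λ ()) q′)
                  (flip {+ 1} {+ 2} (refl-unique (simple-root 0) (atB refl)) (λ ()) q))
               (opp (sign (f (+ 1))) (sign (f (+ 2))))

ev-∣∣-injective : ∀ gs {x y} → ∣ ev gs x ∣ ≡ ∣ ev gs y ∣ → ∣ x ∣ ≡ ∣ y ∣
ev-∣∣-injective gs {x} {y} e with abs-cases (ev gs x) (ev gs y) e
... | inj₁ p = cong ∣_∣ (ev-injective gs p)
... | inj₂ p = trans (cong ∣_∣ (ev-injective gs (trans p (sym (ev-odd gs y))))) (ℤ.∣-i∣≡∣i∣ y)

ev-nonzero : ∀ gs {x} → x ≢ + 0 → ev gs x ≢ + 0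
ev-nonzero gs n e = n (ev-injective gs (trans e (sym (ev-0 gs))))

Perm-∘ev : ∀ {n f} gs → Letters n gs → Perm n f → Perm n (f ∘ ev gs)
Perm-∘ev {n} {f} gs L P = record
  { odd     = λ x → trans (cong f (ev-odd gs x)) (odd P _)
  ; nonzero = λ x≢0 b → nonzero P (ev-nonzero gs x≢0) (ev-bounded gs L b)
  ; bounded = λ b → bounded P (ev-bounded gs L b)
  ; inj     = λ b c e → ev-∣∣-injective gs (inj P (ev-bounded gs L b) (ev-bounded gs L c) e) }

Perm-ev∘ : ∀ {n f} gs → Letters n gs → Perm n f → Perm n (ev gs ∘ f)
Perm-ev∘ {n} {f} gs L P = record
  { odd     = λ x → trans (cong (ev gs) (odd P x)) (ev-odd gs _)
  ; nonzero = λ x≢0 b → ev-nonzero gs (nonzero P x≢0 b)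
  ; bounded = λ b → ev-bounded gs L (bounded P b)
  ; inj     = λ b c e → inj P b c (ev-∣∣-injective gs e) }

sgn-∘ev : ∀ {n f} gs → Letters n gs → Perm n f → sgn n (entries (f ∘ ev gs)) ≡ sgn n (entries f)
sgn-∘ev []       []      P = refl
sgn-∘ev (i ∷ gs) (I ∷ L) P = trans (sgn-∘ev gs L (Perm-∘ev (i ∷ []) (I ∷ []) P)) (sgn-σ i I P)

Perm-restrict : ∀ {n f} → Perm (suc n) f → ∣ f (+ suc n) ∣ ≡ suc n → Perm n f
Perm-restrict {n} {f} P e = record
  { odd     = odd P
  ; nonzero = λ x≢0 b → nonzero P x≢0 (ℕ.m≤n⇒m≤1+n b)
  ; bounded = λ {x} b → ℕ.≤-pred (ℕ.≤∧≢⇒< (bounded P (ℕ.m≤n⇒m≤1+n b))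
      (λ e′ → ℕ.<-irrefl (inj P {x} {+ suc n} (ℕ.m≤n⇒m≤1+n b) ℕ.≤-refl (trans e′ (sym e))) (s≤s b)))
  ; inj     = λ b c → inj P (ℕ.m≤n⇒m≤1+n b) (ℕ.m≤n⇒m≤1+n c) }

opaque
  injective⇒hits : ∀ {n} (g : Fin n → Fin n) → (∀ {x y} → g x ≡ g y → x ≡ y) → ∀ y → ∃ λ x → g x ≡ y
  injective⇒hits {suc n} g g-inj y with Fin.any? (λ x → g x Fin.≟ y)
  ... | yes p = p
  ... | no p =
    ⊥-elim (ℕ.<-irrefl refl (Fin.injective⇒≤ {f = λ x → Fin.punchOut {i = y} {j = g x} (λ e → p (x , sym e))}
                 (λ e → g-inj (Fin.punchOut-injective (λ e′ → p (_ , sym e′)) (λ e′ → p (_ , sym e′)) e))))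

opaque
  Perm-hits : ∀ {n f} → Perm n f → ∀ {v} → v ℕ.< n → ∃ λ i → i ℕ.< n × ∣ f (+ suc i) ∣ ≡ suc v
  Perm-hits {n} {f} P {v} v<n =
    toℕ k , Fin.toℕ<n k , trans (sym (suc-code k)) (cong suc (trans (cong toℕ eq) (Fin.toℕ-fromℕ< v<n)))
    where
    value : Fin n → ℕ
    value k = ∣ f (+ suc (toℕ k)) ∣
    positive : ∀ k → value k ≢ 0
    positive k e = nonzero P {+ suc (toℕ k)} (λ ()) (Fin.toℕ<n k) (ℤ.∣i∣≡0⇒i≡0 e)
    suc-pred : ∀ k → suc (ℕ.pred (value k)) ≡ value k
    suc-pred k = ℕ.suc-pred (value k) {{ℕ.≢-nonZero (positive k)}}
    code< : ∀ k → ℕ.pred (value k) ℕ.< n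
    code< k = subst (ℕ._≤ n) (sym (suc-pred k)) (bounded P {+ suc (toℕ k)} (Fin.toℕ<n k))
    code : Fin n → Fin n
    code k = Fin.fromℕ< (code< k)
    suc-code : ∀ k → suc (toℕ (code k)) ≡ value k
    suc-code k = trans (cong suc (Fin.toℕ-fromℕ< (code< k))) (suc-pred k)
    code-injective : ∀ {j k} → code j ≡ code k → j ≡ k
    code-injective {j} {k} e = Fin.toℕ-injective (ℕ.suc-injective
      (inj P {+ suc (toℕ j)} {+ suc (toℕ k)} (Fin.toℕ<n j) (Fin.toℕ<n k)
        (trans (sym (suc-code j)) (trans (cong (suc ∘ toℕ) e) (suc-code k)))))
    k : Fin n
    k = proj₁ (injective⇒hits code code-injective (Fin.fromℕ< v<n))
    eq : code k ≡ Fin.fromℕ< v<n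
    eq = proj₂ (injective⇒hits code code-injective (Fin.fromℕ< v<n))

σ-transitive⁺ : ∀ d k → ∃ λ gs → Letters (suc k ℕ.+ d) gs × ev gs (+ (suc k ℕ.+ d)) ≡ + suc k
σ-transitive⁺ zero    k = [] , [] , cong +_ (ℕ.+-identityʳ (suc k))
σ-transitive⁺ (suc d) k with σ-transitive⁺ d (suc k)
... | gs , L , e rewrite ℕ.+-suc k d =
  suc k ∷ gs , (ℕ.m≤n⇒m≤1+n (s≤s (ℕ.m≤m+n k d)) , s≤s (s≤s (ℕ.m≤m+n k d))) ∷ L ,
  trans (cong (σ (suc k)) e) (σ-β (suc k))

opaque
  -- Positive values are reached from `n` by descending letters. Letter 0 sends 2 to -1, and
  -- ascending letters lead on to -2, -3 and so forth.
  σ-transitive : ∀ {n} → 2 ℕ.≤ n → ∀ {z} → z ≢ + 0 → ∣ z ∣ ℕ.≤ n → ∃ λ gs → Letters n gs × ev gs (+ n) ≡ z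
  σ-transitive {n} 2≤n {+ zero}  z≢0 b = ⊥-elim (z≢0 refl)
  σ-transitive {n} 2≤n {+ suc k} z≢0 b with σ-transitive⁺ (n ℕ.∸ suc k) k
  ... | r rewrite ℕ.m+[n∸m]≡n b = r
  σ-transitive {n} 2≤n { -[1+ zero ]} z≢0 b with σ-transitive 2≤n {+ 2} (λ ()) 2≤n
  ... | gs , L , e = 0 ∷ gs , (2≤n , ℕ.<⇒≤ 2≤n) ∷ L , trans (cong (σ 0) e) (refl-unique (simple-root 0) (at-A refl))
  σ-transitive {n} 2≤n { -[1+ suc k ]} z≢0 b with σ-transitive 2≤n { -[1+ k ]} (λ ()) (ℕ.<⇒≤ b)
  ... | gs , L , e =
    suc k ∷ gs , (ℕ.<⇒≤ b , b) ∷ L , trans (cong (σ (suc k)) e) (refl-unique (simple-root (suc k)) (at-A refl))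

Letter-mono : ∀ {m n} → m ℕ.≤ n → ∀ {i} → Letter m i → Letter n i
Letter-mono m≤n (p , q) = ℕ.≤-trans p m≤n , ℕ.≤-trans q m≤n

Perm-1 : ∀ {f} → Perm 1 f → sgn 1 (entries f) ≡ Sign.+ → f (+ 1) ≡ + 1
Perm-1 {f} P s = go _ refl
  where
  go : ∀ y → f (+ 1) ≡ y → f (+ 1) ≡ + 1
  go (+ zero) e = ⊥-elim (nonzero P {+ 1} (λ ()) ℕ.≤-refl e)
  go (+ suc zero) e = e
  go (+ suc (suc _)) e with subst (λ y → ∣ y ∣ ℕ.≤ 1) e (bounded P {+ 1} ℕ.≤-refl)
  ... | s≤s ()
  go -[1+ _ ] e with trans (sym s) (cong (λ y → sign y Sign.* Sign.+) e)
  ... | ()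

Perm-0 : ∀ {n f} → Perm n f → f (+ 0) ≡ + 0
Perm-0 {n} {f} P with f (+ 0) ℤ.≟ + 0
... | yes p = p
... | no p = ⊥-elim (x≢-x p (odd P (+ 0)))

opaque
  Perm-top : ∀ {m f} → Perm (suc m) f → ∃ λ z → z ≢ + 0 × ∣ z ∣ ℕ.≤ suc m × f z ≡ + suc m
  Perm-top {m} {f} P with Perm-hits P {m} ℕ.≤-refl
  ... | i , i<n , e with abs-cases (f (+ suc i)) (+ suc m) e
  ... | inj₁ p = + suc i , (λ ()) , i<n , p
  ... | inj₂ p = -[1+ i ] , (λ ()) , i<n , trans (odd P (+ suc i)) (cong -_ p)

Perm-extend : ∀ {m f} hs → Perm (suc m) f → f (+ suc m) ≡ + suc m → Letters m hs →
              (∀ {x} → ∣ x ∣ ℕ.≤ m → f x ≡ ev hs x) → ∀ {x} → ∣ x ∣ ℕ.≤ suc m → f x ≡ ev hs x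
Perm-extend {m} {f} hs P top M e {x} b with ∣ x ∣ ℕ.≤? m
... | yes p = e p
... | no p with abs-cases x (+ suc m) (ℕ.≤-antisym b (ℕ.≰⇒> p))
...   | inj₁ refl = trans top (sym (ev-fixes hs M {+ suc m} ℕ.≤-refl))
...   | inj₂ refl = trans (odd P (+ suc m)) (trans (cong -_ top) (sym (ev-fixes hs M { -[1+ m ]} ℕ.≤-refl)))

ev-cancelʳ : ∀ {n} gs → Letters n gs → ∀ {f g : ℤ → ℤ} → (∀ {x} → ∣ x ∣ ℕ.≤ n → f (ev gs x) ≡ g x) →
             ∀ {x} → ∣ x ∣ ℕ.≤ n → f x ≡ g (ev (reverse gs) x)
ev-cancelʳ gs L {f} e {x} b =
  trans (cong f (sym (ev-reverse gs x))) (e (ev-bounded (reverse gs) (Letters-reverse gs L) b))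

Generated : ℕ → (ℤ → ℤ) → Set
Generated n f = ∃ λ gs → Letters n gs × (∀ {x} → ∣ x ∣ ℕ.≤ n → f x ≡ ev gs x)

Generated-∘ : ∀ {n f} gs → Letters n gs → Generated n (f ∘ ev gs) → Generated n f
Generated-∘ {n} {f} gs L (hs , M , e) = hs ++ reverse gs , All.++⁺ M (Letters-reverse gs L) ,
  λ {x} b → trans (ev-cancelʳ gs L {f} {ev hs} e b) (sym (ev-++ hs (reverse gs) x))

Generated-extend : ∀ {m f} → Perm (suc m) f → f (+ suc m) ≡ + suc m → Generated m f → Generated (suc m) f
Generated-extend P top (hs , M , e) = hs , All.map (λ {i} → Letter-mono (ℕ.n≤1+n _) {i}) M , Perm-extend hs P top M e

-- Precompose with a word that carries the largest value to its preimage under `f`. The largest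
-- value is then fixed, the sign product is unchanged, and the rest is an element of lower rank.
generated-step : ∀ {m} → (∀ {f} → Perm (suc m) f → sgn (suc m) (entries f) ≡ Sign.+ → Generated (suc m) f) →
                 ∀ {f} → Perm (suc (suc m)) f → sgn (suc (suc m)) (entries f) ≡ Sign.+ → Generated (suc (suc m)) f
generated-step {m} rec {f} P s with Perm-top P
... | z , z≢0 , z≤n′ , fz with σ-transitive (s≤s (s≤s z≤n)) z≢0 z≤n′
...   | gs , L , e = Generated-∘ gs L (Generated-extend P′ top (rec (Perm-restrict P′ (cong ∣_∣ top)) sgn′))
  where
  P′ : Perm (suc (suc m)) (f ∘ ev gs)
  P′ = Perm-∘ev gs L P
  top : f (ev gs (+ suc (suc m))) ≡ + suc (suc m)
  top = trans (cong f e) fz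
  sgn′ : sgn (suc m) (entries (f ∘ ev gs)) ≡ Sign.+
  sgn′ = trans (cong (λ x → sign x Sign.* sgn (suc m) (entries (f ∘ ev gs))) (sym top)) (trans (sgn-∘ev gs L P) s)

generated : ∀ n {f} → Perm n f → sgn n (entries f) ≡ Sign.+ → Generated n f
generated zero          P s = [] , [] , λ { {+ zero} z≤n → Perm-0 P }
generated (suc zero)    P s = Generated-extend P (Perm-1 P s) ([] , [] , λ { {+ zero} z≤n → Perm-0 P })
generated (suc (suc m)) = generated-step (generated (suc m))

∣apply∣ : ∀ {n} (w : Vec ℤ n) x → ∣ apply w x ∣ ≡ ∣ apply w (+ ∣ x ∣) ∣
∣apply∣ w (+ _) = refl
∣apply∣ w -[1+ j ] = ℤ.∣-i∣≡∣i∣ (apply w (+ suc j))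

All-lookup : ∀ {n} {P : ℤ → Set} (w : Vec ℤ n) → All P (toList w) → ∀ k → P (lookup w k)
All-lookup (x ∷ w) (p ∷ _) Fin.zero    = p
All-lookup (x ∷ w) (_ ∷ A) (Fin.suc k) = All-lookup w A k

Unique-lookup : ∀ {n} (w : Vec ℤ n) → Unique (List.map ∣_∣ (toList w)) →
                ∀ j k → ∣ lookup w j ∣ ≡ ∣ lookup w k ∣ → j ≡ k
Unique-lookup (x ∷ w) (a ∷ U) Fin.zero    Fin.zero    e = refl
Unique-lookup (x ∷ w) (a ∷ U) Fin.zero    (Fin.suc k) e = ⊥-elim (All-lookup w (All.map⁻ a) k e)
Unique-lookup (x ∷ w) (a ∷ U) (Fin.suc j) Fin.zero    e = ⊥-elim (All-lookup w (All.map⁻ a) j (sym e))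
Unique-lookup (x ∷ w) (a ∷ U) (Fin.suc j) (Fin.suc k) e = cong Fin.suc (Unique-lookup w U j k e)

apply-< : ∀ {n} (w : Vec ℤ n) {i} (p : i ℕ.< n) → apply w (+ suc i) ≡ lookup w (Fin.fromℕ< p)
apply-< w p = trans (cong (λ i → apply w (+ suc i)) (sym (Fin.toℕ-fromℕ< p))) (apply-lookup w (Fin.fromℕ< p))

signedPerm⇒Perm : ∀ {n} (w : Vec ℤ n) → IsSignedPerm w → Perm n (apply w)
signedPerm⇒Perm {n} w (A , U) =
  record { odd = apply-odd w ; nonzero = nz ; bounded = λ {x} → bd {x} ; inj = λ {x} {y} → ij {x} {y} }
  where
  nz⁺ : ∀ {i} → i ℕ.< n → ∣ apply w (+ suc i) ∣ ≢ 0
  nz⁺ p e = ℕ.<⇒≢ (proj₁ (All-lookup w A (Fin.fromℕ< p))) (sym (trans (cong ∣_∣ (sym (apply-< w p))) e))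
  nz : ∀ {x} → x ≢ + 0 → ∣ x ∣ ℕ.≤ n → apply w x ≢ + 0
  nz {+ zero}   x≢0 b e = x≢0 refl
  nz {+ suc _}  x≢0 b e = nz⁺ b (cong ∣_∣ e)
  nz { -[1+ j ]} x≢0 b e = nz⁺ b (trans (sym (∣apply∣ w -[1+ j ])) (cong ∣_∣ e))
  bd⁺ : ∀ {m} → m ℕ.≤ n → ∣ apply w (+ m) ∣ ℕ.≤ n
  bd⁺ {zero}  b = z≤n
  bd⁺ {suc _} b = subst (λ x → ∣ x ∣ ℕ.≤ n) (sym (apply-< w b)) (proj₂ (All-lookup w A (Fin.fromℕ< b)))
  bd : ∀ {x} → ∣ x ∣ ℕ.≤ n → ∣ apply w x ∣ ℕ.≤ n
  bd {x} b = subst (ℕ._≤ n) (sym (∣apply∣ w x)) (bd⁺ {∣ x ∣} b)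
  ij⁺ : ∀ {k l} → k ℕ.≤ n → l ℕ.≤ n → ∣ apply w (+ k) ∣ ≡ ∣ apply w (+ l) ∣ → k ≡ l
  ij⁺ {zero}  {zero}  b c e = refl
  ij⁺ {zero}  {suc l} b c e = ⊥-elim (nz⁺ c (sym e))
  ij⁺ {suc k} {zero}  b c e = ⊥-elim (nz⁺ b e)
  ij⁺ {suc k} {suc l} b c e = cong suc (trans (sym (Fin.toℕ-fromℕ< b)) (trans (cong toℕ
    (Unique-lookup w U _ _ (trans (cong ∣_∣ (sym (apply-< w b))) (trans e (cong ∣_∣ (apply-< w c))))))
      (Fin.toℕ-fromℕ< c)))
  ij : ∀ {x y} → ∣ x ∣ ℕ.≤ n → ∣ y ∣ ℕ.≤ n → ∣ apply w x ∣ ≡ ∣ apply w y ∣ → ∣ x ∣ ≡ ∣ y ∣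
  ij {x} {y} b c e = ij⁺ {∣ x ∣} {∣ y ∣} b c (trans (sym (∣apply∣ w x)) (trans e (∣apply∣ w y)))

parity : ℕ → Sign
parity zero    = Sign.+
parity (suc m) = Sign.opposite (parity m)

even⇒+ : ∀ m → m % 2 ≡ 0 → parity m ≡ Sign.+
even⇒+ zero          e = refl
even⇒+ (suc (suc m)) e = trans (Sign.opposite-involutive (parity m)) (even⇒+ m e)

sgn-parity : ∀ {n} (w : Vec ℤ n) → sgn n (entries (apply w)) ≡ parity (negCount w)
sgn-parity [] = refl
sgn-parity {suc n} (x ∷ w) = trans (sgn-head n (entries (apply (x ∷ w))))
  (trans (cong₂ (λ y s → sign y Sign.* s) (apply-< (x ∷ w) {0} (s≤s z≤n)) (trans (sgn-cong n tail) (sgn-parity w)))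
    (step x))
  where
  tail : ∀ {i} → i ℕ.< n → entries (apply (x ∷ w)) (suc i) ≡ entries (apply w) i
  tail {i} p = trans (apply-< (x ∷ w) (s≤s p)) (sym (apply-< w p))
  step : ∀ x → sign x Sign.* parity (negCount w) ≡ parity (negCount (x ∷ w))
  step (+ _) = refl
  step -[1+ _ ] with parity (negCount w)
  ... | Sign.+ = refl
  ... | Sign.- = refl

InD⇒word : ∀ {n} (w : Vec ℤ n) → InD w → ∃ λ gs → Letters n gs × w ≡ vec n gs
InD⇒word {n} w (S , e) with generated n (signedPerm⇒Perm w S) (trans (sgn-parity w) (even⇒+ (negCount w) e))
... | gs , L , eq = gs , L , trans (sym (Vec.tabulate∘lookup w))
  (Vec.tabulate-cong (λ k → trans (sym (apply-lookup w k)) (eq {+ suc (toℕ k)} (Fin.toℕ<n k))))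

-- The Bruhat order

ev-∷ʳ : ∀ gs i x → ev (gs ++ i ∷ []) x ≡ ev gs (σ i x)
ev-∷ʳ gs i x = ev-++ gs (i ∷ []) x

-- The root is the image under the conjugating element of the simple root. The hypothesis fixes `t`
-- only on the values taken by that element, and these are all values in the range.
reflection⇒refl : ∀ {n t} → IsReflection {n} t →
  ∃ λ a → ∃ λ b → Root a b × ∣ a ∣ ℕ.≤ n × ∣ b ∣ ℕ.≤ n × (∀ {x} → ∣ x ∣ ℕ.≤ n → apply t x ≡ refl⟨ a , b ⟩ x)
reflection⇒refl {n} {t} (g , s , D , G , eq) with InD⇒word g D | gen⇒letter G
... | ks , L , refl | i , I , refl =
  ev ks (α i) , ev ks (β i) , ev-Root ks (simple-root i) ,
  ev-bounded ks L (proj₁ I) , ev-bounded ks L (proj₂ I) , agree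
  where
  open ≡-Reasoning
  entry : ∀ k → apply t (ev ks (+ suc (toℕ k))) ≡ ev (ks ++ i ∷ []) (+ suc (toℕ k))
  entry k = begin
    apply t (ev ks (+ suc (toℕ k)))              ≡⟨ cong (apply t) (sym (Vec.lookup∘tabulate _ k)) ⟩
    apply t (lookup (vec n ks) k)                ≡⟨ sym (Vec.lookup-map k (apply t) (vec n ks)) ⟩
    lookup (t ∘ₛ vec n ks) k                     ≡⟨ cong (λ w → lookup w k) eq ⟩
    lookup (vec n ks ∘ₛ vec n (i ∷ [])) k        ≡⟨ cong (λ w → lookup w k) (vec-∘ n ks (i ∷ []) (I ∷ [])) ⟩
    lookup (vec n (ks ++ i ∷ [])) k              ≡⟨ Vec.lookup∘tabulate _ k ⟩
    ev (ks ++ i ∷ []) (+ suc (toℕ k))            ∎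
  entries-agree : ∀ {x} → ∣ x ∣ ℕ.≤ n → apply t (ev ks x) ≡ ev (ks ++ i ∷ []) x
  entries-agree {x} = odd-ext n (apply t ∘ ev ks) (ev (ks ++ i ∷ []))
    (λ x → trans (cong (apply t) (ev-odd ks x)) (apply-odd t (ev ks x))) (ev-odd (ks ++ i ∷ []))
    (trans (cong (apply t) (ev-0 ks)) (sym (ev-0 (ks ++ i ∷ [])))) entry {x}
  agree : ∀ {x} → ∣ x ∣ ℕ.≤ n → apply t x ≡ refl⟨ ev ks (α i) , ev ks (β i) ⟩ x
  agree {x} b = begin
    apply t x                                        ≡⟨ cong (apply t) (sym (ev-reverse ks x)) ⟩
    apply t (ev ks y)
      ≡⟨ entries-agree (ev-bounded (reverse ks) (Letters-reverse ks L) b) ⟩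
    ev (ks ++ i ∷ []) y                              ≡⟨ ev-∷ʳ ks i y ⟩
    ev ks (σ i y)                                    ≡⟨ ev-refl ks (simple-root i) y ⟩
    refl⟨ ev ks (α i) , ev ks (β i) ⟩ (ev ks y)      ≡⟨ cong refl⟨ ev ks (α i) , ev ks (β i) ⟩ (ev-reverse ks x) ⟩
    refl⟨ ev ks (α i) , ev ks (β i) ⟩ x              ∎
    where y = ev (reverse ks) x

-- Exactly one of the two products inverts x < y, and exchange deletes a letter of its word; by minimality it is gs.
deletion-< : ∀ {n} gs hs {x y} → Letters n hs → Root x y → x < y → (∀ z → ev gs z ≡ ev hs (refl⟨ x , y ⟩ z)) →
           (∀ ks → Letters n ks → (∀ z → ev gs z ≡ ev ks z) → length hs ℕ.< length ks) →
           ∃ λ ks → ks ⊑ gs × (∀ z → ev ks z ≡ ev hs z)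
deletion-< gs hs {x} {y} M R x<y e min with ℤ.<-cmp (ev hs x) (ev hs y)
... | tri≈ _ p _ = ⊥-elim (Root.a≢b R (ev-injective hs p))
... | tri> _ _ p with exchange hs (Root-swap R) x<y p
...   | ks , s , l , e′ = ⊥-elim (ℕ.<-asym (subst (length ks ℕ.<_) l (ℕ.n<1+n _))
          (min ks (Sublist.All-resp-⊆ s M) (λ z → trans (e z) (trans (cong (ev hs) (refl-swap R z)) (sym (e′ z))))))
deletion-< gs hs {x} {y} M R x<y e min | tri< p _ _ with exchange gs (Root-swap R) x<y
  (subst₂ _<_ (trans (cong (ev hs) (sym (refl-unique R (atB refl)))) (sym (e y)))
              (trans (cong (ev hs) (sym (refl-unique R (atA refl)))) (sym (e x))) p)
... | ks , s , l , e′ = ks , s , λ z → begin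
  ev ks z                                        ≡⟨ e′ z ⟩
  ev gs (refl⟨ y , x ⟩ z)                        ≡⟨ cong (ev gs) (sym (refl-swap R z)) ⟩
  ev gs (refl⟨ x , y ⟩ z)                        ≡⟨ e _ ⟩
  ev hs (refl⟨ x , y ⟩ (refl⟨ x , y ⟩ z))        ≡⟨ cong (ev hs) (refl-involutive R z) ⟩
  ev hs z                                        ∎
  where open ≡-Reasoning

deletion : ∀ {n} gs hs {x y} → Letters n hs → Root x y → (∀ z → ev gs z ≡ ev hs (refl⟨ x , y ⟩ z)) →
           (∀ ks → Letters n ks → (∀ z → ev gs z ≡ ev ks z) → length hs ℕ.< length ks) →
           ∃ λ ks → ks ⊑ gs × (∀ z → ev ks z ≡ ev hs z)
deletion gs hs {x} {y} M R e min with ℤ.<-cmp x y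
... | tri< p _ _ = deletion-< gs hs M R p e min
... | tri≈ _ p _ = ⊥-elim (Root.a≢b R p)
... | tri> _ _ p = deletion-< gs hs M (Root-swap R) p (λ z → trans (e z) (cong (ev hs) (refl-swap R z))) min

refl-∘ev : ∀ {n a b} gs hs → Letters n gs → Letters n hs → Root a b → ∣ a ∣ ℕ.≤ n → ∣ b ∣ ℕ.≤ n →
           (∀ (k : Fin n) → ev gs (+ suc (toℕ k)) ≡ refl⟨ a , b ⟩ (ev hs (+ suc (toℕ k)))) →
           ∀ x → ev gs x ≡ refl⟨ a , b ⟩ (ev hs x)
refl-∘ev {n} {a} {b} gs hs L M R p q e x with ∣ x ∣ ℕ.≤? n
... | yes r = odd-ext n (ev gs) (refl⟨ a , b ⟩ ∘ ev hs) (ev-odd gs)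
    (λ x → trans (cong refl⟨ a , b ⟩ (ev-odd hs x)) (refl-odd R (ev hs x)))
    (trans (ev-0 gs) (sym (trans (cong refl⟨ a , b ⟩ (ev-0 hs)) refl-0))) e r
  where
  refl-0 : refl⟨ a , b ⟩ (+ 0) ≡ + 0
  refl-0 = refl-unique R (off (Root.a≢0 R ∘ sym) (Root.b≢0 R ∘ sym)
    (λ e → Root.a≢0 R (ℤ.neg-injective (sym e))) (λ e → Root.b≢0 R (ℤ.neg-injective (sym e))))
... | no r = trans (ev-fixes gs L (ℕ.≰⇒> r))
    (sym (trans (cong refl⟨ a , b ⟩ (ev-fixes hs M (ℕ.≰⇒> r))) (refl-unique R (Refl-fixes p q (ℕ.≰⇒> r)))))

-- The word `gs` may be far from reduced: `deletion` asks only that every word for its product be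
-- longer than the word `hs` of `v`, and the two lengths in the cover provide this.
⋖⇒sublist : ∀ {n v} gs → Letters n gs → v ⋖ vec n gs → ∃ λ hs → hs ⊑ gs × v ≡ vec n hs
⋖⇒sublist {n} {v} gs L (k , lv , lu , t , ρ , eq)
  with hasLength⇒reduced lv | hasLength⇒reduced lu | reflection⇒refl ρ
... | hs , (M , _) , refl , refl | us , (N , min) , l , equ | a , b , R , p , q , et
  with deletion gs hs M (ev-Root (reverse hs) R) root-action min′
  where
  open ≡-Reasoning
  action : ∀ x → ev gs x ≡ refl⟨ a , b ⟩ (ev hs x)
  action = refl-∘ev gs hs L M R p q λ k → begin
    ev gs (+ suc (toℕ k))                            ≡⟨ sym (Vec.lookup∘tabulate _ k) ⟩
    lookup (vec n gs) k                              ≡⟨ cong (λ w → lookup w k) eq ⟩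
    lookup (t ∘ₛ vec n hs) k                         ≡⟨ Vec.lookup-map k (apply t) (vec n hs) ⟩
    apply t (lookup (vec n hs) k)                    ≡⟨ cong (apply t) (Vec.lookup∘tabulate _ k) ⟩
    apply t (ev hs (+ suc (toℕ k)))                  ≡⟨ et (ev-bounded hs M (Fin.toℕ<n k)) ⟩
    refl⟨ a , b ⟩ (ev hs (+ suc (toℕ k)))            ∎
  -- The cover relation multiplies on the left, exchange on the right; pulling the root back through
  -- `hs` passes from one side to the other.
  root-action : ∀ z → ev gs z ≡ ev hs (refl⟨ ev (reverse hs) a , ev (reverse hs) b ⟩ z)
  root-action z = begin
    ev gs z                                                                          ≡⟨ action z ⟩
    refl⟨ a , b ⟩ (ev hs z)
      ≡⟨ cong₂ (λ c d → refl⟨ c , d ⟩ (ev hs z)) (sym (ev-reverse hs a)) (sym (ev-reverse hs b)) ⟩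
    refl⟨ ev hs (ev (reverse hs) a) , ev hs (ev (reverse hs) b) ⟩ (ev hs z)
      ≡⟨ sym (ev-refl hs (ev-Root (reverse hs) R) z) ⟩
    ev hs (refl⟨ ev (reverse hs) a , ev (reverse hs) b ⟩ z)                          ∎
  min′ : ∀ ks → Letters n ks → (∀ z → ev gs z ≡ ev ks z) → length hs ℕ.< length ks
  min′ ks K e = subst (ℕ._≤ length ks) l (min ks K (λ z → trans (vec-ext n {us} {gs} N L (sym equ) z) (e z)))
... | ks , s , e = ks , s , sym (vec-cong n {ks} {hs} e)

-- One half of the subword property. The chain is followed from its upper end, each cover giving a
-- sublist of the sublist already found.
≤B⇒sublist : ∀ {n v} gs → Letters n gs → v ≤B vec n gs → ∃ λ hs → hs ⊑ gs × v ≡ vec n hs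
≤B⇒sublist {n} gs L = go refl
  where
  go : ∀ {v w} → w ≡ vec n gs → v ≤B w → ∃ λ hs → hs ⊑ gs × v ≡ vec n hs
  go refl ε = gs , ⊆-refl , refl
  go e (c ◅ p) with go e p
  ... | hs , s , refl with ⋖⇒sublist hs (Sublist.All-resp-⊆ s L) c
  ...   | ks , s′ , e′ = ks , ⊆-trans s′ s , e′

lookup-All : ∀ {n} {P : ℤ → Set} (w : Vec ℤ n) → (∀ k → P (lookup w k)) → All P (toList w)
lookup-All []      p = []
lookup-All (x ∷ w) p = p Fin.zero ∷ lookup-All w (p ∘ Fin.suc)

lookup-Unique : ∀ {n} (w : Vec ℤ n) → (∀ j k → ∣ lookup w j ∣ ≡ ∣ lookup w k ∣ → j ≡ k) →
                Unique (List.map ∣_∣ (toList w))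
lookup-Unique []      p = []
lookup-Unique (x ∷ w) p = All.map⁺ (lookup-All w λ k e → Fin.0≢1+n (p Fin.zero (Fin.suc k) e)) ∷
  lookup-Unique w (λ j k e → Fin.suc-injective (p (Fin.suc j) (Fin.suc k) e))

+⇒even : ∀ m → parity m ≡ Sign.+ → m % 2 ≡ 0
+⇒even zero          e = refl
+⇒even (suc zero)    ()
+⇒even (suc (suc m)) e = +⇒even m (trans (sym (Sign.opposite-involutive (parity m))) e)

Perm-id : ∀ n → Perm n (λ x → x)
Perm-id n = record { odd = λ _ → refl ; nonzero = λ n _ → n ; bounded = λ b → b ; inj = λ _ _ e → e }

sgn-id : ∀ n → sgn n (entries (λ x → x)) ≡ Sign.+
sgn-id zero    = refl
sgn-id (suc n) = sgn-id n

apply-tabulate : ∀ n (f : ℤ → ℤ) {i} → i ℕ.< n → apply {n} (tabulate (entries f ∘ toℕ)) (+ suc i) ≡ f (+ suc i)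
apply-tabulate n f i<n =
  trans (apply-< _ i<n) (trans (Vec.lookup∘tabulate _ (Fin.fromℕ< i<n)) (cong (entries f) (Fin.toℕ-fromℕ< i<n)))

Perm⇒InD : ∀ n {f} → Perm n f → sgn n (entries f) ≡ Sign.+ → InD {n} (tabulate (entries f ∘ toℕ))
Perm⇒InD n {f} P s =
  (lookup-All w (λ k → subst (λ x → 1 ℕ.≤ ∣ x ∣ × ∣ x ∣ ℕ.≤ n) (sym (Vec.lookup∘tabulate _ k)) (range k)) ,
  lookup-Unique w distinct) ,
  +⇒even (negCount w) (trans (sym (sgn-parity w)) (trans (sgn-cong n (apply-tabulate n f)) s))
  where
  w : Vec ℤ n
  w = tabulate (entries f ∘ toℕ)
  range : ∀ k → 1 ℕ.≤ ∣ f (+ suc (toℕ k)) ∣ × ∣ f (+ suc (toℕ k)) ∣ ℕ.≤ n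
  range k =
    ℕ.n≢0⇒n>0 (λ e → nonzero P {+ suc (toℕ k)} (λ ()) (Fin.toℕ<n k) (ℤ.∣i∣≡0⇒i≡0 e)) ,
    bounded P {+ suc (toℕ k)} (Fin.toℕ<n k)
  distinct : ∀ j k → ∣ lookup w j ∣ ≡ ∣ lookup w k ∣ → j ≡ k
  distinct j k e =
    Fin.toℕ-injective (ℕ.suc-injective (inj P {+ suc (toℕ j)} {+ suc (toℕ k)} (Fin.toℕ<n j) (Fin.toℕ<n k)
    (subst₂ (λ x y → ∣ x ∣ ≡ ∣ y ∣) (Vec.lookup∘tabulate _ j) (Vec.lookup∘tabulate _ k) e)))

word⇒InD : ∀ n gs → Letters n gs → InD (vec n gs)
word⇒InD n gs L = Perm⇒InD n (Perm-∘ev gs L (Perm-id n)) (trans (sgn-∘ev gs L (Perm-id n)) (sgn-id n))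

-- Deleting `i` is left multiplication by its conjugate under `us`, and `us ++ i ∷ reverse us` is a
-- word for this reflection. The two reducedness hypotheses supply the lengths.
delete-⋖ : ∀ {n} us i vs → Reduced n (us ++ i ∷ vs) → Reduced n (us ++ vs) → vec n (us ++ vs) ⋖ vec n (us ++ i ∷ vs)
delete-⋖ {n} us i vs r@(L , _) r′@(L′ , _) = length (us ++ vs) , reduced⇒hasLength (us ++ vs) r′ ,
  subst (HasLength (vec n (us ++ i ∷ vs))) len (reduced⇒hasLength (us ++ i ∷ vs) r) ,
  vec n (us ++ i ∷ reverse us) ,
  (vec n us , vec n (i ∷ []) , word⇒InD n us U , letter⇒gen i I , conj) , prod
  where
  open ≡-Reasoning
  U : Letters n us
  U = All.++⁻ˡ us L
  I : Letter n i
  I = All.head (All.++⁻ʳ us L)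
  len : length (us ++ i ∷ vs) ≡ suc (length (us ++ vs))
  len = begin
    length (us ++ i ∷ vs)             ≡⟨ List.length-++ us ⟩
    length us ℕ.+ suc (length vs)     ≡⟨ ℕ.+-suc (length us) (length vs) ⟩
    suc (length us ℕ.+ length vs)     ≡⟨ cong suc (sym (List.length-++ us)) ⟩
    suc (length (us ++ vs))           ∎
  cancel : ∀ ws x → ev ((us ++ i ∷ reverse us) ++ us ++ ws) x ≡ ev (us ++ i ∷ ws) x
  cancel ws x = begin
    ev ((us ++ i ∷ reverse us) ++ us ++ ws) x          ≡⟨ ev-++ (us ++ i ∷ reverse us) (us ++ ws) x ⟩
    ev (us ++ i ∷ reverse us) (ev (us ++ ws) x)        ≡⟨ ev-++ us (i ∷ reverse us) _ ⟩
    ev us (σ i (ev (reverse us) (ev (us ++ ws) x)))    ≡⟨ cong (ev us ∘ σ i ∘ ev (reverse us)) (ev-++ us ws x) ⟩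
    ev us (σ i (ev (reverse us) (ev us (ev ws x))))    ≡⟨ cong (ev us ∘ σ i) (reverse-ev us (ev ws x)) ⟩
    ev us (σ i (ev ws x))                              ≡⟨ sym (ev-++ us (i ∷ ws) x) ⟩
    ev (us ++ i ∷ ws) x                                ∎
    where
    reverse-ev : ∀ gs x → ev (reverse gs) (ev gs x) ≡ x
    reverse-ev gs x =
      trans (cong (ev (reverse gs)) (cong (λ hs → ev hs x) (sym (List.reverse-involutive gs))))
      (ev-reverse (reverse gs) x)
  conj : vec n (us ++ i ∷ reverse us) ∘ₛ vec n us ≡ vec n us ∘ₛ vec n (i ∷ [])
  conj = begin
    vec n (us ++ i ∷ reverse us) ∘ₛ vec n us           ≡⟨ vec-∘ n (us ++ i ∷ reverse us) us U ⟩
    vec n ((us ++ i ∷ reverse us) ++ us)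
      ≡⟨ cong (λ ws → vec n ((us ++ i ∷ reverse us) ++ ws)) (sym (List.++-identityʳ us)) ⟩
    vec n ((us ++ i ∷ reverse us) ++ us ++ [])
      ≡⟨ vec-cong n {(us ++ i ∷ reverse us) ++ us ++ []} {us ++ i ∷ []} (cancel []) ⟩
    vec n (us ++ i ∷ [])                               ≡⟨ sym (vec-∘ n us (i ∷ []) (I ∷ [])) ⟩
    vec n us ∘ₛ vec n (i ∷ [])                         ∎
  prod : vec n (us ++ i ∷ vs) ≡ vec n (us ++ i ∷ reverse us) ∘ₛ vec n (us ++ vs)
  prod = sym
    (trans (vec-∘ n (us ++ i ∷ reverse us) (us ++ vs) L′)
    (vec-cong n {(us ++ i ∷ reverse us) ++ us ++ vs} {us ++ i ∷ vs} (cancel vs)))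

-- Words with distinct letters and their boolean ideals

support-∈ : ∀ gs hs → Unique gs → (∀ x → ev gs x ≡ ev hs x) → ∀ {i} → i ∈ gs → i ∈ hs
support-∈ gs hs U e {i} m with i ∈? hs
... | yes p = p
... | no p = ⊥-elim (support gs hs U e m p)

Unique-⊆⇒length≤ : ∀ {us hs : List ℕ} → Unique us → (∀ {i} → i ∈ us → i ∈ hs) → length us ℕ.≤ length hs
Unique-⊆⇒length≤ [] s = z≤n
Unique-⊆⇒length≤ {u ∷ us} (a ∷ U) s with ∈-∃++ (s (here refl))
... | xs , ys , refl = subst (suc (length us) ℕ.≤_) (sym len) (s≤s (Unique-⊆⇒length≤ U s′))
  where
  len : length (xs ++ u ∷ ys) ≡ suc (length (xs ++ ys))
  len = trans (List.length-++ xs) (trans (ℕ.+-suc (length xs) (length ys)) (cong suc (sym (List.length-++ xs))))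
  s′ : ∀ {i} → i ∈ us → i ∈ xs ++ ys
  s′ m with ∈-++⁻ xs (s (there m))
  ... | inj₁ p = ∈-++⁺ˡ p
  ... | inj₂ (here refl) = ⊥-elim (All.lookup a m refl)
  ... | inj₂ (there p) = ∈-++⁺ʳ xs p

-- By `support-∈` every word for the same element contains each of the distinct letters, so it is at
-- least as long.
unique⇒reduced : ∀ {n gs} → Letters n gs → Unique gs → Reduced n gs
unique⇒reduced {n} {gs} L U = L , λ hs M e → Unique-⊆⇒length≤ U (support-∈ gs hs U e)

Unique-⊑ : ∀ {gs hs : List ℕ} → hs ⊑ gs → Unique gs → Unique hs
Unique-⊑ [] U = []
Unique-⊑ (_ ∷ʳ s) (_ ∷ U) = Unique-⊑ s U
Unique-⊑ (refl ∷ s) (a ∷ U) = Sublist.All-resp-⊆ s a ∷ Unique-⊑ s U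

-- The prefix `us` accumulates letters already kept, because `delete-⋖` speaks of whole words. All
-- intermediate words have distinct letters and are therefore reduced, so each deletion is a cover.
⊑⇒≤B : ∀ {n hs gs} us → hs ⊑ gs → Letters n (us ++ gs) → Unique (us ++ gs) → vec n (us ++ hs) ≤B vec n (us ++ gs)
⊑⇒≤B us [] L U = ε
⊑⇒≤B {n} {i ∷ hs} {i ∷ gs} us (refl ∷ s) L U =
  subst₂ (λ xs ys → vec n xs ≤B vec n ys) (List.++-assoc us (i ∷ []) hs) (List.++-assoc us (i ∷ []) gs)
    (⊑⇒≤B (us ++ i ∷ []) s (subst (Letters n) (sym (List.++-assoc us (i ∷ []) gs)) L)
                           (subst Unique (sym (List.++-assoc us (i ∷ []) gs)) U))
⊑⇒≤B {n} {hs} {i ∷ gs} us (_ ∷ʳ s) L U = ⊑⇒≤B us s L′ U′ ◅◅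
  (delete-⋖ us i gs (unique⇒reduced L U) (unique⇒reduced L′ U′) ◅ ε)
  where
  drop : us ++ gs ⊑ us ++ i ∷ gs
  drop = Sublist.++⁺ ⊆-refl (i ∷ʳ ⊆-refl)
  L′ = Sublist.All-resp-⊆ drop L
  U′ = Unique-⊑ drop U

select : (gs : List ℕ) → Subset (length gs) → List ℕ
select []       []          = []
select (i ∷ gs) (true ∷ S)  = i ∷ select gs S
select (i ∷ gs) (false ∷ S) = select gs S

select-⊑ : ∀ gs S → select gs S ⊑ gs
select-⊑ []       []          = []
select-⊑ (i ∷ gs) (true ∷ S)  = refl ∷ select-⊑ gs S
select-⊑ (i ∷ gs) (false ∷ S) = i ∷ʳ select-⊑ gs S

⊑⇒select : {hs gs : List ℕ} → hs ⊑ gs → ∃ λ S → hs ≡ select gs S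
⊑⇒select [] = [] , refl
⊑⇒select (_ ∷ʳ s) with ⊑⇒select s
... | S , e = false ∷ S , e
⊑⇒select (refl ∷ s) with ⊑⇒select s
... | S , e = true ∷ S , cong (_ ∷_) e

⊑-select : ∀ {hs} gs S → hs ⊑ select gs S → ∃ λ S′ → S′ Subset.⊆ S × hs ≡ select gs S′
⊑-select [] [] [] = [] , Subset.⊆-refl , refl
⊑-select (i ∷ gs) (true ∷ S) (_ ∷ʳ s) with ⊑-select gs S s
... | S′ , p , e = false ∷ S′ , Subset.out⊆ p , e
⊑-select (i ∷ gs) (true ∷ S) (refl ∷ s) with ⊑-select gs S s
... | S′ , p , e = true ∷ S′ , Subset.s⊆s p , cong (i ∷_) e
⊑-select (i ∷ gs) (false ∷ S) s with ⊑-select gs S s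
... | S′ , p , e = false ∷ S′ , Subset.s⊆s p , e

select-mono : ∀ gs {S T} → S Subset.⊆ T → select gs S ⊑ select gs T
select-mono [] {[]} {[]} p = []
select-mono (i ∷ gs) {true ∷ S} {true ∷ T} p = refl ∷ select-mono gs (Subset.drop-∷-⊆ p)
select-mono (i ∷ gs) {true ∷ S} {false ∷ T} p with p Vec.here
... | ()
select-mono (i ∷ gs) {false ∷ S} {true ∷ T} p = i ∷ʳ select-mono gs (Subset.drop-∷-⊆ p)
select-mono (i ∷ gs) {false ∷ S} {false ∷ T} p = select-mono gs (Subset.drop-∷-⊆ p)

-- Equal first bits cancel. If they differ, the letter `i` occurs in only one of two words for the
-- same element, contrary to `support-∈`.
ev-select-injective : ∀ gs → Unique gs → ∀ S T → (∀ x → ev (select gs S) x ≡ ev (select gs T) x) → S ≡ T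
ev-select-injective [] U [] [] e = refl
ev-select-injective (i ∷ gs) (a ∷ U) (true ∷ S) (true ∷ T) e =
  cong (true ∷_) (ev-select-injective gs U S T (σ-injective i ∘ e))
ev-select-injective (i ∷ gs) (a ∷ U) (false ∷ S) (false ∷ T) e =
  cong (false ∷_) (ev-select-injective gs U S T e)
ev-select-injective (i ∷ gs) (a ∷ U) (true ∷ S) (false ∷ T) e =
  ⊥-elim (All.lookup a
    (Sublist.lookup (select-⊑ gs T)
    (support-∈ (i ∷ select gs S) (select gs T) (Unique-⊑ (refl ∷ select-⊑ gs S) (a ∷ U)) e (here refl))) refl)
ev-select-injective (i ∷ gs) (a ∷ U) (false ∷ S) (true ∷ T) e =
  ⊥-elim (All.lookup a
    (Sublist.lookup (select-⊑ gs S)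
    (support-∈ (i ∷ select gs T) (select gs S) (Unique-⊑ (refl ∷ select-⊑ gs T) (a ∷ U)) (sym ∘ e) (here refl))) refl)

unique⇒boolean : ∀ n gs → Letters n gs → Unique gs → BooleanIdeal (vec n gs)
unique⇒boolean n gs L U = length gs , code , code-injective , code-surjective , code-⊆
  where
  el : Subset (length gs) → Vec ℤ n
  el S = vec n (select gs S)
  LS : ∀ S → Letters n (select gs S)
  LS S = Sublist.All-resp-⊆ (select-⊑ gs S) L
  el-injective : ∀ {S T} → el S ≡ el T → S ≡ T
  el-injective {S} {T} e = ev-select-injective gs U S T (vec-ext n (LS S) (LS T) e)
  search : ∀ v → Dec (∃ λ S → el S ≡ v)
  search v = Subset.anySubset? (λ S → Vec.≡-dec ℤ._≟_ (el S) v)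
  -- The map has to be defined on every vector; one that is not the product of a subword gets the
  -- default `Subset.⊥`.
  code′ : ∀ {v} → Dec (∃ λ S → el S ≡ v) → Subset (length gs)
  code′ (yes (S , _)) = S
  code′ (no _) = Subset.⊥
  code : Vec ℤ n → Subset (length gs)
  code v = code′ (search v)
  code-el : ∀ S → code (el S) ≡ S
  code-el S with search (el S)
  ... | yes (T , e) = el-injective e
  ... | no p = ⊥-elim (p (S , refl))
  below : ∀ {v} → v ≤B vec n gs → ∃ λ S → v ≡ el S
  below p with ≤B⇒sublist gs L p
  ... | hs , s , refl with ⊑⇒select s
  ...   | S , refl = S , refl
  el-≤ : ∀ S → el S ≤B vec n gs
  el-≤ S = ⊑⇒≤B [] (select-⊑ gs S) L U
  code-injective : ∀ u v → u ≤B vec n gs → v ≤B vec n gs → code u ≡ code v → u ≡ v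
  code-injective u v p q e with below p | below q
  ... | S , refl | T , refl = cong el (trans (sym (code-el S)) (trans e (code-el T)))
  code-surjective : ∀ S → ∃ λ v → v ≤B vec n gs × code v ≡ S
  code-surjective S = el S , el-≤ S , code-el S
  code-⊆ : ∀ u v → u ≤B vec n gs → v ≤B vec n gs → (u ≤B v ⇔ code u Subset.⊆ code v)
  code-⊆ u v p q with below p | below q
  ... | S , refl | T , refl rewrite code-el S | code-el T = mk⇔ to from
    where
    to : el S ≤B el T → S Subset.⊆ T
    to r with ≤B⇒sublist (select gs T) (LS T) r
    ... | hs , s , e with ⊑-select gs T s
    ...   | S′ , i , refl = subst (Subset._⊆ T) (sym (el-injective e)) i
    from : S Subset.⊆ T → el S ≤B el T
    from i = ⊑⇒≤B [] (select-mono gs i) (LS T) (Unique-⊑ (select-⊑ gs T) U)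

-- From boolean ideals to distinct letters

Reduced-tail : ∀ {n i gs} → Reduced n (i ∷ gs) → Reduced n gs
Reduced-tail {n} {i} {gs} (I ∷ L , min) = L , λ hs M e → ℕ.≤-pred (min (i ∷ hs) (I ∷ M) (cong (σ i) ∘ e))

tail-⋖ : ∀ {n i gs} → Reduced n (i ∷ gs) → vec n gs ⋖ vec n (i ∷ gs)
tail-⋖ {n} {i} {gs} r = delete-⋖ [] i gs r (Reduced-tail r)

nil-≤B : ∀ {n} gs → Reduced n gs → vec n [] ≤B vec n gs
nil-≤B [] r = ε
nil-≤B (i ∷ gs) r = nil-≤B gs (Reduced-tail r) ◅◅ (tail-⋖ r ◅ ε)

-- If `v` is not the top, the first cover of the chain records its length together with a shortest
-- word, so none has to be searched for.
reduced-below : ∀ {n v gs} → Reduced n gs → v ≤B vec n gs → ∃ λ ks → Reduced n ks × v ≡ vec n ks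
reduced-below {gs = gs} r ε = gs , r , refl
reduced-below r ((_ , lv , _) ◅ p) with hasLength⇒reduced lv
... | ks , r′ , _ , e = ks , r′ , e

⊆-≢⇒∣∣< : ∀ {r} {S T : Subset r} → S Subset.⊆ T → S ≢ T → Subset.∣ S ∣ ℕ.< Subset.∣ T ∣
⊆-≢⇒∣∣< {S = []} {[]} p n = ⊥-elim (n refl)
⊆-≢⇒∣∣< {S = true ∷ S} {true ∷ T} p n = s≤s (⊆-≢⇒∣∣< (Subset.drop-∷-⊆ p) (n ∘ cong (true ∷_)))
⊆-≢⇒∣∣< {S = true ∷ S} {false ∷ T} p n with p Vec.here
... | ()
⊆-≢⇒∣∣< {S = false ∷ S} {true ∷ T} p n = s≤s (Subset.p⊆q⇒∣p∣≤∣q∣ (Subset.drop-∷-⊆ p))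
⊆-≢⇒∣∣< {S = false ∷ S} {false ∷ T} p n = ⊆-≢⇒∣∣< (Subset.drop-∷-⊆ p) (n ∘ cong (false ∷_))

lookup-injective⇒Unique : ∀ {A : Set} (xs : List A) → (∀ j k → List.lookup xs j ≡ List.lookup xs k → j ≡ k) →
  Unique xs
lookup-injective⇒Unique xs p = subst Unique (List.tabulate-lookup xs) (Unique.tabulate⁺ (p _ _))

∣⊥∣-minimal : ∀ {r} {S : Subset r} → S Subset.⊆ Subset.⊥ → Subset.∣ S ∣ ℕ.≤ 0
∣⊥∣-minimal {r} {S} p = subst (Subset.∣ S ∣ ℕ.≤_) (Subset.∣⊥∣≡0 r) (Subset.p⊆q⇒∣p∣≤∣q∣ p)

injection-onto : ∀ {r l} → l ℕ.≤ r → (g : Fin r → Fin l) → (∀ {x y} → g x ≡ g y → x ≡ y) → ∀ y → ∃ λ x → g x ≡ y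
injection-onto {r} {l} l≤r g g-inj with ℕ.≤-antisym l≤r (Fin.injective⇒≤ g-inj)
... | refl = injective⇒hits g g-inj

-- The rank function of the subset lattice dominates length, so the ideal has at least ℓ(w) atoms;
-- each atom is a generator occurring in the word, so the ℓ(w) letters are distinct.
boolean⇒unique : ∀ n gs → Reduced n gs → BooleanIdeal (vec n gs) → Unique gs
boolean⇒unique n gs R (r , f , f-inj , f-surj , f-iso) = lookup-injective⇒Unique gs distinct
  where
  w = vec n gs
  mono : ∀ {u v} → u ≤B v → v ≤B w → f u Subset.⊆ f v
  mono {u} {v} p q = Equivalence.to (f-iso u v (p ◅◅ q) q) p
  size : ∀ ks → Reduced n ks → vec n ks ≤B w → length ks ℕ.≤ Subset.∣ f (vec n ks) ∣
  size [] R′ p = z≤n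
  size (i ∷ ks) R′@(I ∷ K , min) p = ℕ.≤-trans (s≤s (size ks (Reduced-tail R′) (c ◅ p)))
    (⊆-≢⇒∣∣< (mono (c ◅ ε) p) λ e → ℕ.<-irrefl refl
      (min ks K (λ x → sym (vec-ext n K (I ∷ K) (f-inj _ _ (c ◅ p) p e) x))))
    where
    c : vec n ks ⋖ vec n (i ∷ ks)
    c = tail-⋖ R′
  -- The identity lies below the element coded by the empty set. This excludes the empty word as the
  -- preimage of a singleton, so that such a preimage is a single letter.
  bottom : Subset.∣ f (vec n []) ∣ ℕ.≤ 0
  bottom with f-surj Subset.⊥
  ... | v , p , e with reduced-below R p
  ...   | ks , R′ , refl = ∣⊥∣-minimal (subst (f (vec n []) Subset.⊆_) e (mono (nil-≤B ks R′) p))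
  atom : ∀ j → ∃ λ i → i ∈ gs × f (vec n (i ∷ [])) ≡ Subset.⁅ j ⁆
  atom j with f-surj Subset.⁅ j ⁆
  ... | v , p , e with reduced-below R p
  ...   | ks , R′@(K , _) , refl with size ks R′ p
  ...     | b with subst (λ S → length ks ℕ.≤ Subset.∣ S ∣) e b
  ...       | b′ rewrite Subset.∣⁅x⁆∣≡1 j = go ks R′ p e b′
    where
    go : ∀ ks → Reduced n ks → vec n ks ≤B w → f (vec n ks) ≡ Subset.⁅ j ⁆ → length ks ℕ.≤ 1 →
         ∃ λ i → i ∈ gs × f (vec n (i ∷ [])) ≡ Subset.⁅ j ⁆
    go [] R′ p e b with subst (ℕ._≤ 0) (trans (cong Subset.∣_∣ e) (Subset.∣⁅x⁆∣≡1 j)) bottom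
    ... | ()
    go (i ∷ []) (K , _) p e b with ≤B⇒sublist gs (proj₁ R) p
    ... | hs , s , e′ = i , Sublist.lookup s (support-∈ (i ∷ []) hs ([] ∷ [])
          (vec-ext n K (Sublist.All-resp-⊆ s (proj₁ R)) e′) (here refl)) , e
    go (_ ∷ _ ∷ _) R′ p e (s≤s ())
  letter : Fin r → ℕ
  letter j = proj₁ (atom j)
  letter-injective : ∀ {j k} → letter j ≡ letter k → j ≡ k
  letter-injective {j} {k} e = Subset.x∈⁅y⁆⇒x≡y k (subst (j Subset.∈_)
    (trans (sym (proj₂ (proj₂ (atom j)))) (trans (cong (λ i → f (vec n (i ∷ []))) e) (proj₂ (proj₂ (atom k)))))
    (Subset.x∈⁅x⁆ j))
  place : Fin r → Fin (length gs)
  place j = Any.index (proj₁ (proj₂ (atom j)))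
  place-letter : ∀ j → letter j ≡ List.lookup gs (place j)
  place-letter j = Any.lookup-index (proj₁ (proj₂ (atom j)))
  place-injective : ∀ {j k} → place j ≡ place k → j ≡ k
  place-injective {j} {k} e =
    letter-injective (trans (place-letter j) (trans (cong (List.lookup gs) e) (sym (place-letter k))))
  -- The length of `gs` is at most the size of `f w`, hence at most `r`, while the `r` atoms inject
  -- into the places of `gs`; so the injection is onto.
  onto : ∀ a → ∃ λ j → place j ≡ a
  onto = injection-onto (ℕ.≤-trans (size gs R ε) (Subset.∣p∣≤n (f w))) place place-injective
  distinct : ∀ a b → List.lookup gs a ≡ List.lookup gs b → a ≡ b
  distinct a b e with onto a | onto b
  ... | j , refl | k , refl = cong place (letter-injective (trans (place-letter j) (trans e (sym (place-letter k)))))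

-- Pattern occurrences

-- Places are counted from 0: place i is position i + 1 of the one-line notation.
record Occ {k : ℕ} (n : ℕ) (f : ℤ → ℤ) (p : Vec ℤ k) : Set where
  field
    place  : Fin k → ℕ
    place< : ∀ a → place a ℕ.< n
    mono   : ∀ a b → a Fin.< b → place a ℕ.< place b
    signs  : ∀ a → sign (f (+ suc (place a))) ≡ sign (lookup p a)
    order  : ∀ a b → (∣ f (+ suc (place a)) ∣ ℕ.< ∣ f (+ suc (place b)) ∣) ⇔ (∣ lookup p a ∣ ℕ.< ∣ lookup p b ∣)

open Occ

AvoidsF : ℕ → (ℤ → ℤ) → Set
AvoidsF n f = All (λ p → ¬ Occ n f (proj₂ p)) patterns

contains⇒occ : ∀ {n k} {w : Vec ℤ n} {p : Vec ℤ k} → Contains w p → Occ n (apply w) p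
contains⇒occ {w = w} {p} (ι , m , s , o) = record
  { place  = toℕ ∘ ι
  ; place< = Fin.toℕ<n ∘ ι
  ; mono   = m
  ; signs  = λ a → trans (cong sign (apply-lookup w (ι a))) (s a)
  ; order  = λ a b → subst₂ (λ x y → (∣ x ∣ ℕ.< ∣ y ∣) ⇔ (∣ lookup p a ∣ ℕ.< ∣ lookup p b ∣))
      (sym (apply-lookup w (ι a))) (sym (apply-lookup w (ι b))) (o a b) }

occ⇒contains : ∀ {n k} {w : Vec ℤ n} {p : Vec ℤ k} → Occ n (apply w) p → Contains w p
occ⇒contains {n} {w = w} {p} O = (λ a → Fin.fromℕ< (place< O a)) ,
  (λ a b a<b → subst₂ ℕ._<_ (sym (Fin.toℕ-fromℕ< (place< O a))) (sym (Fin.toℕ-fromℕ< (place< O b)))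
    (mono O a b a<b)) ,
  (λ a → trans (cong sign (sym (apply-< w (place< O a)))) (signs O a)) ,
  (λ a b → subst₂ (λ x y → (∣ x ∣ ℕ.< ∣ y ∣) ⇔ (∣ lookup p a ∣ ℕ.< ∣ lookup p b ∣))
      (apply-< w (place< O a)) (apply-< w (place< O b)) (order O a b))

Occ-mono : ∀ {m n k f} {p : Vec ℤ k} → m ℕ.≤ n → Occ m f p → Occ n f p
Occ-mono m≤n O =
  record { place = place O ; place< = λ a → ℕ.≤-trans (place< O a) m≤n
         ; mono = mono O ; signs = signs O ; order = order O }

Occ-restrict : ∀ {n k f} {p : Vec ℤ k} (O : Occ (suc n) f p) → (∀ a → place O a ≢ n) → Occ n f p
Occ-restrict O ≢n =
  record { place = place O ; place< = λ a → ℕ.≤∧≢⇒< (ℕ.≤-pred (place< O a)) (≢n a)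
         ; mono = mono O ; signs = signs O ; order = order O }

Occ-transport : ∀ {m n k f g} {p : Vec ℤ k} (O : Occ m f p) (π : Fin k → ℕ) →
  (∀ a → π a ℕ.< n) → (∀ a b → a Fin.< b → π a ℕ.< π b) →
  (∀ a → g (+ suc (π a)) ≡ f (+ suc (place O a))) → Occ n g p
Occ-transport {p = p} O π π< π-mono e = record { place = π ; place< = π< ; mono = π-mono
  ; signs = λ a → trans (cong sign (e a)) (signs O a)
  ; order =
    λ a b → subst₂ (λ x y → (∣ x ∣ ℕ.< ∣ y ∣) ⇔ (∣ lookup p a ∣ ℕ.< ∣ lookup p b ∣)) (sym (e a)) (sym (e b))
    (order O a b) }

Occ-cong : ∀ {n k f g} {p : Vec ℤ k} → (∀ {i} → i ℕ.< n → g (+ suc i) ≡ f (+ suc i)) → Occ n f p → Occ n g p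
Occ-cong e O = Occ-transport O (place O) (place< O) (mono O) (λ a → e (place< O a))

-- Occurrences and the largest generator

σ-sign : ∀ i x → sign (σ (suc i) x) ≡ sign x
σ-sign i x = go (refl-view (α (suc i)) (β (suc i)) x)
  where
  go : ∀ {y} → Refl (α (suc i)) (β (suc i)) x y → sign y ≡ sign x
  go (atA refl)  = refl
  go (atB refl)  = refl
  go (at-A refl) = refl
  go (at-B refl) = refl
  go (off _ _ _ _) = refl

∣σ∣-top : ∀ q {x} → ∣ x ∣ ≡ suc q → ∣ σ (suc q) x ∣ ≡ suc (suc q)
∣σ∣-top q {+ .(suc q)} refl = cong ∣_∣ (σ-α (suc q))
∣σ∣-top q { -[1+ .q ]} refl = cong ∣_∣ (refl-unique (simple-root (suc q)) (at-A refl))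

-- Among absolute values up to `suc q` only `suc q` changes, and it rises by one: a relabelling that
-- keeps the order. Patterns see nothing else.
σ-<⇔ : ∀ q {x y} → ∣ x ∣ ℕ.≤ suc q → ∣ y ∣ ℕ.≤ suc q →
       (∣ x ∣ ℕ.< ∣ y ∣) ⇔ (∣ σ (suc q) x ∣ ℕ.< ∣ σ (suc q) y ∣)
σ-<⇔ q {x} {y} bx by with ℕ.m≤n⇒m<n∨m≡n bx | ℕ.m≤n⇒m<n∨m≡n by
... | inj₁ p | inj₁ r rewrite σ-fixes-small q {x} p | σ-fixes-small q {y} r = mk⇔ (λ z → z) (λ z → z)
... | inj₁ p | inj₂ r rewrite σ-fixes-small q {x} p | ∣σ∣-top q {y} r | r = mk⇔ ℕ.m≤n⇒m≤1+n (λ _ → p)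
... | inj₂ p | inj₁ r rewrite σ-fixes-small q {y} r | ∣σ∣-top q {x} p | p =
  mk⇔ (λ z → ⊥-elim (ℕ.<-asym z r)) (λ z → ⊥-elim (ℕ.<-asym z (ℕ.m≤n⇒m≤1+n r)))
... | inj₂ p | inj₂ r rewrite ∣σ∣-top q {x} p | ∣σ∣-top q {y} r | p | r =
  mk⇔ (λ z → ⊥-elim (ℕ.<-irrefl refl z)) (λ z → ⊥-elim (ℕ.<-irrefl refl z))

Occ-σ∘⁺ : ∀ {m k f} {p : Vec ℤ k} q → (∀ {i} → i ℕ.< m → ∣ f (+ suc i) ∣ ℕ.≤ suc q) → Occ m f p →
  Occ m (σ (suc q) ∘ f) p
Occ-σ∘⁺ q b O = record { place = place O ; place< = place< O ; mono = mono O
  ; signs = λ a → trans (σ-sign q _) (signs O a)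
  ; order = λ a c → order O a c ⇔-∘ ⇔-sym (σ-<⇔ q (b (place< O a)) (b (place< O c))) }

Occ-σ∘⁻ : ∀ {m k f} {p : Vec ℤ k} q → (∀ {i} → i ℕ.< m → ∣ f (+ suc i) ∣ ℕ.≤ suc q) → Occ m (σ (suc q) ∘ f) p →
  Occ m f p
Occ-σ∘⁻ q b O = record { place = place O ; place< = place< O ; mono = mono O
  ; signs = λ a → trans (sym (σ-sign q _)) (signs O a)
  ; order = λ a c → order O a c ⇔-∘ σ-<⇔ q (b (place< O a)) (b (place< O c)) }

-- The first `suc q` entries of `f ∘ σ (suc q)` are the entries of `f` with place `q` left out, so
-- its place `q` corresponds to place `suc q` of `f`.
Occ-∘σ⁺ : ∀ {k f} {p : Vec ℤ k} q → Occ (suc q) (f ∘ σ (suc q)) p → Occ (suc (suc q)) f p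
Occ-∘σ⁺ {k} {f} {p} q O = Occ-transport O π π< π-mono value
  where
  lift : ∀ i → Dec (i ≡ q) → ℕ
  lift i (yes _) = suc q
  lift i (no _)  = i
  π : Fin k → ℕ
  π a = lift (place O a) (place O a ℕ.≟ q)
  π< : ∀ a → π a ℕ.< suc (suc q)
  π< a with place O a ℕ.≟ q
  ... | yes _ = ℕ.≤-refl
  ... | no _ = ℕ.m≤n⇒m≤1+n (place< O a)
  π-mono : ∀ a b → a Fin.< b → π a ℕ.< π b
  π-mono a b a<b with place O a ℕ.≟ q | place O b ℕ.≟ q
  ... | yes e | _ = ⊥-elim (ℕ.<-irrefl refl (ℕ.≤-trans (place< O b) (subst (ℕ._< place O b) e (mono O a b a<b))))
  ... | no _ | yes e = ℕ.m≤n⇒m≤1+n (subst (place O a ℕ.<_) e (mono O a b a<b))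
  ... | no _ | no _ = mono O a b a<b
  value : ∀ a → f (+ suc (π a)) ≡ f (σ (suc q) (+ suc (place O a)))
  value a with place O a ℕ.≟ q
  ... | yes e = cong f (sym (trans (cong (σ (suc q) ∘ +_ ∘ suc) e) (σ-α (suc q))))
  ... | no ≢q = cong f (sym (σ-fixes-small q {+ suc (place O a)} (s≤s (ℕ.≤∧≢⇒< (ℕ.≤-pred (place< O a)) ≢q))))

Occ-∘σ⁻ : ∀ {k f} {p : Vec ℤ k} q (O : Occ (suc (suc q)) (f ∘ σ (suc q)) p) → (∀ a → place O a ≢ q) → Occ (suc q) f p
Occ-∘σ⁻ {k} {f} {p} q O ≢q = Occ-transport O π π< π-mono value
  where
  lower : ∀ i → Dec (i ≡ suc q) → ℕ
  lower i (yes _) = q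
  lower i (no _)  = i
  below : ∀ a → place O a ≢ suc q → place O a ℕ.< q
  below a ≢ = ℕ.≤∧≢⇒< (ℕ.≤-pred (ℕ.≤∧≢⇒< (ℕ.≤-pred (place< O a)) ≢)) (≢q a)
  π : Fin k → ℕ
  π a = lower (place O a) (place O a ℕ.≟ suc q)
  π< : ∀ a → π a ℕ.< suc q
  π< a with place O a ℕ.≟ suc q
  ... | yes _ = ℕ.≤-refl
  ... | no ≢ = ℕ.m≤n⇒m≤1+n (below a ≢)
  π-mono : ∀ a b → a Fin.< b → π a ℕ.< π b
  π-mono a b a<b with place O a ℕ.≟ suc q | place O b ℕ.≟ suc q
  ... | yes e | _ = ⊥-elim (ℕ.<-irrefl refl (ℕ.≤-trans (place< O b) (subst (ℕ._< place O b) e (mono O a b a<b))))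
  ... | no ≢ | yes e = below a ≢
  ... | no _ | no _ = mono O a b a<b
  value : ∀ a → f (+ suc (π a)) ≡ f (σ (suc q) (+ suc (place O a)))
  value a with place O a ℕ.≟ suc q
  ... | yes e = cong f (sym (trans (cong (σ (suc q) ∘ +_ ∘ suc) e) (σ-β (suc q))))
  ... | no ≢ = cong f (sym (σ-fixes-small q {+ suc (place O a)} (s≤s (below a ≢))))

-- An entry with one larger absolute value beside it in an occurrence is not the largest, and with
-- two such it is not the second largest either. The conditions therefore keep `+ n` from playing a
-- part in the last two places, and `+ (n - 1)` in the last.
Dominated : ∀ {k} → Vec ℤ k → Set
Dominated {k} p = ∀ a → sign (lookup p a) ≡ Sign.+ →
  (suc (toℕ a) ≡ k → ∃ λ b → ∃ λ c → b ≢ c × ∣ lookup p a ∣ ℕ.< ∣ lookup p b ∣ × ∣ lookup p a ∣ ℕ.< ∣ lookup p c ∣) ×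
  (suc (suc (toℕ a)) ≡ k → ∃ λ b → ∣ lookup p a ∣ ℕ.< ∣ lookup p b ∣)

dominated? : ∀ {k} (p : Vec ℤ k) → Dec (Dominated p)
dominated? {k} p = Fin.all? λ a → (sign (lookup p a) Sign.≟ Sign.+) →-dec
  (((suc (toℕ a) ℕ.≟ k) →-dec Fin.any? λ b → Fin.any? λ c → ¬? (b Fin.≟ c) ×-dec
      (∣ lookup p a ∣ ℕ.<? ∣ lookup p b ∣) ×-dec (∣ lookup p a ∣ ℕ.<? ∣ lookup p c ∣))
   ×-dec ((suc (suc (toℕ a)) ℕ.≟ k) →-dec Fin.any? λ b → ∣ lookup p a ∣ ℕ.<? ∣ lookup p b ∣))

-- Hence an entry that is too large for its place at the end belongs to no occurrence of a pattern.
patterns-dominated : All (Dominated ∘ proj₂) patterns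
patterns-dominated = from-yes (All.all? (dominated? ∘ proj₂) patterns)

module _ {k n f} {p : Vec ℤ k} (O : Occ n f p) where

  place-last : ∀ a → suc (place O a) ≡ n → suc (toℕ a) ≡ k
  place-last a e with ℕ.m≤n⇒m<n∨m≡n (Fin.toℕ<n a)
  ... | inj₂ q = q
  ... | inj₁ q =
    ⊥-elim (ℕ.<-irrefl e (ℕ.≤-trans
    (s≤s (mono O a (Fin.fromℕ< q) (subst (toℕ a ℕ.<_) (sym (Fin.toℕ-fromℕ< q)) ℕ.≤-refl))) (place< O _)))

  place-late : ∀ a → suc (suc (place O a)) ≡ n → suc (toℕ a) ≡ k ⊎ suc (suc (toℕ a)) ≡ k
  place-late a e with ℕ.m≤n⇒m<n∨m≡n (Fin.toℕ<n a)
  ... | inj₂ q = inj₁ q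
  ... | inj₁ q = inj₂ (trans (cong suc (sym toℕ-b)) (place-last b
      (ℕ.≤-antisym (place< O b)
        (subst (ℕ._≤ suc (place O b)) e (s≤s (mono O a b (subst (toℕ a ℕ.<_) (sym toℕ-b) ℕ.≤-refl)))))))
    where
    b : Fin k
    b = Fin.fromℕ< q
    toℕ-b : toℕ b ≡ suc (toℕ a)
    toℕ-b = Fin.toℕ-fromℕ< q

  place-injective : ∀ {a b} → place O a ≡ place O b → a ≡ b
  place-injective {a} {b} e with ℕ.<-cmp (toℕ a) (toℕ b)
  ... | tri< q _ _ = ⊥-elim (ℕ.<-irrefl e (mono O a b q))
  ... | tri≈ _ q _ = Fin.toℕ-injective q
  ... | tri> _ _ q = ⊥-elim (ℕ.<-irrefl (sym e) (mono O b a q))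

  no-top-late : Dominated p → (∀ a → ∣ f (+ suc (place O a)) ∣ ℕ.≤ n) →
                ∀ a → f (+ suc (place O a)) ≡ + n → suc (toℕ a) ≡ k ⊎ suc (suc (toℕ a)) ≡ k → ⊥
  no-top-late D bd a e late =
    ℕ.<-irrefl refl (ℕ.≤-trans (subst (λ x → ∣ x ∣ ℕ.< ∣ f (+ suc (place O (proj₁ (bigger late)))) ∣) e
    (Equivalence.from (order O a (proj₁ (bigger late))) (proj₂ (bigger late)))) (bd (proj₁ (bigger late))))
    where
    s : sign (lookup p a) ≡ Sign.+
    s = trans (sym (signs O a)) (cong sign e)
    bigger : suc (toℕ a) ≡ k ⊎ suc (suc (toℕ a)) ≡ k → ∃ λ b → ∣ lookup p a ∣ ℕ.< ∣ lookup p b ∣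
    bigger (inj₁ q) with proj₁ (D a s) q
    ... | b , _ , _ , u , _ = b , u
    bigger (inj₂ q) = proj₂ (D a s) q

-- Here `f` ends in its largest value. The three lemmas treat the last generator being absent,
-- multiplied on the right (the largest value moves one place to the left), and multiplied on the
-- left (the two largest absolute values are exchanged).
module _ {k} {p : Vec ℤ k} (D : Dominated p) (q : ℕ) {f : ℤ → ℤ} (P : Perm (suc (suc q)) f)
  (top : f (+ suc (suc q)) ≡ + suc (suc q)) where

  avoids-extend : ¬ Occ (suc q) f p → ¬ Occ (suc (suc q)) f p
  avoids-extend av O = av (Occ-restrict O λ a e →
    no-top-late O D (λ b → bounded P {+ suc (place O b)} (place< O b)) a (trans (cong (f ∘ +_ ∘ suc) e) top)
      (inj₁ (place-last O a (cong suc e))))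

  avoids-∘σ : ¬ Occ (suc q) f p → ¬ Occ (suc (suc q)) (f ∘ σ (suc q)) p
  avoids-∘σ av O = av (Occ-∘σ⁻ q O λ a e →
    no-top-late O D (λ b → bounded P′ {+ suc (place O b)} (place< O b)) a
      (trans (cong (f ∘ σ (suc q) ∘ +_ ∘ suc) e) (trans (cong f (σ-α (suc q))) top))
      (place-late O a (cong (suc ∘ suc) e)))
    where
    P′ : Perm (suc (suc q)) (f ∘ σ (suc q))
    P′ = Perm-∘ev (suc q ∷ []) ((ℕ.n≤1+n _ , ℕ.≤-refl) ∷ []) P

  avoids-σ∘ : ¬ Occ (suc q) f p → ¬ Occ (suc (suc q)) (σ (suc q) ∘ f) p
  avoids-σ∘ av O =
    av (Occ-σ∘⁻ q bd (Occ-restrict O λ a e → last a e (proj₁ (D a (s a e)) (place-last O a (cong suc e)))))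
    where
    P₀ : Perm (suc q) f
    P₀ = Perm-restrict P (cong ∣_∣ top)
    P′ : Perm (suc (suc q)) (σ (suc q) ∘ f)
    P′ = Perm-ev∘ (suc q ∷ []) ((ℕ.n≤1+n _ , ℕ.≤-refl) ∷ []) P
    bd : ∀ {i} → i ℕ.< suc q → ∣ f (+ suc i) ∣ ℕ.≤ suc q
    bd {i} b = bounded P₀ {+ suc i} b
    top′ : ∀ a → place O a ≡ suc q → σ (suc q) (f (+ suc (place O a))) ≡ + suc q
    top′ a e = trans (cong (σ (suc q) ∘ f ∘ +_ ∘ suc) e) (trans (cong (σ (suc q)) top) (σ-β (suc q)))
    s : ∀ a → place O a ≡ suc q → sign (lookup p a) ≡ Sign.+
    s a e = trans (sym (signs O a)) (cong sign (top′ a e))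
    biggest : ∀ a b → place O a ≡ suc q → ∣ lookup p a ∣ ℕ.< ∣ lookup p b ∣ →
      ∣ σ (suc q) (f (+ suc (place O b))) ∣ ≡ suc (suc q)
    biggest a b e u = ℕ.≤-antisym (bounded P′ {+ suc (place O b)} (place< O b))
      (subst (λ x → ∣ x ∣ ℕ.< _) (top′ a e) (Equivalence.from (order O a b) u))
    -- Two absolute values above `suc q` would both have to be `suc (suc q)`, against injectivity.
    last : ∀ a → place O a ≡ suc q →
           (∃ λ b → ∃ λ c → b ≢ c × ∣ lookup p a ∣ ℕ.< ∣ lookup p b ∣ × ∣ lookup p a ∣ ℕ.< ∣ lookup p c ∣) → ⊥
    last a e (b , c , b≢c , u , v) = b≢c (place-injective O (ℕ.suc-injective
      (inj P′ {+ suc (place O b)} {+ suc (place O c)} (place< O b) (place< O c)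
        (trans (biggest a b e u) (sym (biggest a c e v))))))

-- Finite checks

allVec? : ∀ {A : Set} {n} (xs : List A) {P : Vec A n → Set} → (∀ v → Dec (P v)) →
  Dec (∀ v → VecAll.All (_∈ xs) v → P v)
allVec? {n = zero} xs P? = map′ (λ { p [] VecAll.[] → p }) (λ h → h [] VecAll.[]) (P? [])
allVec? {n = suc n} xs P? = map′
  (λ { A (x ∷ v) (x∈ VecAll.∷ v∈) → All.lookup A x∈ v v∈ })
  (λ h → All.tabulate λ {x} x∈ v v∈ → h (x ∷ v) (x∈ VecAll.∷ v∈))
  (All.all? (λ x → allVec? xs (λ v → P? (x ∷ v))) xs)

anyFinVec? : ∀ {k n} {P : Vec (Fin n) k → Set} → (∀ v → Dec (P v)) → Dec (∃ P)
anyFinVec? {zero} P? = map′ (λ p → [] , p) (λ { ([] , p) → p }) (P? [])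
anyFinVec? {suc k} P? = map′ (λ { (x , v , p) → x ∷ v , p }) (λ { (x ∷ v , p) → x , v , p })
  (Fin.any? λ x → anyFinVec? λ v → P? (x ∷ v))

_⇔-dec_ : ∀ {A B : Set} → Dec A → Dec B → Dec (A ⇔ B)
A? ⇔-dec B? =
  map′ (λ (f , g) → mk⇔ f g) (λ e → Equivalence.to e , Equivalence.from e) ((A? →-dec B?) ×-dec (B? →-dec A?))

-- Position maps are searched in the form of vectors, which can be enumerated; `tabulate` gives
-- every map such a form with the same values.
contains? : ∀ {n k} (w : Vec ℤ n) (p : Vec ℤ k) → Dec (Contains w p)
contains? {n} {k} w p = map′ (λ (v , q) → lookup v , q)
  (λ (ι , m , s , o) → tabulate ι ,
    (λ a b a<b → subst₂ Fin._<_ (sym (Vec.lookup∘tabulate ι a)) (sym (Vec.lookup∘tabulate ι b)) (m a b a<b)) ,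
    (λ a → trans (cong (sign ∘ lookup w) (Vec.lookup∘tabulate ι a)) (s a)) ,
    (λ a b → subst₂ (λ i j → (∣ lookup w i ∣ ℕ.< ∣ lookup w j ∣) ⇔ (∣ lookup p a ∣ ℕ.< ∣ lookup p b ∣))
      (sym (Vec.lookup∘tabulate ι a)) (sym (Vec.lookup∘tabulate ι b)) (o a b)))
  (anyFinVec? λ v →
    (Fin.all? λ a → Fin.all? λ b → (a Fin.<? b) →-dec (lookup v a Fin.<? lookup v b)) ×-dec
    (Fin.all? λ a → sign (lookup w (lookup v a)) Sign.≟ sign (lookup p a)) ×-dec
    (Fin.all? λ a → Fin.all? λ b →
      (∣ lookup w (lookup v a) ∣ ℕ.<? ∣ lookup w (lookup v b) ∣) ⇔-dec (∣ lookup p a ∣ ℕ.<? ∣ lookup p b ∣)))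

avoidsAll? : ∀ {n} (w : Vec ℤ n) → Dec (AvoidsAll w)
avoidsAll? w = All.all? (λ p → ¬? (contains? w (proj₂ p))) patterns

opaque
  unfolding refl⟨_,_⟩

  -- Rank 3 has three letters, so words without repetition are shorter than 4 and form a finite
  -- table. Lower ranks are covered too, since an occurrence in rank n is one in any higher rank.
  small-unique-avoids : ∀ l → l ℕ.< 4 → ∀ (v : Vec ℕ l) → VecAll.All (_∈ 0 ∷ 1 ∷ 2 ∷ []) v → Unique (toList v) →
    AvoidsAll (vec 3 (toList v))
  small-unique-avoids l l<4 =
    subst (λ l → ∀ (v : Vec ℕ l) → VecAll.All (_∈ 0 ∷ 1 ∷ 2 ∷ []) v → Unique (toList v) →
    AvoidsAll (vec 3 (toList v)))
    (Fin.toℕ-fromℕ< l<4) (table (Fin.fromℕ< l<4))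
    where
    Table : Set
    Table = ∀ (l : Fin 4) (v : Vec ℕ (toℕ l)) → VecAll.All (_∈ 0 ∷ 1 ∷ 2 ∷ []) v → Unique (toList v) →
      AvoidsAll (vec 3 (toList v))
    table? : Dec Table
    table? = Fin.all? λ l → allVec? {n = toℕ l} (0 ∷ 1 ∷ 2 ∷ []) {P =
      λ v → Unique (toList v) → AvoidsAll (vec 3 (toList v))}
               (λ v → unique? (toList v) →-dec avoidsAll? (vec 3 (toList v)))
    table : Table
    table = from-yes table?

-- Words with distinct letters avoid the patterns

Letter-below : ∀ {n i} → 2 ℕ.≤ n → Letter (suc n) i → i ≢ n → Letter n i
Letter-below {i = zero}  2≤n _ _ = 2≤n , ℕ.<⇒≤ 2≤n
Letter-below {i = suc i} 2≤n (p , q) i≢n = ℕ.≤-pred q , ℕ.≤∧≢⇒< (ℕ.≤-pred q) i≢n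

Letters-below : ∀ {n} gs → 2 ℕ.≤ n → Letters (suc n) gs → n ∉ gs → Letters n gs
Letters-below []       2≤n []      n∉ = []
Letters-below (i ∷ gs) 2≤n (I ∷ L) n∉ = Letter-below 2≤n I (n∉ ∘ here ∘ sym) ∷ Letters-below gs 2≤n L (n∉ ∘ there)

σ-large : ∀ q {x} → q ℕ.< ∣ x ∣ → q ℕ.< ∣ σ (suc q) x ∣
σ-large q {x} u = go (refl-view (α (suc q)) (β (suc q)) x)
  where
  go : ∀ {y} → Refl (α (suc q)) (β (suc q)) x y → q ℕ.< ∣ y ∣
  go (atA _)  = ℕ.m≤n⇒m≤1+n ℕ.≤-refl
  go (atB _)  = ℕ.≤-refl
  go (at-A _) = ℕ.m≤n⇒m≤1+n ℕ.≤-refl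
  go (at-B _) = ℕ.≤-refl
  go (off _ _ _ _) = u

-- The two factors move disjoint sets: `vs` only absolute values up to `q`, the generator only
-- larger ones.
σ-ev-comm : ∀ q vs → Letters q vs → ∀ x → σ (suc q) (ev vs x) ≡ ev vs (σ (suc q) x)
σ-ev-comm q vs L x with ∣ x ∣ ℕ.≤? q
... | yes u =
  trans (σ-fixes-small q {ev vs x} (s≤s (ev-bounded vs L u))) (cong (ev vs) (sym (σ-fixes-small q {x} (s≤s u))))
... | no u = trans (cong (σ (suc q)) (ev-fixes vs L (ℕ.≰⇒> u))) (sym (ev-fixes vs L (σ-large q (ℕ.≰⇒> u))))

Unique-disjoint : ∀ us {ws} → Unique (us ++ ws) → ∀ {j : ℕ} → j ∈ us → j ∉ ws
Unique-disjoint (u ∷ us) (a ∷ U) (here refl) m = All.lookup a (∈-++⁺ʳ us m) refl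
Unique-disjoint (u ∷ us) (a ∷ U) (there n)   m = Unique-disjoint us U n m

-- The last letter commutes with all letters but its only neighbour q, which occurs on at most one side of it.
peel : ∀ q gs → 2 ℕ.≤ q → Letters (suc (suc q)) gs → Unique gs →
       Letters (suc q) gs ⊎
       ∃ λ hs → Letters (suc q) hs × Unique hs ×
         ((∀ x → ev gs x ≡ ev hs (σ (suc q) x)) ⊎ (∀ x → ev gs x ≡ σ (suc q) (ev hs x)))
peel q gs 2≤q L U with suc q ∈? gs
... | no n∉ = inj₁ (Letters-below gs (ℕ.m≤n⇒m≤1+n 2≤q) L n∉)
... | yes n∈ with ∈-∃++ n∈
...   | us , vs , refl = inj₂ (us ++ vs , All.++⁺ Lu Lv , Unique-⊑ (Sublist.++⁺ ⊆-refl (suc q ∷ʳ ⊆-refl)) U , sides)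
  where
  open ≡-Reasoning
  Lu : Letters (suc q) us
  Lu = Letters-below us (ℕ.m≤n⇒m≤1+n 2≤q) (All.++⁻ˡ us L) (proj₁ (Unique-middle us U))
  Lv : Letters (suc q) vs
  Lv = Letters-below vs (ℕ.m≤n⇒m≤1+n 2≤q) (All.tail (All.++⁻ʳ us L)) (proj₂ (Unique-middle us U))
  sides : (∀ x → ev (us ++ suc q ∷ vs) x ≡ ev (us ++ vs) (σ (suc q) x)) ⊎
    (∀ x → ev (us ++ suc q ∷ vs) x ≡ σ (suc q) (ev (us ++ vs) x))
  sides with q ∈? vs
  ... | no q∉ = inj₁ λ x → begin
    ev (us ++ suc q ∷ vs) x          ≡⟨ ev-++ us (suc q ∷ vs) x ⟩
    ev us (σ (suc q) (ev vs x))      ≡⟨ cong (ev us) (σ-ev-comm q vs (Letters-below vs 2≤q Lv q∉) x) ⟩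
    ev us (ev vs (σ (suc q) x))      ≡⟨ sym (ev-++ us vs _) ⟩
    ev (us ++ vs) (σ (suc q) x)      ∎
  ... | yes q∈ = inj₂ λ x → begin
    ev (us ++ suc q ∷ vs) x          ≡⟨ ev-++ us (suc q ∷ vs) x ⟩
    ev us (σ (suc q) (ev vs x))
      ≡⟨ sym (σ-ev-comm q us (Letters-below us 2≤q Lu λ m → Unique-disjoint us U m (there q∈)) (ev vs x)) ⟩
    σ (suc q) (ev us (ev vs x))      ≡⟨ cong (σ (suc q)) (sym (ev-++ us vs x)) ⟩
    σ (suc q) (ev (us ++ vs) x)      ∎

ev-top : ∀ n gs → Letters n gs → ev gs (+ suc n) ≡ + suc n
ev-top n gs L = ev-fixes gs L {+ suc n} ℕ.≤-refl

Perm-ev : ∀ {n} gs → Letters n gs → Perm n (ev gs)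
Perm-ev {n} gs L = Perm-∘ev gs L (Perm-id n)

AvoidsF-map : ∀ {m n f g} → (∀ {k} {p : Vec ℤ k} → Dominated p → ¬ Occ m f p → ¬ Occ n g p) → AvoidsF m f →
  AvoidsF n g
AvoidsF-map h A = All.zipWith (λ (D , av) → h D av) (patterns-dominated , A)

Occ-≗ : ∀ {n k f g} {p : Vec ℤ k} → (∀ x → g x ≡ f x) → Occ n f p → Occ n g p
Occ-≗ e = Occ-cong (λ {i} _ → e (+ suc i))

small-unique-avoidsF : ∀ gs → Letters 3 gs → Unique gs → AvoidsF 3 (ev gs)
small-unique-avoidsF gs L U =
  All.map (λ av O → av (occ⇒contains {w = vec 3 gs} (Occ-cong (λ {i} i<3 → apply-vec 3 gs {+ suc i} i<3) O)))
  (subst (λ xs → AvoidsAll (vec 3 xs)) list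
    (small-unique-avoids (length gs) (s≤s (Unique-⊆⇒length≤ U (λ m → small (All.lookup L m))))
    (Vec.fromList gs) (members gs L) (subst Unique (sym list) U)))
  where
  list : toList (Vec.fromList gs) ≡ gs
  list = Vec.toList∘fromList gs
  small : ∀ {i} → Letter 3 i → i ∈ 0 ∷ 1 ∷ 2 ∷ []
  small {0} _ = here refl
  small {1} _ = there (here refl)
  small {2} _ = there (there (here refl))
  small {suc (suc (suc _))} (_ , s≤s (s≤s (s≤s ())))
  members : ∀ gs → Letters 3 gs → VecAll.All (_∈ 0 ∷ 1 ∷ 2 ∷ []) (Vec.fromList gs)
  members [] [] = VecAll.[]
  members (i ∷ gs) (I ∷ L) = small I VecAll.∷ members gs L

UniqueAvoids : ℕ → Set
UniqueAvoids n = ∀ gs → Letters n gs → Unique gs → AvoidsF n (ev gs)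

unique⇒avoids-≤3 : ∀ {n} → n ℕ.≤ 3 → UniqueAvoids n
unique⇒avoids-≤3 n≤3 gs L U =
  All.map (_∘ Occ-mono n≤3) (small-unique-avoidsF gs (All.map (λ {i} → Letter-mono n≤3 {i}) L) U)

unique⇒avoids-step : ∀ {q} → 2 ℕ.≤ q → UniqueAvoids (suc q) → UniqueAvoids (suc (suc q))
unique⇒avoids-step {q} 2≤q rec gs L U with peel q gs 2≤q L U
... | inj₁ L′ = AvoidsF-map (λ D → avoids-extend D q (Perm-ev gs L) (ev-top (suc q) gs L′)) (rec gs L′ U)
... | inj₂ (hs , M , V , sides) = go sides
  where
  P : Perm (suc (suc q)) (ev hs)
  P = Perm-ev hs (All.map (λ {i} → Letter-mono (ℕ.n≤1+n (suc q)) {i}) M)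
  go : (∀ x → ev gs x ≡ ev hs (σ (suc q) x)) ⊎ (∀ x → ev gs x ≡ σ (suc q) (ev hs x)) → AvoidsF (suc (suc q)) (ev gs)
  go (inj₁ e) = AvoidsF-map (λ D av → avoids-∘σ D q P (ev-top (suc q) hs M) av ∘ Occ-≗ (sym ∘ e)) (rec hs M V)
  go (inj₂ e) = AvoidsF-map (λ D av → avoids-σ∘ D q P (ev-top (suc q) hs M) av ∘ Occ-≗ (sym ∘ e)) (rec hs M V)

unique⇒avoids : ∀ n → UniqueAvoids n
unique⇒avoids 0 = unique⇒avoids-≤3 z≤n
unique⇒avoids 1 = unique⇒avoids-≤3 (s≤s z≤n)
unique⇒avoids 2 = unique⇒avoids-≤3 (s≤s (s≤s z≤n))
unique⇒avoids 3 = unique⇒avoids-≤3 ℕ.≤-refl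
unique⇒avoids (suc (suc (suc (suc n)))) = unique⇒avoids-step (s≤s (s≤s z≤n)) (unique⇒avoids (suc (suc (suc n))))

-- Avoidance determines the place of the large entries

-- Pattern values count from 1, and so does the index. The list holds the absolute values of an
-- occurrence in increasing order, so pattern value m becomes its m-th member; 0 is the default
-- elsewhere.
nth : ∀ {k} → Vec ℕ k → ℕ → ℕ
nth []       _             = 0
nth (x ∷ xs) zero          = 0
nth (x ∷ xs) (suc zero)    = x
nth (x ∷ xs) (suc (suc m)) = nth xs (suc m)

relabel : ∀ {k} → Vec ℕ k → ℤ → ℤ
relabel xs (+ m)    = + nth xs m
relabel xs -[1+ m ] = - (+ nth xs (suc m))

-- `Ascending`, `Places` and `Values` compute to nested products on explicit lists, so each
-- occurrence below is given by plain tuples of inequalities and equations. Starting from the bound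
-- 0 includes positivity.
Ascending : ∀ {k} → ℕ → Vec ℕ k → Set
Ascending lo []       = ⊤
Ascending lo (x ∷ xs) = lo ℕ.< x × Ascending x xs

Places : ∀ {k} → ℕ → Vec ℕ k → Set
Places n []           = ⊤
Places n (i ∷ [])     = i ℕ.< n
Places n (i ∷ j ∷ is) = i ℕ.< j × Places n (j ∷ is)

Values : ∀ {k l} → (ℤ → ℤ) → Vec ℕ l → Vec ℤ k → Vec ℕ k → Set
Values f xs []      []       = ⊤
Values f xs (z ∷ p) (i ∷ is) = f (+ suc i) ≡ relabel xs z × Values f xs p is

Ascending-lower : ∀ {k lo} (xs : Vec ℕ k) → Ascending lo xs → ∀ {m} → 1 ℕ.≤ m → m ℕ.≤ k → lo ℕ.< nth xs m
Ascending-lower (x ∷ xs) (u , A) {suc zero}    _ b = u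
Ascending-lower (x ∷ xs) (u , A) {suc (suc m)} _ b = ℕ.<-trans u (Ascending-lower xs A (s≤s z≤n) (ℕ.≤-pred b))

nth-mono : ∀ {k lo} (xs : Vec ℕ k) → Ascending lo xs → ∀ {m m′} → 1 ℕ.≤ m → m ℕ.< m′ → m′ ℕ.≤ k →
  nth xs m ℕ.< nth xs m′
nth-mono (x ∷ xs) (u , A) {suc zero}    {suc (suc m′)} _ v b = Ascending-lower xs A (s≤s z≤n) (ℕ.≤-pred b)
nth-mono (x ∷ xs) (u , A) {suc (suc m)} {suc (suc m′)} _ v b = nth-mono xs A (s≤s z≤n) (ℕ.≤-pred v) (ℕ.≤-pred b)
nth-mono (x ∷ xs) (u , A) {suc zero}    {suc zero} _ (s≤s ()) b
nth-mono (x ∷ xs) (u , A) {suc (suc m)} {suc zero} _ (s≤s ()) b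

Places-< : ∀ {k n} (is : Vec ℕ k) → Places n is → ∀ a → lookup is a ℕ.< n
Places-< (i ∷ [])     u       Fin.zero    = u
Places-< (i ∷ j ∷ is) (u , I) Fin.zero    = ℕ.<-trans u (Places-< (j ∷ is) I Fin.zero)
Places-< (i ∷ j ∷ is) (u , I) (Fin.suc a) = Places-< (j ∷ is) I a

Places-mono : ∀ {k n} (is : Vec ℕ k) → Places n is → ∀ a b → a Fin.< b → lookup is a ℕ.< lookup is b
Places-mono (i ∷ j ∷ is) (u , I) Fin.zero    (Fin.suc Fin.zero)    _ = u
Places-mono (i ∷ j ∷ is) (u , I) Fin.zero    (Fin.suc (Fin.suc b)) _ =
  ℕ.<-trans u (Places-mono (j ∷ is) I Fin.zero (Fin.suc b) (s≤s z≤n))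
Places-mono (i ∷ j ∷ is) (u , I) (Fin.suc a) (Fin.suc b) v = Places-mono (j ∷ is) I a b (ℕ.≤-pred v)

Values-lookup : ∀ {k l f} (xs : Vec ℕ l) (p : Vec ℤ k) is → Values f xs p is → ∀ a →
  f (+ suc (lookup is a)) ≡ relabel xs (lookup p a)
Values-lookup xs (z ∷ p) (i ∷ is) (e , V) Fin.zero    = e
Values-lookup xs (z ∷ p) (i ∷ is) (e , V) (Fin.suc a) = Values-lookup xs p is V a

∣relabel∣ : ∀ {k} (xs : Vec ℕ k) z → ∣ relabel xs z ∣ ≡ nth xs ∣ z ∣
∣relabel∣ xs (+ m)    = refl
∣relabel∣ xs -[1+ m ] = ℤ.∣-i∣≡∣i∣ (+ nth xs (suc m))

sign-negate : ∀ {m} → 0 ℕ.< m → sign (- (+ m)) ≡ Sign.-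
sign-negate (s≤s _) = refl

InRange : ∀ {k} → Vec ℤ k → Set
InRange {k} p = ∀ a → 1 ℕ.≤ ∣ lookup p a ∣ × ∣ lookup p a ∣ ℕ.≤ k

patterns-inRange : All (InRange ∘ proj₂) patterns
patterns-inRange =
  from-yes (All.all? (λ p → Fin.all? λ a →
  (1 ℕ.≤? ∣ lookup (proj₂ p) a ∣) ×-dec (∣ lookup (proj₂ p) a ∣ ℕ.≤? proj₁ p)) patterns)

occurrence : ∀ {k n f} (p : Vec ℤ k) → InRange p → (is xs : Vec ℕ k) → Places n is → Ascending 0 xs →
  Values f xs p is → Occ n f p
occurrence {k} {n} {f} p R is xs I A V = record { place = lookup is ; place< = Places-< is I ; mono = Places-mono is I
  ; signs = λ a → trans (cong sign (value a)) (sign-relabel (lookup p a) (R a))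
  ; order =
    λ a b → subst₂ (λ x y → (x ℕ.< y) ⇔ (∣ lookup p a ∣ ℕ.< ∣ lookup p b ∣)) (sym (abs a)) (sym (abs b))
    (mk⇔ (reflect a b) (λ u → nth-mono xs A (proj₁ (R a)) u (proj₂ (R b)))) }
  where
  value : ∀ a → f (+ suc (lookup is a)) ≡ relabel xs (lookup p a)
  value = Values-lookup xs p is V
  abs : ∀ a → ∣ f (+ suc (lookup is a)) ∣ ≡ nth xs ∣ lookup p a ∣
  abs a = trans (cong ∣_∣ (value a)) (∣relabel∣ xs (lookup p a))
  sign-relabel : ∀ z → 1 ℕ.≤ ∣ z ∣ × ∣ z ∣ ℕ.≤ k → sign (relabel xs z) ≡ sign z
  sign-relabel (+ m) _ = refl
  sign-relabel -[1+ m ] (u , v) = sign-negate (Ascending-lower xs A u v)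
  reflect : ∀ a b → nth xs ∣ lookup p a ∣ ℕ.< nth xs ∣ lookup p b ∣ → ∣ lookup p a ∣ ℕ.< ∣ lookup p b ∣
  reflect a b u with ℕ.<-cmp ∣ lookup p a ∣ ∣ lookup p b ∣
  ... | tri< v _ _ = v
  ... | tri≈ _ v _ = ⊥-elim (ℕ.<-irrefl (cong (nth xs) v) u)
  ... | tri> _ _ v = ⊥-elim (ℕ.<-asym u (nth-mono xs A (proj₁ (R b)) v (proj₂ (R a))))

-- Each name spells a pattern in one-line notation with signs and denotes its index in `patterns`.
p-1-2-3 p-1-3-2 p-2-1-3 p-2-3-1 p-3-1-2 p-3-2-1 p+3+2+1 p+3+4+1+2 p+3+2-1 p+3-1-2 p+3+4-1+2 p+3+4-2-1 : Fin
  (length patterns)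
p-3+2+1 p-2-3+1 p-3+4+1+2 p-4-3+1+2 p+1-2 p+3-2+1 p-3+2-1 p-3+4-1+2 : Fin (length patterns)
p-1-2-3    = # 0
p-1-3-2    = # 1
p-2-1-3    = # 2
p-2-3-1    = # 3
p-3-1-2    = # 4
p-3-2-1    = # 5
p+3+2+1    = # 6
p+3+4+1+2  = # 7
p+3+2-1    = # 8
p+3-1-2    = # 9
p+3+4-1+2  = # 10
p+3+4-2-1  = # 11
p-3+2+1    = # 12
p-2-3+1    = # 13
p-3+4+1+2  = # 14
p-4-3+1+2  = # 15
p+1-2      = # 16
p+3-2+1    = # 17
p-3+2-1    = # 18
p-3+4-1+2  = # 19

module LargeEntries (q : ℕ) (2≤q : 2 ℕ.≤ q) {f : ℤ → ℤ} (P : Perm (suc (suc q)) f) (A : AvoidsF (suc (suc q)) f) where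

  -- As values, `n` and `e` are the two largest absolute values; as places counted from 0, `e` is
  -- the last and `q` the one before it.
  n e : ℕ
  n = suc (suc q)
  e = suc q

  bad : (c : Fin (length patterns)) (is xs : Vec ℕ (proj₁ (List.lookup patterns c))) → Places n is → Ascending 0 xs →
        Values f xs (proj₂ (List.lookup patterns c)) is → ⊥
  bad c is xs I S V = All.lookup A (∈-lookup c)
    (occurrence (proj₂ (List.lookup patterns c)) (All.lookup patterns-inRange (∈-lookup c)) is xs I S V)

  data Entry (i : ℕ) : ℕ → Set where
    ⊕ : ∀ {x} → f (+ suc i) ≡ + x → Entry i x
    ⊖ : ∀ {x} → f (+ suc i) ≡ - (+ x) → Entry i x

  ∣entry∣ : ∀ {i x} → Entry i x → ∣ f (+ suc i) ∣ ≡ x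
  ∣entry∣ (⊕ p) = cong ∣_∣ p
  ∣entry∣ {x = x} (⊖ p) = trans (cong ∣_∣ p) (ℤ.∣-i∣≡∣i∣ (+ x))

  entry-∣∣ : ∀ {i x} → ∣ f (+ suc i) ∣ ≡ x → Entry i x
  entry-∣∣ {i} {x} p with abs-cases (f (+ suc i)) (+ x) p
  ... | inj₁ r = ⊕ r
  ... | inj₂ r = ⊖ r

  entry : ∀ i → Entry i ∣ f (+ suc i) ∣
  entry i = entry-∣∣ refl

  positive : ∀ {i x} → i ℕ.< n → Entry i x → 0 ℕ.< x
  positive {i} i<n E = subst (0 ℕ.<_) (∣entry∣ E) (ℕ.n≢0⇒n>0 (λ p → nonzero P {+ suc i} (λ ()) i<n (ℤ.∣i∣≡0⇒i≡0 p)))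

  distinct : ∀ {i j x} → i ℕ.< n → j ℕ.< n → i ≢ j → Entry i x → Entry j x → ⊥
  distinct {i} {j} i<n j<n i≢j E F =
    i≢j (ℕ.suc-injective (inj P {+ suc i} {+ suc j} i<n j<n (trans (∣entry∣ E) (sym (∣entry∣ F)))))

  compare : ∀ {i j x y} → i ℕ.< j → j ℕ.< n → Entry i x → Entry j y → x ℕ.< y ⊎ y ℕ.< x
  compare {x = x} {y} i<j j<n E F with ℕ.<-cmp x y
  ... | tri< u _ _ = inj₁ u
  ... | tri≈ _ refl _ = ⊥-elim (distinct (ℕ.<-trans i<j j<n) j<n (ℕ.<⇒≢ i<j) E F)
  ... | tri> _ _ u = inj₂ u

  <top : ∀ {i j x} → i ℕ.< n → j ℕ.< n → i ≢ j → Entry i x → Entry j n → x ℕ.< n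
  <top {i} {x = x} i<n j<n i≢j E F = ℕ.≤∧≢⇒< (subst (ℕ._≤ n) (∣entry∣ E) (bounded P {+ suc i} i<n))
    (λ { refl → distinct i<n j<n i≢j E F })

  <second : ∀ {i j k x} → i ℕ.< n → j ℕ.< n → k ℕ.< n → i ≢ j → i ≢ k → Entry i x → Entry j n → Entry k e → x ℕ.< e
  <second i<n j<n k<n i≢j i≢k E F G =
    ℕ.≤∧≢⇒< (ℕ.≤-pred (<top i<n j<n i≢j E F)) (λ { refl → distinct i<n k<n i≢k E G })

  -- The list contains all six relative orders of three negative entries.
  three-negative : ∀ {i j k x y z} → i ℕ.< j → j ℕ.< k → k ℕ.< n →
    f (+ suc i) ≡ - (+ x) → f (+ suc j) ≡ - (+ y) → f (+ suc k) ≡ - (+ z) → ⊥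
  three-negative {i} {j} {k} {x} {y} {z} i<j j<k k<n ex ey ez
    with compare i<j (ℕ.<-trans j<k k<n) (⊖ ex) (⊖ ey) | compare j<k k<n (⊖ ey) (⊖ ez) | compare (ℕ.<-trans i<j j<k)
      k<n (⊖ ex) (⊖ ez)
  ... | inj₁ u | inj₁ v | _      =
    bad p-1-2-3 (i ∷ j ∷ k ∷ []) (x ∷ y ∷ z ∷ []) (i<j , j<k , k<n) (0<x , u , v , tt) (ex , ey , ez , tt)
    where 0<x = positive (ℕ.<-trans i<j (ℕ.<-trans j<k k<n)) (⊖ ex)
  ... | inj₁ u | inj₂ v | inj₁ w =
    bad p-1-3-2 (i ∷ j ∷ k ∷ []) (x ∷ z ∷ y ∷ []) (i<j , j<k , k<n) (0<x , w , v , tt) (ex , ey , ez , tt)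
    where 0<x = positive (ℕ.<-trans i<j (ℕ.<-trans j<k k<n)) (⊖ ex)
  ... | inj₁ u | inj₂ v | inj₂ w =
    bad p-2-3-1 (i ∷ j ∷ k ∷ []) (z ∷ x ∷ y ∷ []) (i<j , j<k , k<n) (positive k<n (⊖ ez) , w , u , tt) (ex , ey , ez ,
    tt)
  ... | inj₂ u | inj₁ v | inj₁ w =
    bad p-2-1-3 (i ∷ j ∷ k ∷ []) (y ∷ x ∷ z ∷ []) (i<j , j<k , k<n) (positive (ℕ.<-trans j<k k<n) (⊖ ey) , u , w , tt)
    (ex , ey , ez , tt)
  ... | inj₂ u | inj₁ v | inj₂ w =
    bad p-3-1-2 (i ∷ j ∷ k ∷ []) (y ∷ z ∷ x ∷ []) (i<j , j<k , k<n) (positive (ℕ.<-trans j<k k<n) (⊖ ey) , v , w , tt)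
    (ex , ey , ez , tt)
  ... | inj₂ u | inj₂ v | _      =
    bad p-3-2-1 (i ∷ j ∷ k ∷ []) (z ∷ y ∷ x ∷ []) (i<j , j<k , k<n) (positive k<n (⊖ ez) , v , u , tt) (ex , ey , ez ,
    tt)

  small-then-negative : ∀ {i j x y} → i ℕ.< j → j ℕ.< n → x ℕ.< y → f (+ suc i) ≡ + x → f (+ suc j) ≡ - (+ y) → ⊥
  small-then-negative {i} {j} {x} {y} i<j j<n u ex ey =
    bad p+1-2 (i ∷ j ∷ []) (x ∷ y ∷ []) (i<j , j<n) (positive (ℕ.<-trans i<j j<n) (⊕ ex) , u , tt) (ex , ey , tt)

  Conclusion : Set
  Conclusion = f (+ n) ≡ + n ⊎ f (+ e) ≡ + n ⊎ f (+ n) ≡ + e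

  q<n : q ℕ.< n
  q<n = ℕ.m≤n⇒m≤1+n ℕ.≤-refl
  e<n : e ℕ.< n
  e<n = ℕ.≤-refl
  0<n : 0 ℕ.< n
  0<n = s≤s z≤n
  1<n : 1 ℕ.< n
  1<n = s≤s (s≤s z≤n)
  2<e : 2 ℕ.< e
  2<e = s≤s 2≤q
  2<n : 2 ℕ.< n
  2<n = ℕ.m≤n⇒m≤1+n 2<e
  3<n : 3 ℕ.< n
  3<n = s≤s 2<e

  -- Only `+ (n - 1)` at the very end survives. Before the end, it forms 3̲21 or 3̲21̲ with the
  -- first and the last entry.
  neg-first : ∀ {k} → k ℕ.< n → f (+ 1) ≡ - (+ n) → k ≢ 0 → Entry k e → Conclusion
  neg-first {zero} k<n ef k≢0 (⊖ ek) = ⊥-elim (k≢0 refl)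
  neg-first {zero} k<n ef k≢0 (⊕ ek) = ⊥-elim (k≢0 refl)
  -- The entries begin with -n and -(n - 1). The next two, which exist since n is at least 4, must
  -- be positive; ascending they complete 4̲3̲12, descending they give 3̲21 with -n.
  neg-first {suc zero} k<n ef k≢0 (⊖ ek) with entry 2 | entry 3
  ... | ⊖ ex | _ = ⊥-elim (three-negative (s≤s z≤n) (s≤s (s≤s z≤n)) 2<n ef ek ex)
  ... | ⊕ ex | ⊖ ey = ⊥-elim (three-negative (s≤s z≤n) (s≤s (s≤s z≤n)) 3<n ef ek ey)
  ... | ⊕ ex | ⊕ ey with compare ℕ.≤-refl 3<n (⊕ ex) (⊕ ey)
  ...   | inj₁ u = ⊥-elim (bad p-4-3+1+2 (0 ∷ 1 ∷ 2 ∷ 3 ∷ []) (_ ∷ _ ∷ e ∷ n ∷ [])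
            (s≤s z≤n , ℕ.≤-refl , ℕ.≤-refl , 3<n)
            (positive 2<n (⊕ ex) , u , <second 3<n 0<n 1<n (λ ()) (λ ()) (⊕ ey) (⊖ ef) (⊖ ek) , ℕ.≤-refl , tt)
              (ef , ek , ex , ey , tt))
  ...   | inj₂ u = ⊥-elim (bad p-3+2+1 (0 ∷ 2 ∷ 3 ∷ []) (_ ∷ _ ∷ n ∷ [])
            (s≤s z≤n , ℕ.≤-refl , 3<n) (positive 3<n (⊕ ey) , u , <top 2<n 0<n (λ ()) (⊕ ex) (⊖ ef) , tt)
              (ef , ex , ey , tt))
  neg-first {suc (suc k)} k<n ef k≢0 (⊖ ek) with entry 1
  ... | ⊖ ex = ⊥-elim (three-negative (s≤s z≤n) (s≤s (s≤s z≤n)) k<n ef ex ek)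
  ... | ⊕ ex =
    ⊥-elim (small-then-negative (s≤s (s≤s z≤n)) k<n (<second 1<n 0<n k<n (λ ()) (λ ()) (⊕ ex) (⊖ ef) (⊖ ek)) ex ek)
  neg-first {k@(suc k′)} k<n ef k≢0 (⊕ ek) with k ℕ.≟ e
  ... | yes refl = inj₂ (inj₂ ek)
  ... | no k≢e with entry e
  ...   | ⊕ ey = ⊥-elim (bad p-3+2+1 (0 ∷ k ∷ e ∷ []) (_ ∷ e ∷ n ∷ []) (s≤s z≤n , k<e , e<n)
            (positive e<n (⊕ ey) , <second e<n 0<n k<n (λ ()) (k≢e ∘ sym) (⊕ ey) (⊖ ef) (⊕ ek) , ℕ.≤-refl , tt)
              (ef , ek , ey , tt))
    where k<e = ℕ.≤∧≢⇒< (ℕ.≤-pred k<n) k≢e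
  ...   | ⊖ ey = ⊥-elim (bad p-3+2-1 (0 ∷ k ∷ e ∷ []) (_ ∷ e ∷ n ∷ []) (s≤s z≤n , k<e , e<n)
            (positive e<n (⊖ ey) , <second e<n 0<n k<n (λ ()) (k≢e ∘ sym) (⊖ ey) (⊖ ef) (⊕ ek) , ℕ.≤-refl , tt)
              (ef , ek , ey , tt))
    where k<e = ℕ.≤∧≢⇒< (ℕ.≤-pred k<n) k≢e

  -- A positive first entry would give 12̲, so the first entry is negative and all entries from the
  -- third on must be positive.
  neg-second : ∀ {k} → k ℕ.< n → f (+ 2) ≡ - (+ n) → k ≢ 1 → Entry k e → Conclusion
  neg-second {k} k<n ef k≢1 E with entry 0
  ... | ⊕ ex = ⊥-elim (small-then-negative ℕ.≤-refl 1<n (<top 0<n 1<n (λ ()) (⊕ ex) (⊖ ef)) ex ef)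
  neg-second {zero} k<n ef k≢1 (⊕ ek) | ⊖ ea = ⊥-elim (signs-clash (trans (sym ek) ea))
    where
    signs-clash : ∀ {m} → + suc q ≡ - (+ m) → ⊥
    signs-clash {zero} ()
    signs-clash {suc m} ()
  neg-second {zero} k<n ef k≢1 (⊖ ek) | ⊖ ea with entry 2
  ... | ⊖ ex = ⊥-elim (three-negative (s≤s z≤n) ℕ.≤-refl 2<n ea ef ex)
  ... | ⊕ ex = ⊥-elim (bad p-2-3+1 (0 ∷ 1 ∷ 2 ∷ []) (_ ∷ e ∷ n ∷ []) (ℕ.≤-refl , ℕ.≤-refl , 2<n)
          (positive 2<n (⊕ ex) , <second 2<n 1<n 0<n (λ ()) (λ ()) (⊕ ex) (⊖ ef) (⊖ ek) , ℕ.≤-refl , tt)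
            (ek , ef , ex , tt))
  neg-second {suc zero} k<n ef k≢1 E | ⊖ ea = ⊥-elim (k≢1 refl)
  neg-second {suc (suc k)} k<n ef k≢1 (⊖ ek) | ⊖ ea = ⊥-elim (three-negative (s≤s z≤n) (s≤s (s≤s z≤n)) k<n ea ef ek)
  neg-second {k@(suc (suc k′))} k<n ef k≢1 (⊕ ek) | ⊖ ea with k ℕ.≟ e
  ... | yes refl = inj₂ (inj₂ ek)
  ... | no k≢e with entry e
  ...   | ⊖ ey = ⊥-elim (three-negative (s≤s z≤n) (ℕ.<-trans ℕ.≤-refl 2<e) e<n ea ef ey)
  ...   | ⊕ ey = ⊥-elim (bad p-3+2+1 (1 ∷ k ∷ e ∷ []) (_ ∷ e ∷ n ∷ []) (s≤s (s≤s z≤n) , k<e , e<n)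
            (positive e<n (⊕ ey) ,
              <second e<n 1<n k<n (ℕ.<⇒≢ (ℕ.<-trans ℕ.≤-refl 2<e) ∘ sym) (k≢e ∘ sym) (⊕ ey) (⊖ ef) (⊕ ek) , ℕ.≤-refl ,
              tt) (ef , ek , ey , tt))
    where k<e = ℕ.≤∧≢⇒< (ℕ.≤-pred k<n) k≢e

  -- A positive entry among the first two gives 12̲ with -n; otherwise there are three negative
  -- entries.
  neg-late : ∀ {j} → 2 ℕ.≤ j → j ℕ.< n → f (+ suc j) ≡ - (+ n) → ⊥
  neg-late {j} 2≤j j<n ef with entry 0 | entry 1
  ... | ⊕ ex | _ = small-then-negative (ℕ.<⇒≤ 2≤j) j<n (<top 0<n j<n (ℕ.<⇒≢ (ℕ.<⇒≤ 2≤j)) (⊕ ex) (⊖ ef)) ex ef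
  ... | ⊖ ex | ⊕ ey = small-then-negative 2≤j j<n (<top 1<n j<n (ℕ.<⇒≢ 2≤j) (⊕ ey) (⊖ ef)) ey ef
  ... | ⊖ ex | ⊖ ey = three-negative ℕ.≤-refl 2≤j j<n ex ey ef

  -- At least two entries follow `+ n`, which can thus serve as the 3 of 321, 321̲, 32̲1 and 31̲2̲.
  module _ {j} (j<q : j ℕ.< q) (ej : f (+ suc j) ≡ + n) where

    private
      j<e : j ℕ.< e
      j<e = ℕ.m≤n⇒m≤1+n j<q
      j<n : j ℕ.< n
      j<n = ℕ.m≤n⇒m≤1+n j<e

    falling : ∀ {i l x y} → j ℕ.< i → i ℕ.< l → l ℕ.< n → y ℕ.< x → f (+ suc i) ≡ + x → Entry l y → ⊥
    falling {i} {l} j<i i<l l<n u ex (⊕ ey) = bad p+3+2+1 (j ∷ i ∷ l ∷ []) (_ ∷ _ ∷ n ∷ []) (j<i , i<l , l<n)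
      (positive l<n (⊕ ey) , u , <top (ℕ.<-trans i<l l<n) j<n (ℕ.<⇒≢ j<i ∘ sym) (⊕ ex) (⊕ ej) , tt)
        (ej , ex , ey , tt)
    falling {i} {l} j<i i<l l<n u ex (⊖ ey) = bad p+3+2-1 (j ∷ i ∷ l ∷ []) (_ ∷ _ ∷ n ∷ []) (j<i , i<l , l<n)
      (positive l<n (⊖ ey) , u , <top (ℕ.<-trans i<l l<n) j<n (ℕ.<⇒≢ j<i ∘ sym) (⊕ ex) (⊕ ej) , tt)
        (ej , ex , ey , tt)

    neg-then-small : ∀ {i l x y} → j ℕ.< i → i ℕ.< l → l ℕ.< n → y ℕ.< x → f (+ suc i) ≡ - (+ x) → f (+ suc l) ≡ + y →
      ⊥
    neg-then-small {i} {l} j<i i<l l<n u ex ey = bad p+3-2+1 (j ∷ i ∷ l ∷ []) (_ ∷ _ ∷ n ∷ []) (j<i , i<l , l<n)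
      (positive l<n (⊕ ey) , u , <top (ℕ.<-trans i<l l<n) j<n (ℕ.<⇒≢ j<i ∘ sym) (⊖ ex) (⊕ ej) , tt)
        (ej , ex , ey , tt)

    neg-then-neg : ∀ {i l x y} → j ℕ.< i → i ℕ.< l → l ℕ.< n → x ℕ.< y → f (+ suc i) ≡ - (+ x) →
      f (+ suc l) ≡ - (+ y) → ⊥
    neg-then-neg {i} {l} j<i i<l l<n u ex ey = bad p+3-1-2 (j ∷ i ∷ l ∷ []) (_ ∷ _ ∷ n ∷ []) (j<i , i<l , l<n)
      (positive (ℕ.<-trans i<l l<n) (⊖ ex) , u , <top l<n j<n (ℕ.<⇒≢ (ℕ.<-trans j<i i<l) ∘ sym) (⊖ ey) (⊕ ej) , tt)
        (ej , ex , ey , tt)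

    -- The entry of absolute value n - 1, then `+ n`, then the last two entries have the shape of
    -- the patterns of length four. The sign and order combinations that are missing from that list
    -- contain a shorter pattern.
    second-before : ∀ {k} → k ℕ.< j → Entry k e → ⊥
    second-before {k} k<j E with entry q | entry e
    ... | X | Y with compare ℕ.≤-refl e<n X Y
    ... | c = go E X Y c
      where
      k<n : k ℕ.< n
      k<n = ℕ.<-trans k<j j<n
      small : ∀ {i x} → j ℕ.< i → i ℕ.< n → Entry i x → x ℕ.< e
      small j<i i<n F = <second i<n j<n k<n (ℕ.<⇒≢ j<i ∘ sym) (ℕ.<⇒≢ (ℕ.<-trans k<j j<i) ∘ sym) F (⊕ ej) E
      places : Places n (k ∷ j ∷ q ∷ e ∷ [])
      places = k<j , j<q , ℕ.≤-refl , e<n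
      go : ∀ {x y} → Entry k e → Entry q x → Entry e y → x ℕ.< y ⊎ y ℕ.< x → ⊥
      go (⊕ ek) (⊕ ex) (⊕ ey) (inj₁ u) = bad p+3+4+1+2 _ (_ ∷ _ ∷ e ∷ n ∷ []) places
        (positive q<n (⊕ ex) , u , small j<e e<n (⊕ ey) , ℕ.≤-refl , tt) (ek , ej , ex , ey , tt)
      go (⊖ ek) (⊕ ex) (⊕ ey) (inj₁ u) = bad p-3+4+1+2 _ (_ ∷ _ ∷ e ∷ n ∷ []) places
        (positive q<n (⊕ ex) , u , small j<e e<n (⊕ ey) , ℕ.≤-refl , tt) (ek , ej , ex , ey , tt)
      go _ (⊕ ex) (⊖ ey) (inj₁ u) = small-then-negative ℕ.≤-refl e<n u ex ey
      go _ (⊕ ex) Y (inj₂ u) = falling j<q ℕ.≤-refl e<n u ex Y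
      go (⊕ ek) (⊖ ex) (⊕ ey) (inj₁ u) = bad p+3+4-1+2 _ (_ ∷ _ ∷ e ∷ n ∷ []) places
        (positive q<n (⊖ ex) , u , small j<e e<n (⊕ ey) , ℕ.≤-refl , tt) (ek , ej , ex , ey , tt)
      go (⊖ ek) (⊖ ex) (⊕ ey) (inj₁ u) = bad p-3+4-1+2 _ (_ ∷ _ ∷ e ∷ n ∷ []) places
        (positive q<n (⊖ ex) , u , small j<e e<n (⊕ ey) , ℕ.≤-refl , tt) (ek , ej , ex , ey , tt)
      go _ (⊖ ex) (⊕ ey) (inj₂ u) = neg-then-small j<q ℕ.≤-refl e<n u ex ey
      go (⊖ ek) (⊖ ex) (⊖ ey) _ = three-negative (ℕ.<-trans k<j j<q) ℕ.≤-refl e<n ek ex ey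
      go (⊕ ek) (⊖ ex) (⊖ ey) (inj₁ u) = neg-then-neg j<q ℕ.≤-refl e<n u ex ey
      go (⊕ ek) (⊖ ex) (⊖ ey) (inj₂ u) = bad p+3+4-2-1 _ (_ ∷ _ ∷ e ∷ n ∷ []) places
        (positive e<n (⊖ ey) , u , small j<q q<n (⊖ ex) , ℕ.≤-refl , tt) (ek , ej , ex , ey , tt)

    module _ {k} (j<k : j ℕ.< k) (k<n : k ℕ.< n) where

      private
        small : ∀ {i x} → i ℕ.< n → i ≢ j → i ≢ k → Entry i x → Entry k e → x ℕ.< e
        small i<n i≢j i≢k F E = <second i<n j<n k<n i≢j i≢k F (⊕ ej) E

      second-after⁺ : f (+ suc k) ≡ + e → k ≡ e
      second-after⁺ ek with k ℕ.≟ e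
      ... | yes p = p
      ... | no k≢e = ⊥-elim (falling j<k (ℕ.≤∧≢⇒< (ℕ.≤-pred k<n) k≢e) e<n
              (small e<n (ℕ.<⇒≢ j<e ∘ sym) (k≢e ∘ sym) (entry e) (⊕ ek)) ek (entry e))

      second-last⁻ : k ≡ e → f (+ suc k) ≡ - (+ e) → ⊥
      second-last⁻ refl ek with entry q
      ... | ⊕ ex =
        small-then-negative ℕ.≤-refl e<n (small q<n (ℕ.<⇒≢ j<q ∘ sym) (λ p → ℕ.<-irrefl p ℕ.≤-refl) (⊕ ex) (⊖ ek)) ex
        ek
      ... | ⊖ ex =
        neg-then-neg j<q ℕ.≤-refl e<n (small q<n (ℕ.<⇒≢ j<q ∘ sym) (λ p → ℕ.<-irrefl p ℕ.≤-refl) (⊖ ex) (⊖ ek)) ex ek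

      before : ∀ {i y} → i ℕ.< k → i ≢ j → k ℕ.< e → f (+ suc k) ≡ - (+ e) → f (+ suc e) ≡ - (+ y) → ⊥
      before {i} i<k i≢j k<e ek ey with entry i
      ... | ⊕ ex = small-then-negative i<k k<n (small (ℕ.<-trans i<k k<n) i≢j (ℕ.<⇒≢ i<k) (⊕ ex) (⊖ ek)) ex ek
      ... | ⊖ ex = three-negative i<k k<e e<n ex ek ey

    -- A positive last entry gives 32̲1. If the last entry is negative, any entry other than `+ n`
    -- in front of -(n - 1) is fatal by `before`: positive it gives 12̲, negative it is one of
    -- three.
    second-after⁻ : ∀ {k} → j ℕ.< k → k ℕ.< n → f (+ suc k) ≡ - (+ e) → ⊥
    second-after⁻ {k} j<k k<n ek with k ℕ.≟ e
    ... | yes p = second-last⁻ j<k k<n p ek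
    ... | no k≢e with entry e
    ...   | ⊕ ey =
      neg-then-small j<k k<e e<n (<second e<n j<n k<n (ℕ.<⇒≢ j<e ∘ sym) (k≢e ∘ sym) (⊕ ey) (⊕ ej) (⊖ ek)) ek ey
      where k<e = ℕ.≤∧≢⇒< (ℕ.≤-pred k<n) k≢e
    ...   | ⊖ ey with j ℕ.≟ 0
    ...     | no j≢0 = before j<k k<n (ℕ.≤-trans (s≤s z≤n) j<k) (j≢0 ∘ sym) (ℕ.≤∧≢⇒< (ℕ.≤-pred k<n) k≢e) ek ey
    ...     | yes refl with k ℕ.≟ 1
    ...       | no k≢1 = before j<k k<n {1} (ℕ.≤∧≢⇒< j<k (k≢1 ∘ sym)) (λ ()) (ℕ.≤∧≢⇒< (ℕ.≤-pred k<n) k≢e) ek ey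
    -- Now only `+ n` precedes -(n - 1), so the entry just after them is used; it is not the last,
    -- since n is at least 4.
    ...       | yes refl with entry 2
    ...         | ⊖ ex = three-negative ℕ.≤-refl 2<e e<n ek ex ey
    ...         | ⊕ ex =
      neg-then-small j<k ℕ.≤-refl 2<n (<second 2<n j<n k<n (λ ()) (λ ()) (⊕ ex) (⊕ ej) (⊖ ek)) ek ex

    pos-early : ∀ {k} → k ℕ.< n → k ≢ j → Entry k e → Conclusion
    pos-early {k} k<n k≢j E with ℕ.<-cmp k j
    ... | tri< u _ _ = ⊥-elim (second-before u E)
    ... | tri≈ _ u _ = ⊥-elim (k≢j u)
    pos-early {k} k<n k≢j (⊕ ek) | tri> _ _ u with second-after⁺ u k<n ek
    ... | refl = inj₂ (inj₂ ek)
    pos-early {k} k<n k≢j (⊖ ek) | tri> _ _ u = ⊥-elim (second-after⁻ u k<n ek)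

  large-entries : Conclusion
  large-entries with Perm-hits P {e} e<n | Perm-hits P {q} q<n
  ... | j , j<n , hj | k , k<n , hk = go (entry-∣∣ hj) (entry-∣∣ hk)
    where
    k≢j : k ≢ j
    k≢j refl = ℕ.<-irrefl (trans (sym hk) hj) ℕ.≤-refl
    neg : ∀ {j} → j ℕ.< n → k ≢ j → f (+ suc j) ≡ - (+ n) → Entry k e → Conclusion
    neg {zero} j<n k≢j ej K = neg-first k<n ej k≢j K
    neg {suc zero} j<n k≢j ej K = neg-second k<n ej k≢j K
    neg {suc (suc j)} j<n k≢j ej K = ⊥-elim (neg-late (s≤s (s≤s z≤n)) j<n ej)
    go : Entry j n → Entry k e → Conclusion
    go (⊖ ej) K = neg j<n k≢j ej K
    go (⊕ ej) K with j ℕ.≟ e | j ℕ.≟ q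
    ... | yes refl | _ = inj₁ ej
    ... | no _ | yes refl = inj₂ (inj₁ ej)
    ... | no j≢e | no j≢q = pos-early (ℕ.≤∧≢⇒< (ℕ.≤-pred (ℕ.≤∧≢⇒< (ℕ.≤-pred j<n) j≢e)) j≢q) ej k<n k≢j K

-- Avoiding elements have words with distinct letters

UniqueWord : ℕ → (ℤ → ℤ) → Set
UniqueWord n f = ∃ λ gs → Letters n gs × Unique gs × (∀ {i} → i ℕ.< n → f (+ suc i) ≡ ev gs (+ suc i))

sgn-sign : ∀ {a b} n → (∀ i → sign (a i) ≡ sign (b i)) → sgn n a ≡ sgn n b
sgn-sign zero    e = refl
sgn-sign (suc n) e = cong₂ Sign._*_ (e n) (sgn-sign n e)

agree-top : ∀ {n} {f : ℤ → ℤ} gs → Letters n gs → f (+ suc n) ≡ + suc n →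
  (∀ {i} → i ℕ.< n → f (+ suc i) ≡ ev gs (+ suc i)) →
            ∀ {i} → i ℕ.< suc n → f (+ suc i) ≡ ev gs (+ suc i)
agree-top {n} gs L top e {i} b with ℕ.m≤n⇒m<n∨m≡n (ℕ.≤-pred b)
... | inj₁ u = e u
... | inj₂ refl = trans top (sym (ev-top n gs L))

not-letter : ∀ {n} gs → Letters n gs → n ∉ gs
not-letter {suc n} (i ∷ gs) ((_ , q) ∷ L) (here refl) = ℕ.<-irrefl refl q
not-letter {zero} (i ∷ gs) ((() , q) ∷ L) (here refl)
not-letter (i ∷ gs) (I ∷ L) (there m) = not-letter gs L m

Unique-∷ʳ : ∀ {i : ℕ} gs → Unique gs → i ∉ gs → Unique (gs ++ i ∷ [])
Unique-∷ʳ [] [] n = [] ∷ []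
Unique-∷ʳ (g ∷ gs) (a ∷ U) n = All.++⁺ a ((λ e → n (here (sym e))) ∷ []) ∷ Unique-∷ʳ gs U (n ∘ there)

FindsUniqueWords : ℕ → Set
FindsUniqueWords n = ∀ {f} → Perm n f → sgn n (entries f) ≡ Sign.+ → AvoidsF n f → UniqueWord n f

module _ (q : ℕ) (rec : FindsUniqueWords (suc q)) where

  private
    n : ℕ
    n = suc (suc q)
    last : Letter n (suc q)
    last = ℕ.n≤1+n (suc q) , ℕ.≤-refl
    lift : ∀ gs → Letters (suc q) gs → Letters n gs
    lift gs = All.map (λ {i} → Letter-mono (ℕ.n≤1+n (suc q)) {i})

  -- The word is kept in the lower rank although it describes `f` in the higher one: the letter
  -- `suc q` is then new and may be added at either end without a repetition.
  word-extend : ∀ {f} → Perm n f → sgn n (entries f) ≡ Sign.+ → f (+ n) ≡ + n → AvoidsF (suc q) f →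
                ∃ λ gs → Letters (suc q) gs × Unique gs × (∀ {i} → i ℕ.< n → f (+ suc i) ≡ ev gs (+ suc i))
  word-extend {f} P s top A with rec (Perm-restrict P (cong ∣_∣ top))
    (trans (cong (λ x → sign x Sign.* sgn (suc q) (entries f)) (sym top)) s) A
  ... | gs , L , U , e = gs , L , U , agree-top {f = f} gs L top e

  word-fixed-top : ∀ {f} → Perm n f → sgn n (entries f) ≡ Sign.+ → AvoidsF n f → f (+ n) ≡ + n → UniqueWord n f
  word-fixed-top P s A top with word-extend P s top (All.map (_∘ Occ-mono (ℕ.n≤1+n (suc q))) A)
  ... | gs , L , U , e = gs , lift gs L , U , e

  word-penultimate-top : ∀ {f} → Perm n f → sgn n (entries f) ≡ Sign.+ → AvoidsF n f → f (+ suc q) ≡ + n →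
    UniqueWord n f
  word-penultimate-top {f} P s A e with word-extend {f ∘ σ (suc q)} (Perm-∘ev (suc q ∷ []) (last ∷ []) P)
    (trans (sgn-σ (suc q) last P) s)
      (trans (cong f (σ-β (suc q))) e) (All.map (_∘ Occ-∘σ⁺ q) A)
  ... | gs , L , U , agree =
    gs ++ suc q ∷ [] , All.++⁺ (lift gs L) (last ∷ []) , Unique-∷ʳ gs U (not-letter gs L) , result
    where
    open ≡-Reasoning
    result : ∀ {i} → i ℕ.< n → f (+ suc i) ≡ ev (gs ++ suc q ∷ []) (+ suc i)
    agree-at : ∀ x → ∃ (λ i → i ℕ.< n × x ≡ + suc i) → f (σ (suc q) x) ≡ ev gs x
    agree-at _ (i , b , refl) = agree b
    position : ∀ {i} → i ℕ.< n → ∃ λ j → j ℕ.< n × σ (suc q) (+ suc i) ≡ + suc j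
    position {i} b = go (refl-view (α (suc q)) (β (suc q)) (+ suc i))
      where
      go : ∀ {y} → Refl (α (suc q)) (β (suc q)) (+ suc i) y → ∃ λ j → j ℕ.< n × y ≡ + suc j
      go (atA _) = suc q , ℕ.≤-refl , refl
      go (atB _) = q , ℕ.m≤n⇒m≤1+n ℕ.≤-refl , refl
      go (off _ _ _ _) = i , b , refl
    result {i} b = begin
      f (+ suc i)                                  ≡⟨ cong f (sym (σ-involutive (suc q) (+ suc i))) ⟩
      f (σ (suc q) (σ (suc q) (+ suc i)))          ≡⟨ agree-at _ (position b) ⟩
      ev gs (σ (suc q) (+ suc i))                  ≡⟨ sym (ev-∷ʳ gs (suc q) (+ suc i)) ⟩
      ev (gs ++ suc q ∷ []) (+ suc i)              ∎

  word-last-second : ∀ {f} → Perm n f → sgn n (entries f) ≡ Sign.+ → AvoidsF n f → f (+ n) ≡ + suc q → UniqueWord n f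
  word-last-second {f} P s A e with word-extend {g} P′ (trans (sgn-sign n (λ i → σ-sign q _)) s) top
      (All.map (λ av O →
        av (Occ-mono (ℕ.n≤1+n (suc q)) (Occ-≗ (λ x → sym (σ-involutive (suc q) (f x))) (Occ-σ∘⁺ q bd O)))) A)
    where
    g : ℤ → ℤ
    g = σ (suc q) ∘ f
    P′ : Perm n g
    P′ = Perm-ev∘ (suc q ∷ []) (last ∷ []) P
    top : g (+ n) ≡ + n
    top = trans (cong (σ (suc q)) e) (σ-α (suc q))
    bd : ∀ {i} → i ℕ.< suc q → ∣ g (+ suc i) ∣ ℕ.≤ suc q
    bd {i} b = bounded (Perm-restrict P′ (cong ∣_∣ top)) {+ suc i} b
  ... | gs , L , U , agree = suc q ∷ gs , last ∷ lift gs L ,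
    All.tabulate (λ {j} m e → not-letter gs L (subst (_∈ gs) (sym e) m)) ∷ U ,
    λ {i} b → trans (sym (σ-involutive (suc q) (f (+ suc i)))) (cong (σ (suc q)) (agree b))

  word-step : 2 ℕ.≤ q → FindsUniqueWords n
  word-step 2≤q P s A with LargeEntries.large-entries q 2≤q P A
  ... | inj₁ e = word-fixed-top P s A e
  ... | inj₂ (inj₁ e) = word-penultimate-top P s A e
  ... | inj₂ (inj₂ e) = word-last-second P s A e

-- Ranks at most three

-- One word from each class under commuting 0 with 1. In rank 3 letter 2 is joined to both, so the
-- words with all three letters form four classes, according to the side of 2 on which 0 and 1
-- stand.
smallWords : Fin 4 → List (List ℕ)
smallWords Fin.zero = [] ∷ []
smallWords (Fin.suc Fin.zero) = [] ∷ []
smallWords (Fin.suc (Fin.suc Fin.zero)) = [] ∷ (0 ∷ []) ∷ (1 ∷ []) ∷ (0 ∷ 1 ∷ []) ∷ []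
smallWords (Fin.suc (Fin.suc (Fin.suc Fin.zero))) =
  [] ∷ (0 ∷ []) ∷ (1 ∷ []) ∷ (2 ∷ []) ∷ (0 ∷ 1 ∷ []) ∷ (0 ∷ 2 ∷ []) ∷ (2 ∷ 0 ∷ []) ∷ (1 ∷ 2 ∷ []) ∷ (2 ∷ 1 ∷ []) ∷
  (0 ∷ 1 ∷ 2 ∷ []) ∷ (2 ∷ 0 ∷ 1 ∷ []) ∷ (0 ∷ 2 ∷ 1 ∷ []) ∷ (1 ∷ 2 ∷ 0 ∷ []) ∷ []

smallEntries : List ℤ
smallEntries = + 1 ∷ + 2 ∷ + 3 ∷ -[1+ 0 ] ∷ -[1+ 1 ] ∷ -[1+ 2 ] ∷ []

smallWords-unique : ∀ n → All (λ gs → Letters (toℕ n) gs × Unique gs) (smallWords n)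
smallWords-unique = from-yes table?
  where
  table? : Dec (∀ n → All (λ gs → Letters (toℕ n) gs × Unique gs) (smallWords n))
  table? = Fin.all? λ n →
    All.all? (λ gs → All.all? (λ i → (∣ α i ∣ ℕ.≤? toℕ n) ×-dec (∣ β i ∣ ℕ.≤? toℕ n)) gs ×-dec unique? gs)
    (smallWords n)

inD? : ∀ {n} (w : Vec ℤ n) → Dec (InD w)
inD? {n} w = (All.all? (λ x → (1 ℕ.≤? ∣ x ∣) ×-dec (∣ x ∣ ℕ.≤? n)) (toList w) ×-dec unique? (List.map ∣_∣ (toList w)))
             ×-dec (negCount w % 2 ℕ.≟ 0)

opaque
  unfolding refl⟨_,_⟩

  small-avoiding : ∀ n (w : Vec ℤ (toℕ n)) → VecAll.All (_∈ smallEntries) w → InD w → AvoidsAll w →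
                   Any (λ gs → w ≡ vec (toℕ n) gs) (smallWords n)
  small-avoiding = from-yes table?
    where
    table? : Dec (∀ n (w : Vec ℤ (toℕ n)) → VecAll.All (_∈ smallEntries) w → InD w → AvoidsAll w →
                  Any (λ gs → w ≡ vec (toℕ n) gs) (smallWords n))
    table? = Fin.all? λ n → allVec? {n = toℕ n} smallEntries
      {P = λ w → InD w → AvoidsAll w → Any (λ gs → w ≡ vec (toℕ n) gs) (smallWords n)}
      λ w → inD? w →-dec (avoidsAll? w →-dec Any.any? (λ gs → Vec.≡-dec ℤ._≟_ w (vec (toℕ n) gs)) (smallWords n))

∈-smallEntries : ∀ {x} → 1 ℕ.≤ ∣ x ∣ → ∣ x ∣ ℕ.≤ 3 → x ∈ smallEntries
∈-smallEntries {+ 1} _ _ = here refl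
∈-smallEntries {+ 2} _ _ = there (here refl)
∈-smallEntries {+ 3} _ _ = there (there (here refl))
∈-smallEntries {+ suc (suc (suc (suc _)))} _ (s≤s (s≤s (s≤s ())))
∈-smallEntries { -[1+ 0 ]} _ _ = there (there (there (here refl)))
∈-smallEntries { -[1+ 1 ]} _ _ = there (there (there (there (here refl))))
∈-smallEntries { -[1+ 2 ]} _ _ = there (there (there (there (there (here refl)))))
∈-smallEntries { -[1+ suc (suc (suc _)) ]} _ (s≤s (s≤s (s≤s ())))

word-small : ∀ m → FindsUniqueWords (toℕ {4} m)
word-small m {f} P s A =
  result (find (small-avoiding m w
  (VecAll.tabulate⁺ (λ k → subst (_∈ smallEntries) (Vec.lookup∘tabulate _ k) (members k))) D avoids))
  where
  n = toℕ m
  w : Vec ℤ n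
  w = tabulate (entries f ∘ toℕ)
  D : InD w
  D = Perm⇒InD n P s
  members : ∀ k → lookup w k ∈ smallEntries
  members k with All-lookup w (proj₁ (proj₁ D)) k
  ... | u , v = ∈-smallEntries u (ℕ.≤-trans v (ℕ.≤-pred (Fin.toℕ<n m)))
  avoids : AvoidsAll w
  avoids = All.map (λ av c → av (Occ-cong (λ i<n → sym (apply-tabulate n f i<n)) (contains⇒occ c))) A
  result : (∃ λ gs → gs ∈ smallWords m × w ≡ vec n gs) → UniqueWord n f
  result (gs , m∈ , e) with All.lookup (smallWords-unique m) m∈
  ... | L , U =
    gs , L , U , λ {i} b →
    trans (sym (apply-tabulate n f b)) (trans (cong (λ v → apply v (+ suc i)) e) (apply-tabulate n (ev gs) b))

avoids⇒unique : ∀ n → FindsUniqueWords n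
avoids⇒unique 0 = word-small (# 0)
avoids⇒unique 1 = word-small (# 1)
avoids⇒unique 2 = word-small (# 2)
avoids⇒unique 3 = word-small (# 3)
avoids⇒unique (suc (suc (suc (suc n)))) = word-step (suc (suc n)) (avoids⇒unique (suc (suc (suc n)))) (s≤s (s≤s z≤n))

-- The equivalence

vec-unique-avoids : ∀ n gs → Letters n gs → Unique gs → AvoidsAll (vec n gs)
vec-unique-avoids n gs L U =
  All.map (λ av c → av (Occ-cong (λ i<n → sym (apply-tabulate n (ev gs) i<n)) (contains⇒occ c)))
  (unique⇒avoids n gs L U)

avoids⇒uniqueWord : ∀ n (w : Vec ℤ n) → InD w → AvoidsAll w → ∃ λ gs → Letters n gs × Unique gs × w ≡ vec n gs
avoids⇒uniqueWord n w (S , even) A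
  with avoids⇒unique n (signedPerm⇒Perm w S) (trans (sgn-parity w) (even⇒+ (negCount w) even))
    (All.map (_∘ occ⇒contains) A)
... | gs , L , U , e = gs , L , U , trans (sym (Vec.tabulate∘lookup w))
  (Vec.tabulate-cong (λ k → trans (sym (apply-lookup w k)) (e (Fin.toℕ<n k))))

-- Constructively a shortest word exists only up to double negation, which is enough to refute a statement.
shortest-word : ∀ {n} gs → Letters n gs → ¬ ¬ (∃ λ hs → Reduced n hs × vec n gs ≡ vec n hs)
shortest-word {n} gs L none = go (length gs) gs L refl ℕ.≤-refl
  where
  go : ∀ m hs → Letters n hs → vec n gs ≡ vec n hs → length hs ℕ.≤ m → ⊥
  go m hs M e b = none (hs , (M , shorter m b) , e)
    where
    shorter : ∀ m → length hs ℕ.≤ m → ∀ ks → Letters n ks → (∀ x → ev hs x ≡ ev ks x) → length hs ℕ.≤ length ks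
    shorter zero    b ks K e′ = ℕ.≤-trans b z≤n
    shorter (suc m) b ks K e′ with length hs ℕ.≤? length ks
    ... | yes p = p
    ... | no p = ⊥-elim (go m ks K (trans e (vec-cong n {hs} {ks} e′)) (ℕ.≤-pred (ℕ.≤-trans (ℕ.≰⇒> p) b)))

boolean⇒avoids : ∀ n (w : Vec ℤ n) → InD w → BooleanIdeal w → AvoidsAll w
boolean⇒avoids n w D B with InD⇒word w D
... | gs , L , refl = All.tabulate λ {p} p∈ c → shortest-word gs L λ (hs , R , e) →
  All.lookup (vec-unique-avoids n hs (proj₁ R) (boolean⇒unique n hs R (subst BooleanIdeal e B))) p∈
    (subst (λ v → Contains v (proj₂ p)) e c)

avoids⇒boolean : ∀ n (w : Vec ℤ n) → InD w → AvoidsAll w → BooleanIdeal w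
avoids⇒boolean n w D A with avoids⇒uniqueWord n w D A
... | gs , L , U , refl = unique⇒boolean n gs L U

theorem8p7 : (n : ℕ) (w : Vec ℤ n) → InD w → (BooleanIdeal w ⇔ AvoidsAll w)
theorem8p7 n w D = mk⇔ (boolean⇒avoids n w D) (avoids⇒boolean n w D)
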